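{- Let $n$ be a positive integer. There exists a bicrucial permutation of length $n$ if and only if one of the following holds: $n=9$; or $n$ is odd and $n\geq 13$; or $n$ is even, $n\geq 32$ and $n\neq 38$.
   Context: A permutation $\sigma$ of length $n$ is a permutation of $\{0,\dots,n-1\}$, written as a vector $(\sigma_0,\sigma_1,\dots,\sigma_{n-1})$ with $\sigma_i=\sigma(i)$. Two vectors $a=(a_1,\dots,a_m)$ and $b=(b_1,\dots,b_m)$ of the same length, each consisting of distinct real numbers, are order-isomorphic, written $a\sim b$, if they have the same pattern, i.e. for all $i,j$ we have $a_i<a_j$ if and only if $b_i<b_j$. A square of length $2\ell$ (where $\ell\geq 2$) in $\sigma$ is a factor (block of consecutive entries) $(S_1;S_2)=(\sigma_k,\dots,\sigma_{k+\ell-1};\sigma_{k+\ell},\dots,\sigma_{k+2\ell-1})$ with $S_1\sim S_2$. A permutation is square-free if it contains no square of length at least $4$, i.e. no square with $\ell\geq 2$ (squares with $\ell=1$ are trivial and are ignored). A right-extension of a permutation $\sigma$ of length $n$ is a permutation $\pi$ of length $n+1$ with $(\pi_0,\dots,\pi_{n-1})\sim\sigma$; equivalently, $\pi$ is formed by appending some $x\in\{0,\dots,n\}$ to the end of $\sigma$ and replacing each $\sigma_i\geq x$ by $\sigma_i+1$. A left-extension of $\sigma$ is a permutation $\pi$ of length $n+1$ with $(\pi_1,\dots,\pi_n)\sim\sigma$; equivalently, $\pi$ is formed by prepending some $x\in\{0,\dots,n\}$ and replacing each $\sigma_i\geq x$ by $\sigma_i+1$. A permutation $\sigma$ is right-crucial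 if it is square-free and every right-extension of $\sigma$ contains a square (of length at least $4$). It is left-crucial if it is square-free and every left-extension of $\sigma$ contains a square (of length at least $4$). It is bicrucial if it is both left-crucial and right-crucial. -}

module Defs where

open import Data.Fin.Base using (Fin; suc; toℕ; inject₁; inject≤; _↑ʳ_)
open import Data.Fin.Permutation using (Permutation′; _⟨$⟩ʳ_)
open import Data.Nat.Base using (ℕ; suc; _+_; _≤_; _<_)
open import Data.Nat.Properties using (≤-trans; m≤m+n)
open import Data.Product.Base using (Σ-syntax; ∃-syntax; _×_)
open import Data.Vec.Functional using (Vector)
open import Function.Base using (_∘_)
open import Function.Bundles using (_⇔_)
open import Relation.Nullary.Negation.Core using (¬_)

private
  variable
    m n : ℕ

infix 4 _∼_

-- Order-isomorphism.  It is only ever applied to vectors of distinct entries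
-- (blocks of permutations), whose entries here are natural numbers.
_∼_ : Vector ℕ m → Vector ℕ m → Set
a ∼ b = ∀ i j → a i < a j ⇔ b i < b j

word : Permutation′ n → Vector ℕ n
word σ i = toℕ (σ ⟨$⟩ʳ i)

-- The block (w k , … , w (k + ℓ - 1)).
factor : Vector ℕ n → (k ℓ : ℕ) → k + ℓ ≤ n → Vector ℕ ℓ
factor w k ℓ k+ℓ≤n i = w (inject≤ (k ↑ʳ i) k+ℓ≤n)

-- Only squares of length 2ℓ with ℓ ≥ 2 count: every two adjacent entries form
-- a trivial square.
ContainsSquare : Permutation′ n → Set
ContainsSquare {n} σ =
  ∃[ k ] ∃[ ℓ ] 2 ≤ ℓ × Σ[ fits ∈ k + ℓ + ℓ ≤ n ]
    factor (word σ) k ℓ (≤-trans (m≤m+n (k + ℓ) ℓ) fits)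
      ∼ factor (word σ) (k + ℓ) ℓ fits

SquareFree : Permutation′ n → Set
SquareFree σ = ¬ ContainsSquare σ

IsRightExtension : Permutation′ n → Permutation′ (suc n) → Set
IsRightExtension σ π = word π ∘ inject₁ ∼ word σ

IsLeftExtension : Permutation′ n → Permutation′ (suc n) → Set
IsLeftExtension σ π = word π ∘ suc ∼ word σ

RightCrucial : Permutation′ n → Set
RightCrucial σ = SquareFree σ × (∀ π → IsRightExtension σ π → ContainsSquare π)

LeftCrucial : Permutation′ n → Set
LeftCrucial σ = SquareFree σ × (∀ π → IsLeftExtension σ π → ContainsSquare π)

Bicrucial : Permutation′ n → Set
Bicrucial σ = LeftCrucial σ × RightCrucial σ

{-# OPTIONS --safe #-}
module Submission where

-- Read the entries e₁, e₂, … from an end, with a new entry e₀ in front, say e₀ > e₁.  In a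
-- square-free permutation ups and downs alternate in pairs, and for i of suitable parity the
-- comparisons of e_i with e_{i+2} are reversed by a shift of 4.  Hence a new square has ℓ = 4
-- or 8 ∣ ℓ, and e₀ > e₁ is free of ℓ = 2 only if e₂ < e₃.
--
-- Call the end hard if e₁ < e₂ and easy if e₁ > e₂.  At a hard end an ℓ serves only one of the
-- gaps (e₁,e₂), (e₂,e₃), (e₃,∞), so three values 4, 8, 16 are needed and n ≥ 31; the first gap
-- must be served by 4.  An even length has one hard and one easy end.  For n = 38 the easy end
-- would need ℓ = 8 or 16 for an entry above all others, which contradicts e₇ < e₃ through the
-- matches of the hard end.  If both ends are easy and n < 15, only ℓ = 4 is available, which
-- forces e₁ > e₃ and e₅ > e₇ at both ends, impossible for n = 7, 11.
--
-- For existence take an infinite square-free sequence with a crucial beginning, either a hard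
-- one of 31 entries or an easy one, and modify a few entries at the other end.

open import Defs
open import Data.Bool.Base using (Bool; true; false; T; _∧_; _∨_; not; if_then_else_)
open import Data.Bool.Properties using (T-∧; T-∨; T-≡; not-involutive; ¬-not)
open import Data.Empty using (⊥; ⊥-elim)
open import Data.Fin.Base using (Fin; zero; suc; toℕ; fromℕ; fromℕ<; inject₁; punchIn; punchOut; _↑ʳ_)
open import Data.Fin.Patterns using (0F; 1F; 2F; 3F; 4F; 5F; 6F; 7F)
open import Data.Fin.Permutation using (Permutation; Permutation′; _⟨$⟩ʳ_; _⟨$⟩ˡ_; inverseˡ; insert; insert-punchIn; id)
open import Data.Fin.Properties using (toℕ-fromℕ<; toℕ-inject≤; toℕ-↑ʳ; toℕ-injective; toℕ<n; toℕ-fromℕ; toℕ-inject₁; punchIn-punchOut; punchIn-injective)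
import Data.Fin.Properties as Fin
open import Data.List.Base using (List; []; _∷_; length)
open import Data.Nat.Base
open import Data.Nat.DivMod using (DivMod; _divMod_; result)
open import Data.Nat.Divisibility using (_∣_; _∤_; _∣?_; divides)
open import Data.Nat.Induction using (<-rec)
open import Data.Nat.Properties
open import Data.Nat.Tactic.RingSolver using (solve-∀)
open import Data.Product.Base using (Σ-syntax; ∃-syntax; _×_; _,_; proj₁; proj₂)
open import Data.Sum.Base using (_⊎_; inj₁; inj₂; swap)
open import Data.Unit.Base using (⊤; tt)
open import Data.Vec.Functional using (Vector)
open import Function.Base using (_∘_)
open import Function.Bundles using (_⇔_; mk⇔; module Equivalence)
open import Relation.Binary.Definitions using (tri<; tri≈; tri>)
open import Relation.Binary.PropositionalEquality
open import Relation.Nullary using (¬_; yes; no; contradiction)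
open import Relation.Nullary.Decidable.Core using (Dec)
open Equivalence using (to; from)

-- Square-freeness of an infinite sequence concerns all ℓ at once, so it has to come from
-- comparisons that recur throughout. Ups and downs of period 4 break every ℓ not divisible by 4;
-- comparisons at distance two, reversed by a shift of 4, break ℓ = 12, 20, 28 and so on. In blocks
-- of eight, one comparison alternates from block to block and breaks odd ℓ / 8. Another follows the
-- paperfolding sequence and breaks even ℓ / 8, because for every even shift d > 0 any d consecutive
-- indices contain one whose fold is flipped by d. Changing the far end disturbs only a bounded
-- window, decided by evaluation for all values of the bits it depends on. Longer squares that reach
-- into it are broken by one reversed comparison of peaks. Since the sequence comes in blocks of
-- eight, a family advances in steps of 8; hence several heads, and some small lengths treated
-- singly. The impossibility proofs work up to reversal of the order, so that e₂ < e₃ may be assumed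
-- at an end. The price is that the two ends may be oriented oppositely.

private
  variable
    n : ℕ

-- Words as sequences of natural numbers

at : Vector ℕ n → ℕ → ℕ
at {zero}  w _       = 0
at {suc n} w zero    = w zero
at {suc n} w (suc i) = at (w ∘ suc) i

at-toℕ : (w : Vector ℕ n) (i : Fin n) → at w (toℕ i) ≡ w i
at-toℕ w zero    = refl
at-toℕ w (suc i) = at-toℕ (w ∘ suc) i

at-< : (w : Vector ℕ n) {i : ℕ} (i<n : i < n) → at w i ≡ w (fromℕ< i<n)
at-< w i<n = trans (cong (at w) (sym (toℕ-fromℕ< i<n))) (at-toℕ w (fromℕ< i<n))

at-factor : (w : Vector ℕ n) (k ℓ : ℕ) (fits : k + ℓ ≤ n) (i : Fin ℓ) →
            factor w k ℓ fits i ≡ at w (k + toℕ i)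
at-factor w k ℓ fits i = trans (sym (at-toℕ w _))
  (cong (at w) (trans (toℕ-inject≤ (k ↑ʳ i) fits) (toℕ-↑ʳ k i)))

Square : (ℕ → ℕ) → ℕ → ℕ → Set
Square f k ℓ = ∀ a b → a < ℓ → b < ℓ →
  f (k + a) < f (k + b) ⇔ f (k + ℓ + a) < f (k + ℓ + b)

HasSquare : (ℕ → ℕ) → ℕ → Set
HasSquare f n = ∃[ k ] ∃[ ℓ ] 2 ≤ ℓ × k + ℓ + ℓ ≤ n × Square f k ℓ

containsSquare⇒ : (σ : Permutation′ n) → ContainsSquare σ → HasSquare (at (word σ)) n
containsSquare⇒ σ (k , ℓ , 2≤ℓ , fits , sim) = k , ℓ , 2≤ℓ , fits , square
  where
  first : k + ℓ ≤ _
  first = ≤-trans (m≤m+n (k + ℓ) ℓ) fits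
  at₁ : ∀ {a} (a<ℓ : a < ℓ) → factor (word σ) k ℓ first (fromℕ< a<ℓ) ≡ at (word σ) (k + a)
  at₁ a<ℓ = trans (at-factor (word σ) k ℓ first _) (cong (λ j → at (word σ) (k + j)) (toℕ-fromℕ< a<ℓ))
  at₂ : ∀ {a} (a<ℓ : a < ℓ) → factor (word σ) (k + ℓ) ℓ fits (fromℕ< a<ℓ) ≡ at (word σ) (k + ℓ + a)
  at₂ a<ℓ = trans (at-factor (word σ) (k + ℓ) ℓ fits _) (cong (λ j → at (word σ) (k + ℓ + j)) (toℕ-fromℕ< a<ℓ))
  square : Square (at (word σ)) k ℓ
  square a b a<ℓ b<ℓ = subst₂ _⇔_ (cong₂ _<_ (at₁ a<ℓ) (at₁ b<ℓ)) (cong₂ _<_ (at₂ a<ℓ) (at₂ b<ℓ))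
    (sim (fromℕ< a<ℓ) (fromℕ< b<ℓ))

containsSquare⇐ : (σ : Permutation′ n) → HasSquare (at (word σ)) n → ContainsSquare σ
containsSquare⇐ σ (k , ℓ , 2≤ℓ , fits , square) = k , ℓ , 2≤ℓ , fits , λ i j →
  subst₂ _⇔_ (cong₂ _<_ (sym (at-factor (word σ) k ℓ first i)) (sym (at-factor (word σ) k ℓ first j)))
             (cong₂ _<_ (sym (at-factor (word σ) (k + ℓ) ℓ fits i)) (sym (at-factor (word σ) (k + ℓ) ℓ fits j)))
             (square (toℕ i) (toℕ j) (toℕ<n i) (toℕ<n j))
  where
  first : k + ℓ ≤ _
  first = ≤-trans (m≤m+n (k + ℓ) ℓ) fits

-- Reflection exchanges the two halves and turns offset `c` into `ℓ ∸ suc c`, so the equivalence is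
-- used backwards. This reduces right ends to left ends.
mirrorSquare : ∀ {N K i ℓ} (r w : ℕ → ℕ) → (∀ p q → p + q ≡ N → r p ≡ w q) →
               i + K + ℓ + ℓ ≡ suc N → Square r i ℓ → Square w K ℓ
mirrorSquare {N} {K} {i} {ℓ} r w mirror total square a b a<ℓ b<ℓ =
  mk⇔ (λ lt → subst₂ _<_ (second a<ℓ) (second b<ℓ) (from sq (subst₂ _<_ (sym (first a<ℓ)) (sym (first b<ℓ)) lt)))
      (λ lt → subst₂ _<_ (first a<ℓ) (first b<ℓ) (to sq (subst₂ _<_ (sym (second a<ℓ)) (sym (second b<ℓ)) lt)))
  where
  <ℓ : ∀ {c} → c < ℓ → ℓ ∸ suc c < ℓ
  <ℓ {c} c<ℓ = ∸-monoʳ-< {ℓ} {suc c} {0} (s≤s z≤n) c<ℓ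
  sq = square (ℓ ∸ suc a) (ℓ ∸ suc b) (<ℓ a<ℓ) (<ℓ b<ℓ)
  second : ∀ {c} → c < ℓ → r (i + (ℓ ∸ suc c)) ≡ w (K + ℓ + c)
  second {c} c<ℓ = mirror _ _ (suc-injective (trans (eq i K ℓ c (ℓ ∸ suc c))
    (trans (cong (i + K + ℓ +_) (m+[n∸m]≡n c<ℓ)) total)))
    where
    eq : ∀ i K ℓ c d → suc ((i + d) + (K + ℓ + c)) ≡ i + K + ℓ + (suc c + d)
    eq = solve-∀
  first : ∀ {c} → c < ℓ → r (i + ℓ + (ℓ ∸ suc c)) ≡ w (K + c)
  first {c} c<ℓ = mirror _ _ (suc-injective (trans (eq i K ℓ c (ℓ ∸ suc c))
    (trans (cong (i + K + ℓ +_) (m+[n∸m]≡n c<ℓ)) total)))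
    where
    eq : ∀ i K ℓ c d → suc ((i + ℓ + d) + (K + c)) ≡ i + K + ℓ + (suc c + d)
    eq = solve-∀

-- Crucial ends, and the permutation that ranks a sequence

cons : ℕ → (ℕ → ℕ) → ℕ → ℕ
cons x e zero    = x
cons x e (suc i) = e i

-- One implication only: ties of `f` stay open, so a coarse sequence of levels stands for everything
-- that refines it.
Follows : ℕ → (ℕ → ℕ) → (ℕ → ℕ) → Set
Follows n f e = ∀ i j → i < n → j < n → f i < f j → e i < e j

-- Extensions are taken up to order, with any fresh `x`; no renumbering of old entries is involved.
EndCrucial : ℕ → (ℕ → ℕ) → Set
EndCrucial n f = ∀ e x → Follows n f e → (∀ i → i < n → e i ≢ x) →
  ∃[ ℓ ] 2 ≤ ℓ × ℓ + ℓ ≤ suc n × Square (cons x e) 0 ℓ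

-- Both comparisons are strict, so the obstruction persists under `Follows`.
Break : (ℕ → ℕ) → ℕ → ℕ → Set
Break f i ℓ = ∃[ a ] ∃[ b ] a < ℓ × b < ℓ × f (i + a) < f (i + b) × f (i + ℓ + b) < f (i + ℓ + a)

maximum : ∀ {m} (f : Fin (suc m) → ℕ) → Σ[ i ∈ Fin (suc m) ] (∀ j → f j ≤ f i)
maximum {zero}  f = zero , λ { zero → ≤-refl }
maximum {suc m} f with maximum (f ∘ suc)
... | i , max with ≤-total (f zero) (f (suc i))
...   | inj₁ le = suc i , λ { zero → le ; (suc j) → max j }
...   | inj₂ ge = zero , λ { zero → ≤-refl ; (suc j) → ≤-trans (max j) ge }

insert-self : ∀ {m n} (i : Fin (suc m)) j (π : Permutation m n) → insert i j π ⟨$⟩ʳ i ≡ j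
insert-self i j π with i Fin.≟ i
... | yes _ = refl
... | no i≢i = contradiction refl i≢i

punchIn-fromℕ : ∀ {n} (i : Fin n) → toℕ (punchIn (fromℕ n) i) ≡ toℕ i
punchIn-fromℕ zero    = refl
punchIn-fromℕ (suc i) = cong suc (punchIn-fromℕ i)

-- The position of the maximum receives the value `n`; the other positions are ranked recursively
-- and keep their values.
standardise : ∀ n (f : Fin n → ℕ) → (∀ {i j} → f i ≡ f j → i ≡ j) →
              Σ[ σ ∈ Permutation′ n ] (∀ i j → f i < f j → word σ i < word σ j)
standardise zero    f inj = id , λ ()
standardise (suc n) f inj with maximum f
... | m , max with standardise n (f ∘ punchIn m) (λ eq → punchIn-injective m _ _ (inj eq))
...   | σ , mono = τ , mono′
  where
  τ : Permutation′ (suc n)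
  τ = insert m (fromℕ n) σ
  word-m : word τ m ≡ n
  word-m = trans (cong toℕ (insert-self m (fromℕ n) σ)) (toℕ-fromℕ n)
  word-punchIn : ∀ k → word τ (punchIn m k) ≡ word σ k
  word-punchIn k = trans (cong toℕ (insert-punchIn m (fromℕ n) σ k)) (punchIn-fromℕ (σ ⟨$⟩ʳ k))
  punched : ∀ i → i ≢ m → ∃[ k ] punchIn m k ≡ i
  punched i i≢m = punchOut (i≢m ∘ sym) , punchIn-punchOut (i≢m ∘ sym)
  mono′ : ∀ i j → f i < f j → word τ i < word τ j
  mono′ i j lt with i Fin.≟ m
  ... | yes refl = contradiction (max j) (<⇒≱ lt)
  ... | no i≢m with punched i i≢m
  ...   | k , refl with j Fin.≟ m
  ...     | yes refl = subst₂ _<_ (sym (word-punchIn k)) (sym word-m) (toℕ<n (σ ⟨$⟩ʳ k))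
  ...     | no j≢m with punched j j≢m
  ...       | l , refl = subst₂ _<_ (sym (word-punchIn k)) (sym (word-punchIn l)) (mono k l lt)

word-injective : (σ : Permutation′ n) {i j : Fin n} → word σ i ≡ word σ j → i ≡ j
word-injective σ eq = trans (sym (inverseˡ σ)) (trans (cong (σ ⟨$⟩ˡ_) (toℕ-injective eq)) (inverseˡ σ))

module _ (n : ℕ) (f : ℕ → ℕ)
         (injective : ∀ i j → i < n → j < n → f i ≡ f j → i ≡ j)
         (broken : ∀ i ℓ → 2 ≤ ℓ → i + ℓ + ℓ ≤ n → Break f i ℓ)
         (leftEnd : EndCrucial n f) (rightEnd : EndCrucial n (λ i → f (n ∸ suc i))) where

  private
    standard = standardise n (f ∘ toℕ) (λ {i} {j} eq → toℕ-injective (injective _ _ (toℕ<n i) (toℕ<n j) eq))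
    σ = proj₁ standard
    w = at (word σ)

    follows : Follows n f w
    follows i j i<n j<n lt = subst₂ _<_ (sym (at-< (word σ) i<n)) (sym (at-< (word σ) j<n))
      (proj₂ standard _ _ (subst₂ _<_ (cong f (sym (toℕ-fromℕ< i<n))) (cong f (sym (toℕ-fromℕ< j<n))) lt))

    squareFree : SquareFree σ
    squareFree contains with containsSquare⇒ σ contains
    ... | k , ℓ , 2≤ℓ , fits , square with broken k ℓ 2≤ℓ fits
    ...   | a , b , a<ℓ , b<ℓ , lt , gt = <-asym
      (to (square a b a<ℓ b<ℓ) (follows _ _ (inside₁ a<ℓ) (inside₁ b<ℓ) lt))
      (follows _ _ (inside₂ b<ℓ) (inside₂ a<ℓ) gt)
      where
      inside₂ : ∀ {c} → c < ℓ → k + ℓ + c < n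
      inside₂ c<ℓ = <-≤-trans (+-monoʳ-< (k + ℓ) c<ℓ) fits
      inside₁ : ∀ {c} → c < ℓ → k + c < n
      inside₁ {c} c<ℓ = ≤-<-trans (+-monoˡ-≤ c (m≤m+n k ℓ)) (inside₂ c<ℓ)

    left : ∀ π → IsLeftExtension σ π → ContainsSquare π
    left π ext with leftEnd (at (word π) ∘ suc) (at (word π) 0)
        (λ i j i<n j<n lt → ext′ i j i<n j<n (follows i j i<n j<n lt)) fresh
      where
      v = at (word π)
      ext′ : Follows n w (v ∘ suc)
      ext′ i j i<n j<n lt = subst₂ _<_ (sym (at-< (word π ∘ suc) i<n)) (sym (at-< (word π ∘ suc) j<n))
        (from (ext (fromℕ< i<n) (fromℕ< j<n)) (subst₂ _<_ (at-< (word σ) i<n) (at-< (word σ) j<n) lt))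
      fresh : ∀ i → i < n → v (suc i) ≢ v 0
      fresh i i<n eq with () ← word-injective π {suc (fromℕ< i<n)} {zero} (trans (sym (at-< (word π ∘ suc) i<n)) eq)
    ... | ℓ , 2≤ℓ , fits , square = containsSquare⇐ π (0 , ℓ , 2≤ℓ , fits , λ a b a<ℓ b<ℓ →
        subst₂ _⇔_ (cong₂ _<_ (same a) (same b)) (cong₂ _<_ (same (ℓ + a)) (same (ℓ + b))) (square a b a<ℓ b<ℓ))
      where
      same : ∀ i → cons (at (word π) 0) (at (word π) ∘ suc) i ≡ at (word π) i
      same zero    = refl
      same (suc i) = refl

    right : ∀ π → IsRightExtension σ π → ContainsSquare π
    right π ext with rightEnd (λ i → at (word π) (n ∸ suc i)) (at (word π) n) ext″ fresh
      where
      v = at (word π)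
      at-inject₁ : ∀ {i} (i<n : i < n) → v i ≡ word π (inject₁ (fromℕ< i<n))
      at-inject₁ i<n = trans (cong v (sym (trans (toℕ-inject₁ _) (toℕ-fromℕ< i<n)))) (at-toℕ (word π) _)
      at-last : v n ≡ word π (fromℕ n)
      at-last = trans (cong v (sym (toℕ-fromℕ n))) (at-toℕ (word π) (fromℕ n))
      ext′ : Follows n w v
      ext′ i j i<n j<n lt = subst₂ _<_ (sym (at-inject₁ i<n)) (sym (at-inject₁ j<n))
        (from (ext (fromℕ< i<n) (fromℕ< j<n)) (subst₂ _<_ (at-< (word σ) i<n) (at-< (word σ) j<n) lt))
      n∸suc<n : ∀ {i} → i < n → n ∸ suc i < n
      n∸suc<n {i} i<n = ∸-monoʳ-< {n} {suc i} {0} (s≤s z≤n) i<n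
      ext″ : Follows n (λ i → f (n ∸ suc i)) (λ i → v (n ∸ suc i))
      ext″ i j i<n j<n lt = ext′ _ _ (n∸suc<n i<n) (n∸suc<n j<n) (follows _ _ (n∸suc<n i<n) (n∸suc<n j<n) lt)
      fresh : ∀ i → i < n → v (n ∸ suc i) ≢ v n
      fresh i i<n eq = <⇒≢ (n∸suc<n i<n) (trans (sym (toℕ-fromℕ< (n∸suc<n i<n)))
        (trans (sym (toℕ-inject₁ _)) (trans (cong toℕ
          (word-injective π (trans (sym (at-inject₁ (n∸suc<n i<n))) (trans eq at-last)))) (toℕ-fromℕ n))))
    ... | ℓ , 2≤ℓ , fits , square = containsSquare⇐ π
      (K , ℓ , 2≤ℓ , ≤-reflexive total , mirrorSquare {K = K} {i = 0} r v mirror total square)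
      where
      v = at (word π)
      r = cons (v n) (λ i → v (n ∸ suc i))
      K = suc n ∸ (ℓ + ℓ)
      total : K + ℓ + ℓ ≡ suc n
      total = trans (+-assoc K ℓ ℓ) (m∸n+n≡m fits)
      mirror : ∀ p q → p + q ≡ n → r p ≡ v q
      mirror zero    q eq   = cong v (sym eq)
      mirror (suc p) q refl = cong v (m+n∸m≡n (suc p) q)

  build : Σ[ σ ∈ Permutation′ n ] Bicrucial σ
  build = σ , (squareFree , left) , (squareFree , right)

∧⁻ : ∀ {x y} → T (x ∧ y) → T x × T y
∧⁻ = to T-∧

∨⁻ : ∀ {x y} → T (x ∨ y) → T x ⊎ T y
∨⁻ = to T-∨

-- Decision procedures for finite sequences

T-not : ∀ {x} → T (not x) → ¬ T x
T-not {false} _ ()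

all< any< : ℕ → (ℕ → Bool) → Bool
all< zero    p = true
all< (suc n) p = p n ∧ all< n p
any< zero    p = false
any< (suc n) p = p n ∨ any< n p

all<-sound : ∀ n {p} → T (all< n p) → ∀ i → i < n → T (p i)
all<-sound (suc n) ps i i<1+n with ∧⁻ ps | m≤n⇒m<n∨m≡n (s≤s⁻¹ i<1+n)
... | _  , ps′ | inj₁ i<n  = all<-sound n ps′ i i<n
... | pn , _   | inj₂ refl = pn

any<-sound : ∀ n {p} → T (any< n p) → ∃[ i ] i < n × T (p i)
any<-sound (suc n) ps with ∨⁻ ps
... | inj₁ pn  = n , ≤-refl , pn
... | inj₂ ps′ with any<-sound n ps′
...   | i , i<n , pi = i , m≤n⇒m≤1+n i<n , pi

broken? : (ℕ → ℕ) → ℕ → ℕ → Bool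
broken? g i ℓ = any< ℓ λ a → any< ℓ λ b → (g (i + a) <ᵇ g (i + b)) ∧ (g (i + ℓ + b) <ᵇ g (i + ℓ + a))

broken?-sound : ∀ g i ℓ → T (broken? g i ℓ) → Break g i ℓ
broken?-sound g i ℓ t with any<-sound ℓ t
... | a , a<ℓ , t′ with any<-sound ℓ t′
...   | b , b<ℓ , t″ = a , b , a<ℓ , b<ℓ , <ᵇ⇒< _ _ (proj₁ (∧⁻ t″)) ,
        <ᵇ⇒< _ _ (proj₂ (∧⁻ {g (i + a) <ᵇ g (i + b)} t″))

-- The lexicographic order of level and position, as a two-digit number to base `n`. Levels may
-- repeat, entries may not.
key : ℕ → (ℕ → ℕ) → ℕ → ℕ
key n g i = g i * n + i

-- Equal levels are ordered by position.
Lt : (ℕ → ℕ) → ℕ → ℕ → Set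
Lt g i j = g i < g j ⊎ (g i ≡ g j × i < j)

key-mono : ∀ n g {i j} → i < n → Lt g i j → key n g i < key n g j
key-mono n g {i} {j} i<n (inj₁ lt) = begin-strict
  g i * n + i   <⟨ +-monoʳ-< (g i * n) i<n ⟩
  g i * n + n   ≡⟨ +-comm (g i * n) n ⟩
  suc (g i) * n ≤⟨ *-monoˡ-≤ n lt ⟩
  g j * n       ≤⟨ m≤m+n (g j * n) j ⟩
  g j * n + j   ∎
  where open ≤-Reasoning
key-mono n g {i} {j} i<n (inj₂ (eq , lt)) rewrite eq = +-monoʳ-< (g j * n) lt

Lt-total : ∀ g i j → i ≢ j → Lt g i j ⊎ Lt g j i
Lt-total g i j i≢j with <-cmp (g i) (g j) | <-cmp i j
... | tri< lt _ _ | _           = inj₁ (inj₁ lt)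
... | tri> _ _ gt | _           = inj₂ (inj₁ gt)
... | tri≈ _ eq _ | tri< lt _ _ = inj₁ (inj₂ (eq , lt))
... | tri≈ _ eq _ | tri≈ _ e _  = contradiction e i≢j
... | tri≈ _ eq _ | tri> _ _ gt = inj₂ (inj₂ (sym eq , gt))

key-injective : ∀ n g i j → i < n → j < n → key n g i ≡ key n g j → i ≡ j
key-injective n g i j i<n j<n eq with i ≟ j
... | yes e = e
... | no i≢j with Lt-total g i j i≢j
...   | inj₁ l = contradiction eq (<⇒≢ (key-mono n g i<n l))
...   | inj₂ l = contradiction (sym eq) (<⇒≢ (key-mono n g j<n l))

agree? : (ℕ → ℕ) → ℕ → Bool
agree? y ℓ = all< ℓ λ a → all< a λ b →
  ((y b <ᵇ y a) ∧ (y (ℓ + b) <ᵇ y (ℓ + a))) ∨ ((y a <ᵇ y b) ∧ (y (ℓ + a) <ᵇ y (ℓ + b)))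

SameOrder : (ℕ → ℕ) → ℕ → ℕ → ℕ → Set
SameOrder z ℓ a b = (z a < z b × z (ℓ + a) < z (ℓ + b)) ⊎ (z b < z a × z (ℓ + b) < z (ℓ + a))

sameOrder⇒⇔ : ∀ {z ℓ a b} → SameOrder z ℓ a b → z a < z b ⇔ z (ℓ + a) < z (ℓ + b)
sameOrder⇒⇔ (inj₁ (p , q)) = mk⇔ (λ _ → q) (λ _ → p)
sameOrder⇒⇔ (inj₂ (p , q)) = mk⇔ (λ lt → contradiction p (<-asym lt)) (λ lt → contradiction q (<-asym lt))

agree?-sound : ∀ {y z ℓ m} → T (agree? y ℓ) → ℓ + ℓ ≤ suc m →
               (∀ a b → a ≤ m → b ≤ m → y a < y b → z a < z b) → Square z 0 ℓ
agree?-sound {y} {z} {ℓ} {m} t fits mono = square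
  where
  inside : ∀ {c} → c < ℓ → ℓ + c ≤ m
  inside {c} c<ℓ = s≤s⁻¹ (≤-trans (+-monoʳ-< ℓ c<ℓ) fits)
  transfer : ∀ {a b} → a < ℓ → b < ℓ → y a < y b × y (ℓ + a) < y (ℓ + b) → z a < z b × z (ℓ + a) < z (ℓ + b)
  transfer a<ℓ b<ℓ (p , q) = mono _ _ (≤-trans (m≤n+m _ ℓ) (inside a<ℓ)) (≤-trans (m≤n+m _ ℓ) (inside b<ℓ)) p ,
                             mono _ _ (inside a<ℓ) (inside b<ℓ) q
  same : ∀ a b → a < ℓ → b < ℓ → b < a → SameOrder z ℓ b a
  same a b a<ℓ b<ℓ b<a with ∨⁻ {(y b <ᵇ y a) ∧ (y (ℓ + b) <ᵇ y (ℓ + a))} (all<-sound a (all<-sound ℓ t a a<ℓ) b b<a)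
  ... | inj₁ p = inj₁ (transfer b<ℓ a<ℓ (<ᵇ⇒< _ _ (proj₁ (∧⁻ p)) , <ᵇ⇒< _ _ (proj₂ (∧⁻ {y b <ᵇ y a} p))))
  ... | inj₂ p = inj₂ (transfer a<ℓ b<ℓ (<ᵇ⇒< _ _ (proj₁ (∧⁻ p)) , <ᵇ⇒< _ _ (proj₂ (∧⁻ {y a <ᵇ y b} p))))
  square : Square z 0 ℓ
  square a b a<ℓ b<ℓ with <-cmp a b
  ... | tri≈ _ refl _ = mk⇔ (λ lt → contradiction lt (<-irrefl refl)) (λ lt → contradiction lt (<-irrefl refl))
  ... | tri< a<b _ _  = sameOrder⇒⇔ {z} (same b a b<ℓ a<ℓ a<b)
  ... | tri> _ _ b<a  = sameOrder⇒⇔ {z} (swap (same a b a<ℓ b<ℓ b<a))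

-- Doubling makes room for a new first entry that exceeds exactly the entries below v.
cutAt : (ℕ → ℕ) → ℕ → ℕ → ℕ
cutAt f v = cons (v + v) (λ i → suc (f i + f i))

squareAtCut? : ℕ → (ℕ → ℕ) → ℕ → Bool
squareAtCut? m f v = any< (suc m) λ ℓ → (1 <ᵇ ℓ) ∧ ((ℓ + ℓ ≤ᵇ suc m) ∧ agree? (cutAt f v) ℓ)

-- Relative to `m` entries, a new one is determined by the highest entry it exceeds. This leaves m +
-- 1 cuts: `0` exceeds nothing, `suc (f j)` exceeds exactly the entries up to `f j`. Distinctness
-- makes the highest entry unique.
endCrucial? : ℕ → (ℕ → ℕ) → Bool
endCrucial? m f = (all< m λ i → all< i λ j → not (f i ≡ᵇ f j)) ∧
  (squareAtCut? m f 0 ∧ all< m λ j → squareAtCut? m f (suc (f j)))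

splitLast : ∀ {m} {P : ℕ → Set} → (∀ i → i < m → P i) → P m → ∀ i → i < suc m → P i
splitLast init last i i<1+m with m≤n⇒m<n∨m≡n (s≤s⁻¹ i<1+m)
... | inj₁ i<m  = init i i<m
... | inj₂ refl = last

highestBelow : ∀ m (f e : ℕ → ℕ) x → (∀ i → i < m → ¬ (e i < x)) ⊎
  (∃[ j ] j < m × e j < x × (∀ i → i < m → e i < x → f i ≤ f j))
highestBelow zero    f e x = inj₁ (λ _ ())
highestBelow (suc m) f e x with highestBelow m f e x | e m <? x
... | inj₁ none | no ¬p = inj₁ (splitLast none ¬p)
... | inj₁ none | yes p = inj₂ (m , ≤-refl , p , splitLast (λ i i<m lt → contradiction lt (none i i<m)) (λ _ → ≤-refl))
... | inj₂ (j , j<m , below , high) | no ¬p =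
        inj₂ (j , m≤n⇒m≤1+n j<m , below , splitLast high (λ p → contradiction p ¬p))
... | inj₂ (j , j<m , below , high) | yes p with ≤-total (f j) (f m)
...   | inj₁ le = inj₂ (m , ≤-refl , p , splitLast (λ i i<m lt → ≤-trans (high i i<m lt) le) (λ _ → ≤-refl))
...   | inj₂ ge = inj₂ (j , m≤n⇒m≤1+n j<m , below , splitLast high (λ _ → ge))

double-< : ∀ {a b} → a < b → suc (a + a) < b + b
double-< {a} {b} a<b = ≤-trans (s≤s (≤-reflexive (sym (+-suc a a)))) (+-mono-≤ a<b a<b)

module _ (n m : ℕ) (m≤n : m ≤ n) (f g : ℕ → ℕ) (f-follows-g : Follows m g f) (check : T (endCrucial? m g)) where

  -- The squares found by the check lie within the new entry and the first `m` old ones, so the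
  -- entries after these are arbitrary.
  endCrucial : EndCrucial n f
  endCrucial e x e-follows-f fresh = proof
    where
    e-follows-g : Follows m g e
    e-follows-g i j i<m j<m lt = e-follows-f i j (<-≤-trans i<m m≤n) (<-≤-trans j<m m≤n) (f-follows-g i j i<m j<m lt)

    fromCut : ∀ v → (∀ i → i < m → g i < v → e i < x) → (∀ i → i < m → v ≤ g i → x < e i) →
              T (squareAtCut? m g v) → ∃[ ℓ ] 2 ≤ ℓ × ℓ + ℓ ≤ suc n × Square (cons x e) 0 ℓ
    fromCut v below above t with any<-sound (suc m) t
    ... | ℓ , _ , t′ with ∧⁻ {1 <ᵇ ℓ} t′
    ...   | t₁ , t″ with ∧⁻ {ℓ + ℓ ≤ᵇ suc m} t″
    ...     | t₂ , t₃ = ℓ , <ᵇ⇒< 1 ℓ t₁ , ≤-trans fits (s≤s m≤n) , agree?-sound {cutAt g v} t₃ fits mono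
      where
      fits = ≤ᵇ⇒≤ (ℓ + ℓ) (suc m) t₂
      mono : ∀ a b → a ≤ m → b ≤ m → cutAt g v a < cutAt g v b → cons x e a < cons x e b
      mono zero    zero    _   _   lt = contradiction lt (<-irrefl refl)
      mono zero    (suc j) _   j<m lt with v ≤? g j
      ... | yes le = above j j<m le
      ... | no ¬le = contradiction (<-trans lt (double-< (≰⇒> ¬le))) (<-irrefl refl)
      mono (suc i) zero    i<m _   lt with g i <? v
      ... | yes l = below i i<m l
      ... | no ¬l = contradiction lt (≤⇒≯ (≤-trans (+-mono-≤ (≮⇒≥ ¬l) (≮⇒≥ ¬l)) (n≤1+n _)))
      mono (suc i) (suc j) i<m j<m lt with g i <? g j
      ... | yes l = e-follows-g i j i<m j<m l
      ... | no ¬l = contradiction lt (≤⇒≯ (s≤s (+-mono-≤ (≮⇒≥ ¬l) (≮⇒≥ ¬l))))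

    check′ = ∧⁻ {all< m λ i → all< i λ j → not (g i ≡ᵇ g j)} check

    distinct : ∀ i j → i < m → j < i → g i ≢ g j
    distinct i j i<m j<i eq = T-not (all<-sound i (all<-sound m (proj₁ check′) i i<m) j j<i) (≡⇒≡ᵇ (g i) (g j) eq)

    g-injective : ∀ i j → i < m → j < m → g i ≡ g j → i ≡ j
    g-injective i j i<m j<m eq with <-cmp i j
    ... | tri< i<j _ _ = contradiction (sym eq) (distinct j i j<m i<j)
    ... | tri≈ _ i≡j _ = i≡j
    ... | tri> _ _ j<i = contradiction eq (distinct i j i<m j<i)

    above-x : ∀ i → i < m → ¬ (e i < x) → x < e i
    above-x i i<m ¬lt with <-cmp (e i) x
    ... | tri< lt _ _ = contradiction lt ¬lt
    ... | tri≈ _ eq _ = contradiction eq (fresh i (<-≤-trans i<m m≤n))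
    ... | tri> _ _ gt = gt

    proof : ∃[ ℓ ] 2 ≤ ℓ × ℓ + ℓ ≤ suc n × Square (cons x e) 0 ℓ
    proof with highestBelow m g e x | ∧⁻ (proj₂ check′)
    ... | inj₁ none | t , _ = fromCut 0 (λ _ _ ()) (λ i i<m _ → above-x i i<m (none i i<m)) t
    ... | inj₂ (j , j<m , e-j<x , high) | _ , t = fromCut (suc (g j)) below
            (λ i i<m lt → above-x i i<m (λ l → ≤⇒≯ (high i i<m l) lt)) (all<-sound m t j j<m)
      where
      below : ∀ i → i < m → g i < suc (g j) → e i < x
      below i i<m (s≤s le) with m≤n⇒m<n∨m≡n le
      ... | inj₁ lt = <-trans (e-follows-g i j i<m j<m lt) e-j<x
      ... | inj₂ eq with refl ← g-injective i j i<m j<m eq = e-j<x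

BicrucialOfLength : ℕ → Set
BicrucialOfLength n = Σ[ σ ∈ Permutation′ n ] Bicrucial σ

fromLevels : ∀ n g → (∀ i ℓ → 2 ≤ ℓ → i + ℓ + ℓ ≤ n → Break g i ℓ) →
             EndCrucial n (key n g) → EndCrucial n (λ i → key n g (n ∸ suc i)) → BicrucialOfLength n
fromLevels n g broken = build n (key n g) (key-injective n g) broken′
  where
  broken′ : ∀ i ℓ → 2 ≤ ℓ → i + ℓ + ℓ ≤ n → Break (key n g) i ℓ
  broken′ i ℓ 2≤ℓ fits with broken i ℓ 2≤ℓ fits
  ... | a , b , a<ℓ , b<ℓ , lt , gt = a , b , a<ℓ , b<ℓ ,
        key-mono n g (≤-<-trans (+-monoˡ-≤ a (m≤m+n i ℓ)) (inside a<ℓ)) (inj₁ lt) , key-mono n g (inside b<ℓ) (inj₁ gt)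
    where
    inside : ∀ {c} → c < ℓ → i + ℓ + c < n
    inside c<ℓ = <-≤-trans (+-monoʳ-< (i + ℓ) c<ℓ) fits

allBroken? : ℕ → (ℕ → ℕ) → Bool
allBroken? n g = all< (suc n) λ ℓ → (ℓ <ᵇ 2) ∨ all< (suc n ∸ (ℓ + ℓ)) λ i → broken? g i ℓ

allBroken?-sound : ∀ n g → T (allBroken? n g) → ∀ i ℓ → 2 ≤ ℓ → i + ℓ + ℓ ≤ n → Break g i ℓ
allBroken?-sound n g t i ℓ 2≤ℓ fits with ∨⁻ {ℓ <ᵇ 2} (all<-sound (suc n) t ℓ (s≤s (≤-trans (m≤n+m ℓ (i + ℓ)) fits)))
... | inj₁ ℓ<2 = contradiction 2≤ℓ (<⇒≱ (<ᵇ⇒< ℓ 2 ℓ<2))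
... | inj₂ t′  = broken?-sound g i ℓ (all<-sound (suc n ∸ (ℓ + ℓ)) t′ i (m+n≤o⇒m≤o∸n (suc i) (s≤s (subst (_≤ n) (+-assoc i ℓ ℓ) fits))))

bicrucial? : ℕ → (ℕ → ℕ) → Bool
bicrucial? n g = allBroken? n g ∧ (endCrucial? n g ∧ endCrucial? n (λ i → g (n ∸ suc i)))

checked : ∀ n g → T (bicrucial? n g) → BicrucialOfLength n
checked n g t with ∧⁻ {allBroken? n g} t
... | t₁ , t′ with ∧⁻ {endCrucial? n g} t′
...   | t₂ , t₃ = fromLevels n g (allBroken?-sound n g t₁)
        (endCrucial n n ≤-refl (key n g) g (λ _ _ i<n _ lt → key-mono n g i<n (inj₁ lt)) t₂)
        (endCrucial n n ≤-refl (λ i → key n g (n ∸ suc i)) (λ i → g (n ∸ suc i))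
          (λ _ _ i<n _ lt → key-mono n g (∸-monoʳ-< {n} (s≤s z≤n) i<n) (inj₁ lt)) t₃)

-- Single permutations verified by evaluation

nth : List ℕ → ℕ → ℕ
nth []       _       = 0
nth (x ∷ xs) zero    = x
nth (x ∷ xs) (suc i) = nth xs i

-- These lengths are too short for the families below.

bicrucial9 : BicrucialOfLength 9
bicrucial9 = checked 9 (nth (
  8 ∷ 5 ∷ 6 ∷ 7 ∷ 3 ∷ 0 ∷ 2 ∷ 4 ∷ 1 ∷ [])) tt

bicrucial13 : BicrucialOfLength 13
bicrucial13 = checked 13 (nth (
  12 ∷ 3 ∷ 6 ∷ 9 ∷ 8 ∷ 2 ∷ 5 ∷ 11 ∷ 4 ∷ 1 ∷ 7 ∷ 10 ∷ 0 ∷ [])) tt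

bicrucial15 : BicrucialOfLength 15
bicrucial15 = checked 15 (nth (
  13 ∷ 3 ∷ 6 ∷ 10 ∷ 8 ∷ 1 ∷ 5 ∷ 12 ∷ 4 ∷ 0 ∷ 7 ∷ 11 ∷ 9 ∷ 2 ∷ 14 ∷ [])) tt

bicrucial17 : BicrucialOfLength 17
bicrucial17 = checked 17 (nth (
  16 ∷ 5 ∷ 8 ∷ 14 ∷ 10 ∷ 3 ∷ 6 ∷ 12 ∷ 1 ∷ 0 ∷ 9 ∷ 15 ∷ 11 ∷ 4 ∷ 7 ∷ 13 ∷ 2 ∷ [])) tt

bicrucial19 : BicrucialOfLength 19
bicrucial19 = checked 19 (nth (
  12 ∷ 4 ∷ 9 ∷ 16 ∷ 13 ∷ 2 ∷ 7 ∷ 10 ∷ 5 ∷ 0 ∷ 14 ∷ 17 ∷ 15 ∷ 3 ∷ 8 ∷ 11 ∷ 6 ∷ 1 ∷ 18 ∷ [])) tt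

bicrucial25 : BicrucialOfLength 25
bicrucial25 = checked 25 (nth (
  24 ∷ 7 ∷ 12 ∷ 18 ∷ 15 ∷ 4 ∷ 9 ∷ 19 ∷ 8 ∷ 3 ∷ 13 ∷ 22 ∷ 16 ∷ 5 ∷ 10 ∷ 20 ∷ 1 ∷ 0 ∷ 14 ∷ 23 ∷
  17 ∷ 6 ∷ 11 ∷ 21 ∷ 2 ∷ [])) tt

bicrucial27 : BicrucialOfLength 27
bicrucial27 = checked 27 (nth (
  25 ∷ 4 ∷ 13 ∷ 16 ∷ 15 ∷ 1 ∷ 10 ∷ 17 ∷ 7 ∷ 0 ∷ 14 ∷ 23 ∷ 20 ∷ 2 ∷ 11 ∷ 18 ∷ 8 ∷ 5 ∷ 21 ∷ 24 ∷
  22 ∷ 3 ∷ 12 ∷ 19 ∷ 9 ∷ 6 ∷ 26 ∷ [])) tt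

bicrucial32 : BicrucialOfLength 32
bicrucial32 = checked 32 (nth (
  23 ∷ 30 ∷ 31 ∷ 10 ∷ 9 ∷ 15 ∷ 29 ∷ 27 ∷ 24 ∷ 26 ∷ 28 ∷ 11 ∷ 8 ∷ 12 ∷ 25 ∷ 22 ∷ 7 ∷ 20 ∷ 21 ∷ 3 ∷
  2 ∷ 6 ∷ 19 ∷ 17 ∷ 13 ∷ 16 ∷ 18 ∷ 4 ∷ 0 ∷ 5 ∷ 14 ∷ 1 ∷ [])) tt

bicrucial34 : BicrucialOfLength 34
bicrucial34 = checked 34 (nth (
  24 ∷ 31 ∷ 32 ∷ 11 ∷ 10 ∷ 16 ∷ 30 ∷ 28 ∷ 25 ∷ 27 ∷ 29 ∷ 12 ∷ 8 ∷ 13 ∷ 26 ∷ 23 ∷ 7 ∷ 21 ∷ 22 ∷ 3 ∷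
  2 ∷ 6 ∷ 20 ∷ 18 ∷ 14 ∷ 17 ∷ 19 ∷ 4 ∷ 0 ∷ 5 ∷ 15 ∷ 9 ∷ 1 ∷ 33 ∷ [])) tt

bicrucial36 : BicrucialOfLength 36
bicrucial36 = checked 36 (nth (
  29 ∷ 34 ∷ 35 ∷ 24 ∷ 21 ∷ 28 ∷ 33 ∷ 32 ∷ 25 ∷ 30 ∷ 31 ∷ 18 ∷ 10 ∷ 19 ∷ 26 ∷ 23 ∷ 14 ∷ 22 ∷ 27 ∷ 8 ∷
  7 ∷ 13 ∷ 20 ∷ 17 ∷ 11 ∷ 15 ∷ 16 ∷ 3 ∷ 2 ∷ 4 ∷ 12 ∷ 9 ∷ 1 ∷ 5 ∷ 6 ∷ 0 ∷ [])) tt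

bicrucial44 : BicrucialOfLength 44
bicrucial44 = checked 44 (nth (
  35 ∷ 42 ∷ 43 ∷ 19 ∷ 18 ∷ 27 ∷ 41 ∷ 39 ∷ 36 ∷ 38 ∷ 40 ∷ 20 ∷ 15 ∷ 21 ∷ 37 ∷ 34 ∷ 14 ∷ 32 ∷ 33 ∷ 7 ∷
  6 ∷ 13 ∷ 31 ∷ 29 ∷ 24 ∷ 28 ∷ 30 ∷ 8 ∷ 3 ∷ 9 ∷ 25 ∷ 16 ∷ 4 ∷ 11 ∷ 22 ∷ 1 ∷ 0 ∷ 10 ∷ 26 ∷ 17 ∷
  5 ∷ 12 ∷ 23 ∷ 2 ∷ [])) tt

bicrucial46 : BicrucialOfLength 46
bicrucial46 = checked 46 (nth (
  36 ∷ 43 ∷ 44 ∷ 23 ∷ 21 ∷ 28 ∷ 42 ∷ 40 ∷ 37 ∷ 39 ∷ 41 ∷ 24 ∷ 17 ∷ 25 ∷ 38 ∷ 35 ∷ 14 ∷ 33 ∷ 34 ∷ 6 ∷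
  5 ∷ 13 ∷ 32 ∷ 30 ∷ 26 ∷ 29 ∷ 31 ∷ 7 ∷ 0 ∷ 8 ∷ 27 ∷ 18 ∷ 1 ∷ 11 ∷ 15 ∷ 9 ∷ 3 ∷ 19 ∷ 22 ∷ 20 ∷
  2 ∷ 12 ∷ 16 ∷ 10 ∷ 4 ∷ 45 ∷ [])) tt

-- Parity and paperfolding

odd? : ℕ → Bool
odd? zero    = false
odd? (suc n) = not (odd? n)

odd?-+ : ∀ m {n} → odd? n ≡ true → odd? (m + n) ≡ not (odd? m)
odd?-+ zero    eq = eq
odd?-+ (suc m) eq = cong not (odd?-+ m eq)

odd?-double : ∀ m → odd? (m + m) ≡ false
odd?-double zero    = refl
odd?-double (suc m) rewrite +-suc m m = trans (not-involutive _) (odd?-double m)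

data Halved : ℕ → Set where
  even : ∀ m → Halved (m + m)
  odd  : ∀ m → Halved (suc (m + m))

halve : ∀ n → Halved n
halve zero = even 0
halve (suc n) with halve n
... | even m = odd m
... | odd m  = subst Halved (cong suc (+-suc m m)) (even (suc m))

paperfoldFuel : ℕ → ℕ → Bool
paperfoldFuel zero    n = false
paperfoldFuel (suc k) n = if odd? n then odd? ⌊ n /2⌋ else paperfoldFuel k ⌊ n /2⌋

-- The paperfolding sequence: write m = 2ᵉ (2 u + 1) and take the parity of u.
paperfold : ℕ → Bool
paperfold n = paperfoldFuel n n

paperfoldFuel-stable : ∀ k k′ n → n ≤ k → n ≤ k′ → paperfoldFuel k n ≡ paperfoldFuel k′ n
paperfoldFuel-stable zero    zero     n       _  _  = refl
paperfoldFuel-stable zero    (suc k′) zero    _  _  = paperfoldFuel-stable zero k′ 0 z≤n z≤n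
paperfoldFuel-stable (suc k) zero     zero    _  _  = paperfoldFuel-stable k zero 0 z≤n z≤n
paperfoldFuel-stable (suc k) (suc k′) zero    _  _  = paperfoldFuel-stable k k′ 0 z≤n z≤n
paperfoldFuel-stable (suc k) (suc k′) (suc n) (s≤s le) (s≤s le′) with odd? (suc n)
... | true  = refl
... | false = paperfoldFuel-stable k k′ _ (≤-trans half le) (≤-trans half le′)
  where
  half : ⌊ suc n /2⌋ ≤ n
  half = s≤s⁻¹ (⌊n/2⌋<n n)

paperfold-odd : ∀ m → paperfold (suc (m + m)) ≡ odd? m
paperfold-odd m rewrite odd?-double m = cong odd? (sym (n≡⌈n+n/2⌉ m))

paperfold-even : ∀ m → paperfold (m + m) ≡ paperfold m
paperfold-even zero = refl
paperfold-even (suc m) rewrite odd?-double (suc m) =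
  trans (cong (paperfoldFuel (m + suc m)) (sym (n≡⌊n+n/2⌋ (suc m))))
        (paperfoldFuel-stable (m + suc m) (suc m) (suc m) (m≤n+m (suc m) m) ≤-refl)

FlipsIn : ℕ → ℕ → ℕ → Set
FlipsIn lo hi d = ∃[ m ] lo ≤ m × m < hi × paperfold (m + d) ≡ not (paperfold m)

flip-odd : ∀ {k} u → odd? k ≡ true → paperfold (suc (u + u) + (k + k)) ≡ not (paperfold (suc (u + u)))
flip-odd {k} u k-odd = begin
  paperfold (suc (u + u) + (k + k))   ≡⟨ cong (paperfold ∘ suc) (eq u k) ⟩
  paperfold (suc ((u + k) + (u + k))) ≡⟨ paperfold-odd (u + k) ⟩
  odd? (u + k)                        ≡⟨ odd?-+ u k-odd ⟩
  not (odd? u)                        ≡⟨ cong not (paperfold-odd u) ⟨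
  not (paperfold (suc (u + u)))       ∎
  where
  open ≡-Reasoning
  eq : ∀ u k → (u + u) + (k + k) ≡ (u + k) + (u + k)
  eq = solve-∀

flip-double : ∀ {m d} → paperfold (m + d) ≡ not (paperfold m) →
              paperfold ((m + m) + (d + d)) ≡ not (paperfold (m + m))
flip-double {m} {d} flip = begin
  paperfold ((m + m) + (d + d)) ≡⟨ cong paperfold (eq m d) ⟩
  paperfold ((m + d) + (m + d)) ≡⟨ paperfold-even (m + d) ⟩
  paperfold (m + d)             ≡⟨ flip ⟩
  not (paperfold m)             ≡⟨ cong not (paperfold-even m) ⟨
  not (paperfold (m + m))       ∎
  where
  open ≡-Reasoning
  eq : ∀ m d → (m + m) + (d + d) ≡ (m + d) + (m + d)
  eq = solve-∀

odd?-odd : ∀ m → odd? (suc (m + m)) ≡ true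
odd?-odd m = cong not (odd?-double m)

double-mono-< : ∀ {m n} → m < n → m + m < n + n
double-mono-< lt = +-mono-< lt lt

-- The shift d = 2k flips every index whose 2-adic valuation is one less than that of d,
-- and such indices recur with a period dividing d.
paperfold-flips : ∀ k → 1 ≤ k → ∀ s → FlipsIn s (s + (k + k)) (k + k)
paperfold-flips = <-rec _ step
  where
  step : ∀ k → (∀ {j} → j < k → 1 ≤ j → ∀ s → FlipsIn s (s + (j + j)) (j + j)) →
         1 ≤ k → ∀ s → FlipsIn s (s + (k + k)) (k + k)
  step k rec 1≤k s with halve k | halve s
  step _ rec 1≤k _ | odd j | odd u =
    suc (u + u) , ≤-refl , m<m+n _ (s≤s z≤n) , flip-odd {suc (j + j)} u (odd?-odd j)
  step _ rec 1≤k _ | odd j | even u =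
    suc (u + u) , n≤1+n _ , subst (suc (u + u) <_) (eq u j) (s≤s (s≤s (m≤m+n (u + u) _))) , flip-odd {suc (j + j)} u (odd?-odd j)
    where
    eq : ∀ u j → suc (suc (u + u + (j + j + (j + j)))) ≡ (u + u) + (suc (j + j) + suc (j + j))
    eq = solve-∀
  step _ rec 1≤k _ | even zero    | _ with () ← 1≤k
  step _ rec 1≤k _ | even (suc j) | even u with rec {suc j} (m<m+n (suc j) (s≤s z≤n)) (s≤s z≤n) u
  ... | m , lo , hi , flip = m + m , +-mono-≤ lo lo ,
        subst (m + m <_) (eq u (suc j)) (double-mono-< hi) , flip-double {m} flip
    where
    eq : ∀ u j → (u + (j + j)) + (u + (j + j)) ≡ (u + u) + ((j + j) + (j + j))
    eq = solve-∀
  step _ rec 1≤k _ | even (suc j) | odd u with rec {suc j} (m<m+n (suc j) (s≤s z≤n)) (s≤s z≤n) (suc u)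
  ... | m , lo , s≤s hi , flip = m + m , ≤-trans (s≤s (+-monoʳ-≤ u (n≤1+n u))) (+-mono-≤ lo lo) ,
        s≤s (subst (m + m ≤_) (eq u (suc j)) (+-mono-≤ hi hi)) , flip-double {m} flip
    where
    eq : ∀ u j → (u + (j + j)) + (u + (j + j)) ≡ (u + u) + ((j + j) + (j + j))
    eq = solve-∀

-- Meant for squares that start within the first 32 entries of `hard`: there only blocks from 4 on
-- follow the folding. The witnesses are 5 for odd `k`, 4 for `k` equal to 4, and doubled witnesses
-- otherwise.
paperfold-flips-from-4 : ∀ k → 3 ≤ k → FlipsIn 4 (k + k) (k + k)
paperfold-flips-from-4 = <-rec _ step
  where
  step : ∀ k → (∀ {j} → j < k → 3 ≤ j → FlipsIn 4 (j + j) (j + j)) → 3 ≤ k → FlipsIn 4 (k + k) (k + k)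
  step k rec 3≤k with halve k
  step _ rec 3≤k | odd j  = 5 , n≤1+n 4 , +-mono-≤ 3≤k 3≤k , flip-odd {suc (j + j)} 2 (odd?-odd j)
  step _ rec 3≤k | even 0 with () ← 3≤k
  step _ rec 3≤k | even 1 with s≤s (s≤s ()) ← 3≤k
  step _ rec 3≤k | even 2 = 4 , ≤-refl , m≤m+n 5 3 , refl
  step _ rec 3≤k | even j@(suc (suc (suc _))) with rec {j} (m<m+n j (s≤s z≤n)) (s≤s (s≤s (s≤s z≤n)))
  ... | m , lo , hi , flip = m + m , ≤-trans lo (m≤m+n m m) , double-mono-< hi , flip-double {m} flip

-- Step patterns and the shifts that reverse them

-- Step₁ rules out squares with ℓ not divisible by 4, and Step₂, whose direction is
-- reversed by a shift of 4, those with ℓ an odd multiple of 4 and ℓ ≥ 12.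
Step₁ Step₂ : ℕ → ℕ → ℕ → Set
Step₁ 0 x y = y < x
Step₁ 1 x y = x < y
Step₁ 2 x y = x < y
Step₁ 3 x y = y < x
Step₁ (suc (suc (suc (suc i)))) x y = Step₁ i x y
Step₂ 0 x y = y < x
Step₂ 2 x y = y < x
Step₂ 4 x y = x < y
Step₂ 6 x y = x < y
Step₂ (suc (suc (suc (suc (suc (suc (suc (suc i)))))))) x y = Step₂ i x y
Step₂ _ x y = ⊤

step₁? step₂? : ℕ → ℕ → ℕ → Bool
step₁? 0 x y = y <ᵇ x
step₁? 1 x y = x <ᵇ y
step₁? 2 x y = x <ᵇ y
step₁? 3 x y = y <ᵇ x
step₁? (suc (suc (suc (suc i)))) x y = step₁? i x y
step₂? 0 x y = y <ᵇ x
step₂? 2 x y = y <ᵇ x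
step₂? 4 x y = x <ᵇ y
step₂? 6 x y = x <ᵇ y
step₂? (suc (suc (suc (suc (suc (suc (suc (suc i)))))))) x y = step₂? i x y
step₂? _ x y = true

step₁?-sound : ∀ i {x y} → T (step₁? i x y) → Step₁ i x y
step₁?-sound 0 t = <ᵇ⇒< _ _ t
step₁?-sound 1 t = <ᵇ⇒< _ _ t
step₁?-sound 2 t = <ᵇ⇒< _ _ t
step₁?-sound 3 t = <ᵇ⇒< _ _ t
step₁?-sound (suc (suc (suc (suc i)))) t = step₁?-sound i t

step₂?-sound : ∀ i {x y} → T (step₂? i x y) → Step₂ i x y
step₂?-sound 0 t = <ᵇ⇒< _ _ t
step₂?-sound 1 t = tt
step₂?-sound 2 t = <ᵇ⇒< _ _ t
step₂?-sound 3 t = tt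
step₂?-sound 4 t = <ᵇ⇒< _ _ t
step₂?-sound 5 t = tt
step₂?-sound 6 t = <ᵇ⇒< _ _ t
step₂?-sound 7 t = tt
step₂?-sound (suc (suc (suc (suc (suc (suc (suc (suc i)))))))) t = step₂?-sound i t

steps₁? steps₂? : (ℕ → ℕ) → ℕ → Bool
steps₁? g n = all< n λ x → step₁? x (g x) (g (1 + x))
steps₂? g n = all< n λ x → step₂? x (g x) (g (2 + x))

breaks? : (ℕ → ℕ) → ℕ → ℕ → Bool
breaks? g ℓ n = all< n λ x → broken? g x ℓ

steps₁?-sound : ∀ g n → T (steps₁? g n) → ∀ x → x < n → Step₁ x (g x) (g (1 + x))
steps₁?-sound g n t x x<n = step₁?-sound x (all<-sound n t x x<n)

steps₂?-sound : ∀ g n → T (steps₂? g n) → ∀ x → x < n → Step₂ x (g x) (g (2 + x))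
steps₂?-sound g n t x x<n = step₂?-sound x (all<-sound n t x x<n)

breaks?-sound : ∀ g ℓ n → T (breaks? g ℓ n) → ∀ x → x < n → Break g x ℓ
breaks?-sound g ℓ n t x x<n = broken?-sound g x ℓ (all<-sound n t x x<n)

Step₁-periodic : ∀ m i → Step₁ (m * 8 + i) ≡ Step₁ i
Step₁-periodic zero    i = refl
Step₁-periodic (suc m) i = Step₁-periodic m i

Step₁-periodic₄ : ∀ m i → Step₁ (m * 4 + i) ≡ Step₁ i
Step₁-periodic₄ zero    i = refl
Step₁-periodic₄ (suc m) i = Step₁-periodic₄ m i

Step₂-periodic : ∀ m i → Step₂ (m * 8 + i) ≡ Step₂ i
Step₂-periodic zero    i = refl
Step₂-periodic (suc m) i = Step₂-periodic m i

Opposite : ℕ → ℕ → ℕ → ℕ → Set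
Opposite x y x′ y′ = (x < y × y′ < x′) ⊎ (y < x × x′ < y′)

data Offset : ℕ → Set where
  one   : Offset 1
  two   : Offset 2
  three : Offset 3

-- In the pattern down, up, up, down a shift by 2 reverses every step, and a shift by 1 or 3
-- reverses one of any two consecutive steps.
opposite₁ : ∀ i {r} → Offset r → ∀ {x y z x′ y′ z′} → Step₁ i x y → Step₁ (1 + i) y z →
            Step₁ (r + i) x′ y′ → Step₁ (r + (1 + i)) y′ z′ → Opposite x y x′ y′ ⊎ Opposite y z y′ z′
opposite₁ 0 one   p q p′ q′ = inj₁ (inj₂ (p , p′))
opposite₁ 0 two   p q p′ q′ = inj₁ (inj₂ (p , p′))
opposite₁ 0 three p q p′ q′ = inj₂ (inj₁ (q , q′))
opposite₁ 1 one   p q p′ q′ = inj₂ (inj₁ (q , q′))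
opposite₁ 1 two   p q p′ q′ = inj₁ (inj₁ (p , p′))
opposite₁ 1 three p q p′ q′ = inj₁ (inj₁ (p , p′))
opposite₁ 2 one   p q p′ q′ = inj₁ (inj₁ (p , p′))
opposite₁ 2 two   p q p′ q′ = inj₁ (inj₁ (p , p′))
opposite₁ 2 three p q p′ q′ = inj₂ (inj₂ (q , q′))
opposite₁ 3 one   p q p′ q′ = inj₂ (inj₂ (q , q′))
opposite₁ 3 two   p q p′ q′ = inj₁ (inj₂ (p , p′))
opposite₁ 3 three p q p′ q′ = inj₁ (inj₂ (p , p′))
opposite₁ (suc (suc (suc (suc i)))) one   p q p′ q′ = opposite₁ i one p q p′ q′
opposite₁ (suc (suc (suc (suc i)))) two   p q p′ q′ = opposite₁ i two p q p′ q′
opposite₁ (suc (suc (suc (suc i)))) three p q p′ q′ = opposite₁ i three p q p′ q′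

opposite₁-two : ∀ i {x y x′ y′} → Step₁ i x y → Step₁ (2 + i) x′ y′ → Opposite x y x′ y′
opposite₁-two 0 p p′ = inj₂ (p , p′)
opposite₁-two 1 p p′ = inj₁ (p , p′)
opposite₁-two 2 p p′ = inj₁ (p , p′)
opposite₁-two 3 p p′ = inj₂ (p , p′)
opposite₁-two (suc (suc (suc (suc i)))) p p′ = opposite₁-two i p p′

-- One of two consecutive indices is even.
opposite₂ : ∀ i {x y x′ y′ u v u′ v′} → Step₂ i x y → Step₂ (4 + i) x′ y′ →
            Step₂ (1 + i) u v → Step₂ (4 + (1 + i)) u′ v′ → Opposite x y x′ y′ ⊎ Opposite u v u′ v′
opposite₂ 0 p p′ q q′ = inj₁ (inj₂ (p , p′))
opposite₂ 1 p p′ q q′ = inj₂ (inj₂ (q , q′))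
opposite₂ 2 p p′ q q′ = inj₁ (inj₂ (p , p′))
opposite₂ 3 p p′ q q′ = inj₂ (inj₁ (q , q′))
opposite₂ 4 p p′ q q′ = inj₁ (inj₁ (p , p′))
opposite₂ 5 p p′ q q′ = inj₂ (inj₁ (q , q′))
opposite₂ 6 p p′ q q′ = inj₁ (inj₁ (p , p′))
opposite₂ 7 p p′ q q′ = inj₂ (inj₂ (q , q′))
opposite₂ (suc (suc (suc (suc (suc (suc (suc (suc i)))))))) p p′ q q′ = opposite₂ i p p′ q q′

breakAt : ∀ {f i ℓ} P Q → i ≤ P → P < i + ℓ → i ≤ Q → Q < i + ℓ →
          f P < f Q → f (ℓ + Q) < f (ℓ + P) → Break f i ℓ
breakAt {f} {i} {ℓ} P Q i≤P P< i≤Q Q< lt gt =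
  P ∸ i , Q ∸ i , offset i≤P P< , offset i≤Q Q< ,
  subst₂ _<_ (cong f (sym (m+[n∸m]≡n i≤P))) (cong f (sym (m+[n∸m]≡n i≤Q))) lt ,
  subst₂ _<_ (cong f (shifted i≤Q)) (cong f (shifted i≤P)) gt
  where
  offset : ∀ {R} → i ≤ R → R < i + ℓ → R ∸ i < ℓ
  offset {R} i≤R R< = +-cancelˡ-< i _ _ (subst (_< i + ℓ) (sym (m+[n∸m]≡n i≤R)) R<)
  shifted : ∀ {R} → i ≤ R → ℓ + R ≡ i + ℓ + (R ∸ i)
  shifted {R} i≤R = trans (cong (ℓ +_) (sym (m+[n∸m]≡n i≤R)))
    (trans (sym (+-assoc ℓ i _)) (cong (_+ (R ∸ i)) (+-comm ℓ i)))

breakOpposite : ∀ {f i ℓ} P Q → i ≤ P → P < i + ℓ → i ≤ Q → Q < i + ℓ →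
                Opposite (f P) (f Q) (f (ℓ + P)) (f (ℓ + Q)) → Break f i ℓ
breakOpposite {f} P Q i≤P P< i≤Q Q< (inj₁ (lt , gt)) = breakAt {f} P Q i≤P P< i≤Q Q< lt gt
breakOpposite {f} P Q i≤P P< i≤Q Q< (inj₂ (lt , gt)) = breakAt {f} Q P i≤Q Q< i≤P P< lt gt

-- The infinite square-free sequence

-- Levels by residue modulo 8.  Residue 5 lies above or below residue 1 according to the
-- parity p of the block, which breaks squares with ℓ / 8 odd; residue 2 lies above or
-- below residue 6 according to the paperfolding sequence, which breaks the others.
level : Bool → Bool → ℕ → ℕ
level p b 0 = 100
level p b 1 = 30
level p b 2 = if b then 80 else 60
level p b 3 = 120
level p b 4 = 50
level p b 5 = if p then 20 else 40
level p b 6 = 70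
level p b _ = 110

block : ℕ → ℕ → ℕ
block a (suc (suc (suc (suc (suc (suc (suc (suc i)))))))) = block (suc a) i
block a i = level (odd? a) (paperfold a) i

body : ℕ → ℕ
body = block 0

-- A finite copy of `block` with the parity and the folds as parameters: a property of a window can
-- then be decided by running through all bits.
window : Bool → List Bool → ℕ → ℕ
window p [] i = 0
window p (b ∷ bs) (suc (suc (suc (suc (suc (suc (suc (suc i)))))))) = window (not p) bs i
window p (b ∷ bs) i = level p b i

folds : ℕ → ℕ → List Bool
folds a zero    = []
folds a (suc k) = paperfold a ∷ folds (suc a) k

block-shift : ∀ q a x → block a (q * 8 + x) ≡ block (a + q) x
block-shift zero    a x = cong (λ c → block c x) (sym (+-identityʳ a))
block-shift (suc q) a x = trans (block-shift q (suc a) x) (cong (λ c → block c x) (sym (+-suc a q)))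

block-window : ∀ k a x → x < k * 8 → block a x ≡ window (odd? a) (folds a k) x
block-window (suc k) a 0 _ = refl
block-window (suc k) a 1 _ = refl
block-window (suc k) a 2 _ = refl
block-window (suc k) a 3 _ = refl
block-window (suc k) a 4 _ = refl
block-window (suc k) a 5 _ = refl
block-window (suc k) a 6 _ = refl
block-window (suc k) a 7 _ = refl
block-window (suc k) a (suc (suc (suc (suc (suc (suc (suc (suc x))))))))
  (s≤s (s≤s (s≤s (s≤s (s≤s (s≤s (s≤s (s≤s x<)))))))) = block-window k (suc a) x x<

body-window : ∀ q x → x < 24 → body (q * 8 + x) ≡ window (odd? q) (folds q 3) x
body-window q x x<24 = trans (block-shift q 0 x) (block-window 3 q x x<24)

∀Bool : (Bool → Bool) → Bool
∀Bool p = p false ∧ p true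

∀Bool-sound : ∀ {p} → T (∀Bool p) → ∀ b → T (p b)
∀Bool-sound {p} t false = proj₁ (∧⁻ t)
∀Bool-sound {p} t true  = proj₂ (∧⁻ {p false} t)

breakShift : ∀ {f g} s x ℓ {B} → (∀ y → y < B → f (s + y) ≡ g y) → x + ℓ + ℓ ≤ B → Break g x ℓ → Break f (s + x) ℓ
breakShift {f} {g} s x ℓ {B} same fits (a , b , a<ℓ , b<ℓ , lt , gt) = a , b , a<ℓ , b<ℓ ,
  subst₂ _<_ (same₁ a<ℓ) (same₁ b<ℓ) lt , subst₂ _<_ (same₂ b<ℓ) (same₂ a<ℓ) gt
  where
  inside : ∀ {c} → c < ℓ → x + ℓ + c < B
  inside c<ℓ = <-≤-trans (+-monoʳ-< (x + ℓ) c<ℓ) fits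
  same₁ : ∀ {c} → c < ℓ → g (x + c) ≡ f (s + x + c)
  same₁ {c} c<ℓ = trans (sym (same (x + c) (≤-<-trans (+-monoˡ-≤ c (m≤m+n x ℓ)) (inside c<ℓ)))) (cong f (sym (+-assoc s x c)))
  same₂ : ∀ {c} → c < ℓ → g (x + ℓ + c) ≡ f (s + x + ℓ + c)
  same₂ {c} c<ℓ = trans (sym (same (x + ℓ + c) (inside c<ℓ))) (cong f (eq s x ℓ c))
    where
    eq : ∀ s x ℓ c → s + (x + ℓ + c) ≡ s + x + ℓ + c
    eq = solve-∀

-- What is asked of the infinite part from index `o` on. `step₂` starts one later because the raised
-- entry 4 of `easy` reverses that comparison. `peaks` is the order that the heads reverse.
record Regular (o : ℕ) (b : ℕ → ℕ) : Set where
  field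
    step₁  : ∀ i → o ≤ i → Step₁ i (b i) (b (1 + i))
    step₂  : ∀ i → o < i → Step₂ i (b i) (b (2 + i))
    break₄ : ∀ i → o ≤ i → Break b i 4
    break₈ : ∀ i k → o ≤ i → 1 ≤ k → Break b i (k * 8)
    peaks  : ∀ j → b (j * 8 + 7) < b (j * 8 + 3)

windowCheck : ((ℕ → ℕ) → Bool) → Bool
windowCheck c = ∀Bool λ p → ∀Bool λ b → ∀Bool λ b′ → ∀Bool λ b″ → c (window p (b ∷ b′ ∷ b″ ∷ []))

windowCheck-sound : ∀ c → T (windowCheck c) → ∀ q → T (c (window (odd? q) (folds q 3)))
windowCheck-sound c t q =
  ∀Bool-sound {λ b″ → c (window p (b ∷ b′ ∷ b″ ∷ []))}
    (∀Bool-sound {λ b′ → ∀Bool λ b″ → c (window p (b ∷ b′ ∷ b″ ∷ []))}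
      (∀Bool-sound {λ b → ∀Bool λ b′ → ∀Bool λ b″ → c (window p (b ∷ b′ ∷ b″ ∷ []))}
        (∀Bool-sound {λ p → ∀Bool λ b → ∀Bool λ b′ → ∀Bool λ b″ → c (window p (b ∷ b′ ∷ b″ ∷ []))} t p) b) b′)
    (paperfold (2 + q))
  where
  p  = odd? q
  b  = paperfold q
  b′ = paperfold (1 + q)

data Split8 : ℕ → Set where
  split8 : ∀ q x → x < 8 → Split8 (q * 8 + x)

divide8 : ∀ i → Split8 i
divide8 i with i divMod 8
... | result q r refl = subst Split8 (+-comm (q * 8) (toℕ r)) (split8 q (toℕ r) (toℕ<n r))

body-entry : ∀ q x → x < 8 → body (q * 8 + x) ≡ level (odd? q) (paperfold q) x
body-entry q x x<8 = trans (block-shift q 0 x) (entry x x<8)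
  where
  entry : ∀ x → x < 8 → block q x ≡ level (odd? q) (paperfold q) x
  entry 0 _ = refl
  entry 1 _ = refl
  entry 2 _ = refl
  entry 3 _ = refl
  entry 4 _ = refl
  entry 5 _ = refl
  entry 6 _ = refl
  entry 7 _ = refl
  entry (suc (suc (suc (suc (suc (suc (suc (suc _)))))))) (s≤s (s≤s (s≤s (s≤s (s≤s (s≤s (s≤s (s≤s ()))))))))

body-entry-shifted : ∀ k q x → x < 8 → body (k * 8 + (q * 8 + x)) ≡ level (odd? (q + k)) (paperfold (q + k)) x
body-entry-shifted k q x x<8 = trans (cong body (eq k q x)) (body-entry (q + k) x x<8)
  where
  eq : ∀ k q x → k * 8 + (q * 8 + x) ≡ (q + k) * 8 + x
  eq = solve-∀

-- Only residue 5 depends on the parity of its block. Residue 1 has a constant level and may come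
-- from any block `m′`, which is needed when a square starts in the middle of a block.
opposite-alternating : ∀ {k} m m′ → odd? k ≡ true →
  Opposite (body (m * 8 + 5)) (body (m′ * 8 + 1)) (body (k * 8 + (m * 8 + 5))) (body (k * 8 + (m′ * 8 + 1)))
opposite-alternating {k} m m′ k-odd
  rewrite body-entry m 5 (m≤n+m 6 2) | body-entry m′ 1 (m≤n+m 2 6)
        | body-entry-shifted k m 5 (m≤n+m 6 2) | body-entry-shifted k m′ 1 (m≤n+m 2 6)
        | odd?-+ m {k} k-odd with odd? m
... | false = inj₂ (m≤n+m 31 9 , m≤n+m 21 9)
... | true  = inj₁ (m≤n+m 21 9 , m≤n+m 31 9)

opposite-folded : ∀ {k} m m′ → paperfold (m + k) ≡ not (paperfold m) →
  Opposite (body (m * 8 + 2)) (body (m′ * 8 + 6)) (body (k * 8 + (m * 8 + 2))) (body (k * 8 + (m′ * 8 + 6)))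
opposite-folded {k} m m′ flip
  rewrite body-entry m 2 (m≤n+m 3 5) | body-entry m′ 6 (m≤n+m 7 1)
        | body-entry-shifted k m 2 (m≤n+m 3 5) | body-entry-shifted k m′ 6 (m≤n+m 7 1)
        | flip with paperfold m
... | false = inj₁ (m≤n+m 61 9 , m≤n+m 71 9)
... | true  = inj₂ (m≤n+m 71 9 , m≤n+m 61 9)

place-≤ : ∀ {q m x y} → q ≤ m → x ≤ y → q * 8 + x ≤ m * 8 + y
place-≤ q≤m x≤y = +-mono-≤ (*-monoˡ-≤ 8 q≤m) x≤y

place-<ˡ : ∀ {q m x y} → q < m → x < 8 → q * 8 + x < m * 8 + y
place-<ˡ {q} {m} {x} {y} q<m x<8 = <-≤-trans (+-monoʳ-< (q * 8) x<8)
  (≤-trans (≤-reflexive (+-comm (q * 8) 8)) (≤-trans (*-monoˡ-≤ 8 q<m) (m≤m+n (m * 8) y)))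

place-<ʳ : ∀ {q m x y} → q ≤ m → x < y → q * 8 + x < m * 8 + y
place-<ʳ q≤m x<y = +-mono-≤-< (*-monoˡ-≤ 8 q≤m) x<y

-- Eight consecutive entries contain a residue 5 and a residue 1; the cases tell which of the blocks
-- `q` and `suc q` they lie in.
body-break-odd : ∀ i k → 1 ≤ k → odd? k ≡ true → Break body i (k * 8)
body-break-odd i k 1≤k k-odd with divide8 i
... | split8 q x x<8 = choose (x ≤? 1) (x ≤? 5)
  where
  end : (q + k) * 8 + x ≡ q * 8 + x + k * 8
  end = eq q k x
    where
    eq : ∀ q k x → (q + k) * 8 + x ≡ q * 8 + x + k * 8
    eq = solve-∀
  q<q+k : q < q + k
  q<q+k = m<m+n q 1≤k
  choose : Dec (x ≤ 1) → Dec (x ≤ 5) → Break body (q * 8 + x) (k * 8)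
  choose (yes x≤1) _ = breakOpposite {body} {q * 8 + x} {k * 8} (q * 8 + 5) (q * 8 + 1)
    (place-≤ {q} {q} ≤-refl (≤-trans x≤1 (m≤n+m 1 4))) (subst (q * 8 + 5 <_) end (place-<ˡ {q} {q + k} q<q+k (m≤n+m 6 2)))
    (place-≤ {q} {q} ≤-refl x≤1) (subst (q * 8 + 1 <_) end (place-<ˡ {q} {q + k} q<q+k (m≤n+m 2 6)))
    (opposite-alternating {k} q q k-odd)
  choose (no x≰1) (yes x≤5) = breakOpposite {body} {q * 8 + x} {k * 8} (q * 8 + 5) (suc q * 8 + 1)
    (place-≤ {q} {q} ≤-refl x≤5) (subst (q * 8 + 5 <_) end (place-<ˡ {q} {q + k} q<q+k (m≤n+m 6 2)))
    (<⇒≤ (place-<ˡ {q} {suc q} ≤-refl x<8)) (subst (suc q * 8 + 1 <_) end (place-<ʳ {suc q} {q + k} q<q+k (≰⇒> x≰1)))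
    (opposite-alternating {k} q (suc q) k-odd)
  choose (no x≰1) (no x≰5) = breakOpposite {body} {q * 8 + x} {k * 8} (suc q * 8 + 5) (suc q * 8 + 1)
    (<⇒≤ (place-<ˡ {q} {suc q} ≤-refl x<8)) (subst (suc q * 8 + 5 <_) end (place-<ʳ {suc q} {q + k} q<q+k (≰⇒> x≰5)))
    (<⇒≤ (place-<ˡ {q} {suc q} ≤-refl x<8)) (subst (suc q * 8 + 1 <_) end (place-<ʳ {suc q} {q + k} q<q+k (≰⇒> x≰1)))
    (opposite-alternating {k} (suc q) (suc q) k-odd)

body-break-even : ∀ i k → 1 ≤ k → Break body i ((k + k) * 8)
body-break-even i k 1≤k with divide8 i
... | split8 q x x<8 = choose (x ≤? 2) (x ≤? 6)
  where
  K = k + k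
  end : (q + K) * 8 + x ≡ q * 8 + x + K * 8
  end = eq q K x
    where
    eq : ∀ q K x → (q + K) * 8 + x ≡ q * 8 + x + K * 8
    eq = solve-∀
  choose : Dec (x ≤ 2) → Dec (x ≤ 6) → Break body (q * 8 + x) (K * 8)
  choose (yes x≤2) _ with paperfold-flips k 1≤k q
  ... | m , lo , hi , flip = breakOpposite {body} (m * 8 + 2) (m * 8 + 6)
        (place-≤ lo x≤2) (subst (m * 8 + 2 <_) end (place-<ˡ hi (m≤n+m 3 5)))
        (place-≤ lo (≤-trans x≤2 (m≤n+m 2 4))) (subst (m * 8 + 6 <_) end (place-<ˡ hi (m≤n+m 7 1)))
        (opposite-folded {K} m m flip)
  -- Residue 2 of block `q` is missed, so a flipped block is sought from `suc q` on. Residue 6, of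
  -- constant level, is taken from the block before it, and thus lies inside even if the flipped
  -- block is cut off by the end of the half.
  choose (no x≰2) (yes x≤6) with paperfold-flips k 1≤k (suc q)
  ... | suc m , s≤s lo , s≤s hi , flip = breakOpposite {body} (suc m * 8 + 2) (m * 8 + 6)
        (<⇒≤ (place-<ˡ (s≤s lo) x<8)) (subst (suc m * 8 + 2 <_) end (place-<ʳ hi (≰⇒> x≰2)))
        (place-≤ lo x≤6) (subst (m * 8 + 6 <_) end (place-<ˡ hi (m≤n+m 7 1)))
        (opposite-folded {K} (suc m) m flip)
  choose (no x≰2) (no x≰6) with paperfold-flips k 1≤k (suc q)
  ... | suc m , s≤s lo , s≤s hi , flip = breakOpposite {body} (suc m * 8 + 2) (suc m * 8 + 6)
        (<⇒≤ (place-<ˡ (s≤s lo) x<8)) (subst (suc m * 8 + 2 <_) end (place-<ʳ hi (≰⇒> x≰2)))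
        (<⇒≤ (place-<ˡ (s≤s lo) x<8)) (subst (suc m * 8 + 6 <_) end (place-<ʳ hi (≰⇒> x≰6)))
        (opposite-folded {K} (suc m) (suc m) flip)

body-break : ∀ i k → 1 ≤ k → Break body i (k * 8)
body-break i k 1≤k with halve k
... | odd j  = body-break-odd i (suc (j + j)) 1≤k (odd?-odd j)
body-break i .(0 + 0)         1≤k | even zero with () ← 1≤k
body-break i .(suc j + suc j) 1≤k | even (suc j) = body-break-even i (suc j) (s≤s z≤n)

body-regular : Regular 0 body
body-regular = record
  { step₁  = λ i _ → step₁ i
  ; step₂  = λ i _ → step₂ i
  ; break₄ = λ i _ → break₄ i
  ; break₈ = λ i k _ → body-break i k
  ; peaks  = peaks
  }
  where
  <24 : ∀ {x} y → x < 8 → y ≤ 16 → y + x < 24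
  <24 y x<8 y≤16 = +-mono-≤-< y≤16 x<8
  shifted : ∀ q y x → body (q * 8 + (y + x)) ≡ body (y + (q * 8 + x))
  shifted q y x = cong body (eq q y x)
    where
    eq : ∀ q y x → q * 8 + (y + x) ≡ y + (q * 8 + x)
    eq = solve-∀
  step₁ : ∀ i → Step₁ i (body i) (body (1 + i))
  step₁ i with divide8 i
  ... | split8 q x x<8 rewrite Step₁-periodic q x =
    subst₂ (Step₁ x) (sym (body-window q x (<24 0 x<8 z≤n)))
      (trans (sym (body-window q (1 + x) (<24 1 x<8 (s≤s z≤n)))) (shifted q 1 x))
      (steps₁?-sound (window (odd? q) (folds q 3)) 8 (windowCheck-sound (λ g → steps₁? g 8) tt q) x x<8)
  step₂ : ∀ i → Step₂ i (body i) (body (2 + i))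
  step₂ i with divide8 i
  ... | split8 q x x<8 rewrite Step₂-periodic q x =
    subst₂ (Step₂ x) (sym (body-window q x (<24 0 x<8 z≤n)))
      (trans (sym (body-window q (2 + x) (<24 2 x<8 (s≤s (s≤s z≤n))))) (shifted q 2 x))
      (steps₂?-sound (window (odd? q) (folds q 3)) 8 (windowCheck-sound (λ g → steps₂? g 8) tt q) x x<8)
  break₄ : ∀ i → Break body i 4
  break₄ i with divide8 i
  ... | split8 q x x<8 = breakShift {body} {window (odd? q) (folds q 3)} (q * 8) x 4 {24} (body-window q)
    (≤-trans (+-monoˡ-≤ 4 (+-monoˡ-≤ 4 (<⇒≤ x<8))) (m≤n+m 16 8))
    (breaks?-sound (window (odd? q) (folds q 3)) 4 8 (windowCheck-sound (λ g → breaks? g 4 8) tt q) x x<8)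
  peaks : ∀ j → body (j * 8 + 7) < body (j * 8 + 3)
  peaks q = subst₂ _<_ (sym (body-window q 7 (m≤n+m 8 16))) (sym (body-window q 3 (m≤n+m 4 20)))
    (<ᵇ⇒< _ _ (windowCheck-sound (λ g → g 7 <ᵇ g 3) tt q))

-- The easy and the hard beginning

-- Used from e₄ on, which is raised above e₆: then ℓ = 4 makes the beginning crucial.
easy : ℕ → ℕ
easy i = if i ≡ᵇ 4 then 600 else body i

easy-regular : Regular 4 easy
easy-regular = record
  { step₁ = step₁ ; step₂ = step₂ ; break₄ = break₄ ; break₈ = break₈ ; peaks = peaks }
  where
  open Regular body-regular using () renaming (step₁ to body₁; step₂ to body₂; break₄ to body-break₄; peaks to body-peaks)
  fit : ∀ i → 4 < i → ∃[ j ] i ≡ 5 + j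
  fit i 4<i = i ∸ 5 , sym (m+[n∸m]≡n 4<i)
  step₁ : ∀ i → 4 ≤ i → Step₁ i (easy i) (easy (1 + i))
  step₁ i 4≤i with m≤n⇒m<n∨m≡n 4≤i
  ... | inj₂ refl = m≤n+m 41 559
  ... | inj₁ 4<i with fit i 4<i
  ...   | j , refl = body₁ (5 + j) z≤n
  step₂ : ∀ i → 4 < i → Step₂ i (easy i) (easy (2 + i))
  step₂ i 4<i with fit i 4<i
  ... | j , refl = body₂ (5 + j) (s≤s z≤n)
  break₄ : ∀ i → 4 ≤ i → Break easy i 4
  break₄ i 4≤i with m≤n⇒m<n∨m≡n 4≤i
  ... | inj₂ refl = broken?-sound easy 4 4 tt
  ... | inj₁ 4<i with fit i 4<i
  ...   | j , refl = body-break₄ (5 + j) z≤n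
  break₈ : ∀ i k → 4 ≤ i → 1 ≤ k → Break easy i (k * 8)
  break₈ i k 4≤i 1≤k with m≤n⇒m<n∨m≡n 4≤i
  ... | inj₁ 4<i with fit i 4<i
  ...   | j , refl = body-break (5 + j) k 1≤k
  -- The raised entry 4 exceeds entry 6, while all translates by multiples of 8 have levels 50 < 70.
  break₈ i k@(suc k′) 4≤i 1≤k | inj₂ refl = breakAt {easy} 6 4 (m≤n+m 4 2) (m≤m+n 7 (5 + k′ * 8)) ≤-refl (m≤m+n 5 (7 + k′ * 8))
    (m≤n+m 71 529) (subst₂ _<_ (far 4 (m≤n+m 5 3)) (far 6 (m≤n+m 7 1)) (m≤n+m 51 19))
    where
    far : ∀ y → y < 8 → level (odd? k) (paperfold k) y ≡ easy (k * 8 + y)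
    far y y<8 = sym (body-entry k y y<8)
  peaks : ∀ j → easy (j * 8 + 7) < easy (j * 8 + 3)
  peaks zero    = body-peaks 0
  peaks (suc j) = body-peaks (suc j)

-- Found by computer search: every entry above e₁ that is put in front of e₁, …, e₃₁
-- completes a square with ℓ = 4, 8 or 16.  The entry at index 0 is a placeholder.
tail : List ℕ
tail = 1000 ∷
  230 ∷ 300 ∷ 310 ∷ 112 ∷ 105 ∷ 150 ∷ 290 ∷ 270 ∷ 240 ∷ 260 ∷ 280 ∷ 114 ∷  90 ∷ 116 ∷ 250 ∷ 220 ∷
   66 ∷ 200 ∷ 210 ∷  44 ∷  42 ∷  63 ∷ 190 ∷ 170 ∷ 130 ∷ 160 ∷ 180 ∷  46 ∷  25 ∷  48 ∷ 140 ∷ []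

hard : ℕ → ℕ
hard i = if i <ᵇ 32 then nth tail i else body i

hard-body : ∀ {i} → 32 ≤ i → hard i ≡ body i
hard-body {i} 32≤i = subst (λ i → hard i ≡ body i) (m+[n∸m]≡n 32≤i) (beyond (i ∸ 32))
  where
  beyond : ∀ j → hard (32 + j) ≡ body (32 + j)
  beyond j = refl

-- The first half contains all of blocks 4 to k - 1, where `hard` is `body`. For odd `k` block 4 has
-- the required reversal; for even `k` one of these blocks is flipped by the shift `k`.
hard-break-far : ∀ i k → i < 32 → 5 ≤ k → Break hard i (k * 8)
hard-break-far i k i<32 5≤k with halve k
... | odd j = breakOpposite {hard} 37 33 (m≤n⇒m≤1+n (≤-trans (<⇒≤ i<32) (m≤n+m 32 4))) (inside 37 (m≤n+m 38 2))
        (m≤n⇒m≤1+n (<⇒≤ i<32)) (inside 33 (m≤n+m 34 6))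
        (subst₂ (Opposite 40 30) (far 37 (m≤n+m 32 5)) (far 33 (m≤n+m 32 1)) (opposite-alternating {k} 4 4 (odd?-odd j)))
  where
  inside : ∀ y → y < 40 → y < i + k * 8
  inside y y<40 = <-≤-trans y<40 (≤-trans (*-monoˡ-≤ 8 5≤k) (m≤n+m (k * 8) i))
  far : ∀ y → 32 ≤ y → body (k * 8 + y) ≡ hard (k * 8 + y)
  far y 32≤y = sym (hard-body (≤-trans 32≤y (m≤n+m y (k * 8))))
... | even j with paperfold-flips-from-4 j (≰⇒> λ j≤2 → <⇒≱ 5≤k (+-mono-≤ j≤2 j≤2))
...   | m , lo , hi , flip = breakOpposite {hard} (m * 8 + 2) (m * 8 + 6)
        (≤-trans (<⇒≤ i<32) (late 2)) (inside 2 (m≤n+m 3 5))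
        (≤-trans (<⇒≤ i<32) (late 6)) (inside 6 (m≤n+m 7 1))
        (subst₂ (λ x y → Opposite x y (hard (k * 8 + (m * 8 + 2))) (hard (k * 8 + (m * 8 + 6)))) (sym (hard-body (late 2))) (sym (hard-body (late 6)))
          (subst₂ (Opposite (body (m * 8 + 2)) (body (m * 8 + 6))) (far 2) (far 6) (opposite-folded {k} m m flip)))
  where
  late : ∀ y → 32 ≤ m * 8 + y
  late y = ≤-trans (*-monoˡ-≤ 8 lo) (m≤m+n (m * 8) y)
  inside : ∀ y → y < 8 → m * 8 + y < i + k * 8
  inside y y<8 = subst (m * 8 + y <_) (+-comm (k * 8) i) (place-<ˡ hi y<8)
  far : ∀ y → body (k * 8 + (m * 8 + y)) ≡ hard (k * 8 + (m * 8 + y))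
  far y = sym (hard-body (≤-trans (late y) (m≤n+m (m * 8 + y) (k * 8))))

byRange : ∀ {n} (P : ℕ → Set) → (∀ i → i < n → P i) → (∀ j → P (n + j)) → ∀ i → P i
byRange {n} P near far i with i <? n
... | yes i<n = near i i<n
... | no i≮n = subst P (m+[n∸m]≡n (≮⇒≥ i≮n)) (far (i ∸ n))

hard-regular : Regular 1 hard
hard-regular = record
  { step₁ = step₁ ; step₂ = step₂ ; break₄ = break₄ ; break₈ = break₈ ; peaks = peaks }
  where
  open Regular body-regular using () renaming (step₁ to body₁; step₂ to body₂; break₄ to body-break₄; peaks to body-peaks)
  near : ∀ ℓ → T (breaks? (hard ∘ suc) ℓ 31) → ∀ i → i < 32 → 1 ≤ i → Break hard i ℓ
  near ℓ t (suc i) (s≤s i<31) _ = breaks?-sound (hard ∘ suc) ℓ 31 t i i<31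
  step₁ : ∀ i → 1 ≤ i → Step₁ i (hard i) (hard (1 + i))
  step₁ i _ = byRange {32} (λ i → Step₁ i (hard i) (hard (1 + i)))
    (steps₁?-sound hard 32 tt) (λ j → body₁ (32 + j) z≤n) i
  step₂ : ∀ i → 1 < i → Step₂ i (hard i) (hard (2 + i))
  step₂ i _ = byRange {32} (λ i → Step₂ i (hard i) (hard (2 + i)))
    (steps₂?-sound hard 32 tt) (λ j → body₂ (32 + j) (s≤s z≤n)) i
  break₄ : ∀ i → 1 ≤ i → Break hard i 4
  break₄ = byRange {32} (λ i → 1 ≤ i → Break hard i 4) (near 4 tt) (λ j _ → body-break₄ (32 + j) z≤n)
  break₈ : ∀ i k → 1 ≤ i → 1 ≤ k → Break hard i (k * 8)
  break₈ i k 1≤i 1≤k = byRange {32} (λ i → 1 ≤ i → Break hard i (k * 8)) (small k 1≤k) (λ j _ → body-break (32 + j) k 1≤k) i 1≤i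
    where
    small : ∀ k → 1 ≤ k → ∀ i → i < 32 → 1 ≤ i → Break hard i (k * 8)
    small 1 _ = near 8 tt
    small 2 _ = near 16 tt
    small 3 _ = near 24 tt
    small 4 _ = near 32 tt
    small k@(suc (suc (suc (suc (suc _))))) _ i i<32 _ = hard-break-far i k i<32 (s≤s (s≤s (s≤s (s≤s (s≤s z≤n)))))
  peaks : ∀ j → hard (j * 8 + 7) < hard (j * 8 + 3)
  peaks 0 = m≤n+m 291 19
  peaks 1 = m≤n+m 251 29
  peaks 2 = m≤n+m 191 19
  peaks 3 = m≤n+m 141 39
  peaks (suc (suc (suc (suc j)))) = body-peaks (4 + j)

-- Heads at the other end

spliceAt : ℕ → (ℕ → ℕ) → List ℕ → ℕ → ℕ
spliceAt z b xs i = if i <ᵇ z then b i else nth xs (i ∸ z)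

spliceAt-< : ∀ {z b xs i} → i < z → spliceAt z b xs i ≡ b i
spliceAt-< {z} {b} {xs} {i} i<z rewrite to T-≡ (<⇒<ᵇ i<z) = refl

-- `g` is the window from a multiple of 8 on: 15 entries of the infinite part, then the head, which
-- thus begins with the peak of residue 7. The bounds are those of squares that fit into `15 + len`
-- entries. The comparison of `steps₂?` with the very last entry is left out, as the heads of length
-- 2 and 4 reverse it. `peaks-ok` and `peaks′-ok` contradict `peaks`, the latter being required only
-- of heads longer than 12.
record HeadOK (g : ℕ → ℕ) (len m : ℕ) : Set where
  field
    steps₁-ok  : T (steps₁? g (14 + len))
    steps₂-ok  : T (steps₂? g (12 + len))
    breaks₄-ok : T (breaks? g 4 (8 + len))
    breaks₈-ok : T (breaks? g 8 len)
    peaks-ok   : T (g 11 <ᵇ g 15)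
    peaks′-ok  : T ((len ≤ᵇ 12) ∨ (g 19 <ᵇ g 23))
    len-ok     : T (len ≤ᵇ 16)
    m-ok       : T (m ≤ᵇ 15)
    crucial-ok : T (endCrucial? m (λ i → g (14 + len ∸ i)))

module _ (o : ℕ) (b : ℕ → ℕ) (regular : Regular o b) (w : ℕ) (xs : List ℕ) (g : ℕ → ℕ) (m₁ m₂ : ℕ)
         (same : ∀ x → x < 15 + length xs → spliceAt (w * 8 + 15) b xs (w * 8 + x) ≡ g x)
         (headOK : HeadOK g (length xs) m₂)
         (leftCheck : T (endCrucial? m₁ (λ i → b (o + i)))) (m₁-fits : o + m₁ ≤ w * 8 + 15) (o-fits : o ≤ w * 8) where

  private
    open Regular regular
    len = length xs
    z = w * 8 + 15
    h = spliceAt z b xs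

    open HeadOK headOK

    len≤16 : len ≤ 16
    len≤16 = ≤ᵇ⇒≤ len 16 len-ok

    h-base : ∀ {i} → i < z → h i ≡ b i
    h-base = spliceAt-< {z} {b} {xs}

    data Position (i : ℕ) : Set where
      early : i < w * 8 → Position i
      late  : ∀ x → i ≡ w * 8 + x → Position i

    position : ∀ i → Position i
    position i with i <? w * 8
    ... | yes lt = early lt
    ... | no ¬lt = late (i ∸ w * 8) (sym (m+[n∸m]≡n (≮⇒≥ ¬lt)))

    reassoc : ∀ y x → y + (w * 8 + x) ≡ w * 8 + (y + x)
    reassoc y x = eq y (w * 8) x
      where
      eq : ∀ y v x → y + (v + x) ≡ v + (y + x)
      eq = solve-∀

    cancel : ∀ {y} k → w * 8 + y ≤ w * 8 + k → y ≤ k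
    cancel k le = +-cancelˡ-≤ (w * 8) _ k le

    total : w * 8 + (15 + len) ≡ z + len
    total = sym (+-assoc (w * 8) 15 len)

    early+ : ∀ {i} y → y ≤ 15 → i < w * 8 → y + i < z
    early+ {i} y y≤15 i< = subst (y + i <_) (+-comm 15 (w * 8)) (+-mono-≤-< y≤15 i<)

    h-step₁ : ∀ i → o ≤ i → 2 + i ≤ z + len → Step₁ i (h i) (h (1 + i))
    h-step₁ i o≤i fits with position i
    ... | early i< = subst₂ (Step₁ i) (sym (h-base (early+ 0 z≤n i<))) (sym (h-base (early+ 1 (s≤s z≤n) i<))) (step₁ i o≤i)
    ... | late x refl rewrite Step₁-periodic w x =
      subst₂ (Step₁ x) (sym (same x (<-trans ≤-refl x<))) (trans (sym (same (1 + x) x<)) (cong h (sym (reassoc 1 x))))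
        (steps₁?-sound g (14 + len) steps₁-ok x (s≤s⁻¹ x<))
      where
      x< : 1 + x < 15 + len
      x< = cancel (15 + len) (subst₂ _≤_ (reassoc 2 x) (sym total) fits)

    h-step₂ : ∀ i → o < i → 4 + i ≤ z + len → Step₂ i (h i) (h (2 + i))
    h-step₂ i o<i fits with position i
    ... | early i< = subst₂ (Step₂ i) (sym (h-base (early+ 0 z≤n i<))) (sym (h-base (early+ 2 (s≤s (s≤s z≤n)) i<))) (step₂ i o<i)
    ... | late x refl rewrite Step₂-periodic w x =
      subst₂ (Step₂ x) (sym (same x (≤-trans (m≤n+m (suc x) 3) x<))) (trans (sym (same (2 + x) (≤-trans (m≤n+m (3 + x) 1) x<))) (cong h (sym (reassoc 2 x))))
        (steps₂?-sound g (12 + len) steps₂-ok x (s≤s⁻¹ (s≤s⁻¹ (s≤s⁻¹ x<))))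
      where
      x< : 4 + x ≤ 15 + len
      x< = cancel (15 + len) (subst₂ _≤_ (reassoc 4 x) (sym total) fits)

    fromBase : ∀ {i ℓ} → i + ℓ + ℓ ≤ z → Break b i ℓ → Break h i ℓ
    fromBase {i} {ℓ} fits = breakShift {h} {b} 0 i ℓ {z} (λ _ → h-base) fits

    fromWindow : ∀ {x ℓ} → w * 8 + x + ℓ + ℓ ≤ z + len → Break g x ℓ → Break h (w * 8 + x) ℓ
    fromWindow {x} {ℓ} fits = breakShift {h} {g} (w * 8) x ℓ {15 + len} same
      (cancel (15 + len) (subst₂ _≤_ (eq (w * 8) x ℓ) (sym total) fits))
      where
      eq : ∀ v x ℓ → v + x + ℓ + ℓ ≡ v + (x + ℓ + ℓ)
      eq = solve-∀

    h-break₄ : ∀ i → o ≤ i → i + 4 + 4 ≤ z + len → Break h i 4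
    h-break₄ i o≤i fits with position i
    ... | early i< = fromBase (subst (_≤ z) (eq i) (<⇒≤ (early+ 8 (m≤n+m 8 7) i<))) (break₄ i o≤i)
      where
      eq : ∀ i → 8 + i ≡ i + 4 + 4
      eq = solve-∀
    ... | late x refl = fromWindow fits (breaks?-sound g 4 (8 + len) breaks₄-ok x
            (+-cancelˡ-≤ 7 _ _ (cancel (15 + len) (subst₂ _≤_ (eq (w * 8) x) (sym total) fits))))
      where
      eq : ∀ v x → v + x + 4 + 4 ≡ v + (8 + x)
      eq = solve-∀

    -- A square with ℓ ≥ 16 that reaches into the head contains two peaks of the head
    -- whose order is the reverse of the order of such peaks elsewhere.
    h-break-peaks : ∀ i k c → o ≤ i → 2 ≤ k → c ≤ 2 + w → h (c * 8 + 3) < h (c * 8 + 7) →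
                    c * 8 + 7 < i + k * 8 + k * 8 → i + k * 8 + k * 8 ≤ c * 8 + 19 → Break h i (k * 8)
    h-break-peaks i k c o≤i 2≤k c≤ raised reach fits =
      breakAt {h} (j * 8 + 7) (j * 8 + 3) (≤-trans i≤ (+-monoʳ-≤ (j * 8) (m≤n+m 3 4))) <i+ℓ i≤
        (≤-<-trans (+-monoʳ-≤ (j * 8) (m≤n+m 3 4)) <i+ℓ)
        (subst₂ _<_ (sym (h-base inBase)) (sym (h-base (≤-<-trans (+-monoʳ-≤ (j * 8) (m≤n+m 3 4)) inBase))) (peaks j))
        (subst₂ _<_ (cong h (sym (place 3))) (cong h (sym (place 7))) raised)
      where
      ℓ = k * 8
      16≤ℓ : 16 ≤ ℓ
      16≤ℓ = *-monoˡ-≤ 8 2≤k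
      i+ℓ≤ : i + ℓ ≤ c * 8 + 3
      i+ℓ≤ = +-cancelʳ-≤ 16 _ _ (≤-trans (+-monoʳ-≤ (i + ℓ) 16≤ℓ) (≤-trans fits (≤-reflexive (sym (+-assoc (c * 8) 3 16)))))
      k≤c : k ≤ c
      k≤c = s≤s⁻¹ (*-cancelʳ-< 8 k (suc c) (≤-<-trans (≤-trans (m≤n+m ℓ i) i+ℓ≤)
        (subst (c * 8 + 3 <_) (+-comm (c * 8) 8) (+-monoʳ-< (c * 8) (m≤m+n 4 4)))))
      j = c ∸ k
      place : ∀ y → ℓ + (j * 8 + y) ≡ c * 8 + y
      place y = trans (eq k j y) (cong (λ c → c * 8 + y) (m+[n∸m]≡n k≤c))
        where
        eq : ∀ k j y → k * 8 + (j * 8 + y) ≡ (k + j) * 8 + y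
        eq = solve-∀
      i≤ : i ≤ j * 8 + 3
      i≤ = +-cancelˡ-≤ ℓ _ _ (subst₂ _≤_ (+-comm i ℓ) (sym (place 3)) i+ℓ≤)
      <i+ℓ : j * 8 + 7 < i + ℓ
      <i+ℓ = +-cancelˡ-< ℓ _ _ (subst₂ _<_ (sym (place 7)) (+-comm (i + ℓ) ℓ) reach)
      -- As `c ≤ 2 + w` and `2 ≤ k`, the block `j` is at most `w`, hence below the head.
      inBase : j * 8 + 7 < z
      inBase = +-cancelˡ-< 16 _ _ (≤-<-trans (+-monoˡ-≤ (j * 8 + 7) 16≤ℓ) (≤-<-trans (≤-reflexive (place 7))
        (≤-<-trans (+-monoˡ-≤ 7 (*-monoˡ-≤ 8 c≤)) (subst (2 * 8 + w * 8 + 7 <_) (eq (w * 8)) (+-monoʳ-< (2 * 8 + w * 8) (m≤m+n 8 7))))))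
        where
        eq : ∀ v → 2 * 8 + v + 15 ≡ 16 + (v + 15)
        eq = solve-∀

    h-break₈ : ∀ i k → o ≤ i → 1 ≤ k → i + k * 8 + k * 8 ≤ z + len → Break h i (k * 8)
    h-break₈ i k o≤i 1≤k fits with i + k * 8 + k * 8 ≤? z
    ... | yes le = fromBase le (break₈ i k o≤i 1≤k)
    h-break₈ i 1 o≤i 1≤k fits | no ≰z with position i
    ... | early i< = contradiction (subst (_≤ z) (eq i) (early+ 15 ≤-refl i<)) ≰z
      where
      eq : ∀ i → suc (15 + i) ≡ i + 1 * 8 + 1 * 8
      eq = solve-∀
    ... | late x refl = fromWindow fits (breaks?-sound g 8 len breaks₈-ok x
            (+-cancelˡ-≤ 15 _ _ (cancel (15 + len) (subst₂ _≤_ (eq (w * 8) x) (sym total) fits))))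
      where
      eq : ∀ v x → v + x + 1 * 8 + 1 * 8 ≡ v + (15 + suc x)
      eq = solve-∀
    -- With ℓ ≥ 16, both peaks of block `c` lie in the second half if the square ends after
    -- `c * 8 + 7` and by `c * 8 + 19`. Block `suc w` covers ends within 12 entries of `z`, block
    -- `2 + w` the later ones.
    h-break₈ i k@(suc (suc _)) o≤i 1≤k fits | no ≰z with i + k * 8 + k * 8 ≤? z + 12
    ... | yes le = h-break-peaks i k (suc w) o≤i (s≤s (s≤s z≤n)) (n≤1+n _)
            (subst₂ _<_ (trans (sym (same 11 (m≤m+n 12 _))) (cong h (eq w 3))) (trans (sym (same 15 (15-inside))) (cong h (eq w 7)))
              (<ᵇ⇒< _ _ peaks-ok))
            (subst (_< i + k * 8 + k * 8) (eq w 7) (≰⇒> ≰z)) (≤-trans le (≤-reflexive (eq′ w)))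
      where
      eq : ∀ w y → w * 8 + (8 + y) ≡ suc w * 8 + y
      eq = solve-∀
      eq′ : ∀ w → w * 8 + 15 + 12 ≡ suc w * 8 + 19
      eq′ = solve-∀
      15-inside : 15 < 15 + len
      15-inside = +-cancelˡ-< (w * 8) _ _ (subst (z <_) (sym total) (<-≤-trans (≰⇒> ≰z) fits))
    ... | no ≰12 = h-break-peaks i k (2 + w) o≤i (s≤s (s≤s z≤n)) ≤-refl raised
            (<-trans (subst (2 * 8 + w * 8 + 7 <_) (eq₁ (w * 8)) (+-monoʳ-< (2 * 8 + w * 8) (m≤m+n 8 3))) (≰⇒> ≰12))
            (≤-trans fits (≤-trans (+-monoʳ-≤ z len≤16) (≤-trans (≤-reflexive (eq₂ (w * 8))) (+-monoʳ-≤ (2 * 8 + w * 8) (m≤m+n 15 4)))))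
      where
      eq : ∀ w y → w * 8 + (16 + y) ≡ suc (suc w) * 8 + y
      eq = solve-∀
      eq₁ : ∀ v → 2 * 8 + v + 11 ≡ v + 15 + 12
      eq₁ = solve-∀
      eq₂ : ∀ v → v + 15 + 16 ≡ 2 * 8 + v + 15
      eq₂ = solve-∀
      12<len : 12 < len
      12<len = +-cancelˡ-< z _ _ (<-≤-trans (≰⇒> ≰12) fits)
      in-window : ∀ y → y < 28 → y < 15 + len
      in-window y y<28 = <-≤-trans y<28 (+-monoʳ-≤ 15 12<len)
      raised : h ((2 + w) * 8 + 3) < h ((2 + w) * 8 + 7)
      raised with ∨⁻ {len ≤ᵇ 12} peaks′-ok
      ... | inj₁ le = contradiction 12<len (≤⇒≯ (≤ᵇ⇒≤ len 12 le))
      ... | inj₂ lt = subst₂ _<_ (trans (sym (same 19 (in-window 19 (m≤m+n 20 8)))) (cong h (eq w 3)))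
                                 (trans (sym (same 23 (in-window 23 (m≤m+n 24 4)))) (cong h (eq w 7))) (<ᵇ⇒< _ _ lt)

    -- Two consecutive steps of the first half are compared, so ℓ ≥ 3; for ℓ = 2 the only step is
    -- reversed by itself, see `opposite₁-two`.
    h-break-steps : ∀ i q {r} → Offset r → o ≤ i → 3 ≤ r + q * 4 →
                    i + (r + q * 4) + (r + q * 4) ≤ z + len → Break h i (r + q * 4)
    h-break-steps i q {r} off o≤i 3≤ℓ fits =
      join (opposite₁ i off (h-step₁ i o≤i (≤-trans (n≤1+n _) early₂)) (h-step₁ (1 + i) (m≤n⇒m≤1+n o≤i) early₂)
        (shifted i o≤i (≤-trans (n≤1+n _) late₂)) (shifted (1 + i) (m≤n⇒m≤1+n o≤i) late₃))
      where
      ℓ = r + q * 4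
      late₃ : 2 + (ℓ + (1 + i)) ≤ z + len
      late₃ = ≤-trans (≤-trans (≤-reflexive (eq ℓ i)) (+-monoʳ-≤ (i + ℓ) 3≤ℓ)) fits
        where
        eq : ∀ ℓ i → 2 + (ℓ + (1 + i)) ≡ i + ℓ + 3
        eq = solve-∀
      late₂ : 3 + (ℓ + i) ≤ z + len
      late₂ = ≤-trans (≤-reflexive (cong (2 +_) (sym (+-suc ℓ i)))) late₃
      early₂ : 3 + i ≤ z + len
      early₂ = ≤-trans (+-monoʳ-≤ 3 (m≤n+m i ℓ)) late₂
      periodic : ∀ j → Step₁ (ℓ + j) ≡ Step₁ (r + j)
      periodic j = trans (cong Step₁ (eq r (q * 4) j)) (Step₁-periodic₄ q (r + j))
        where
        eq : ∀ r v j → r + v + j ≡ v + (r + j)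
        eq = solve-∀
      shifted : ∀ j → o ≤ j → 2 + (ℓ + j) ≤ z + len → Step₁ (r + j) (h (ℓ + j)) (h (ℓ + (1 + j)))
      shifted j o≤j fits′ = subst₂ (λ S t → S (h (ℓ + j)) (h t)) (periodic j) (sym (+-suc ℓ j))
        (h-step₁ (ℓ + j) (m≤n⇒m≤o+n ℓ o≤j) fits′)
      i< : ∀ y → y < 3 → y + i < i + ℓ
      i< y y<3 = subst (y + i <_) (+-comm ℓ i) (+-monoˡ-< i (<-≤-trans y<3 3≤ℓ))
      join : Opposite (h i) (h (1 + i)) (h (ℓ + i)) (h (ℓ + (1 + i))) ⊎
             Opposite (h (1 + i)) (h (2 + i)) (h (ℓ + (1 + i))) (h (ℓ + (2 + i))) → Break h i ℓ
      join (inj₁ opp) = breakOpposite {h} i (1 + i) ≤-refl (i< 0 (s≤s z≤n)) (n≤1+n i) (i< 1 (s≤s (s≤s z≤n))) opp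
      join (inj₂ opp) = breakOpposite {h} (1 + i) (2 + i) (n≤1+n i) (i< 1 (s≤s (s≤s z≤n))) (m≤n+m i 2) (i< 2 ≤-refl) opp

    h-break-offset : ∀ i q {r} → Offset r → o ≤ i → 2 ≤ r + q * 4 → i + (r + q * 4) + (r + q * 4) ≤ z + len → Break h i (r + q * 4)
    h-break-offset i zero one o≤i (s≤s ()) fits
    h-break-offset i zero two o≤i _ fits =
      breakOpposite {h} i (1 + i) ≤-refl (m<m+n i (s≤s z≤n)) (n≤1+n i) (subst (1 + i <_) (+-comm 2 i) ≤-refl)
        (opposite₁-two i (h-step₁ i o≤i (≤-trans (m≤n+m _ 2) fits′)) (h-step₁ (2 + i) (m≤n⇒m≤o+n 2 o≤i) fits′))
      where
      fits′ : 4 + i ≤ z + len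
      fits′ = subst (_≤ z + len) (eq i) fits
        where
        eq : ∀ i → i + (2 + 0 * 4) + (2 + 0 * 4) ≡ 4 + i
        eq = solve-∀
    h-break-offset i zero three o≤i 2≤ℓ fits = h-break-steps i 0 three o≤i ≤-refl fits
    h-break-offset i (suc q) {r} off o≤i 2≤ℓ fits =
      h-break-steps i (suc q) off o≤i (≤-trans (m≤m+n 3 (1 + q * 4)) (m≤n+m (4 + q * 4) r)) fits

    h-break-half : ∀ i j → o ≤ i → 1 ≤ j → i + (4 + j * 8) + (4 + j * 8) ≤ z + len → Break h i (4 + j * 8)
    h-break-half i j@(suc j′) o≤i _ fits =
      join (opposite₂ (1 + i) (h-step₂ (1 + i) (s≤s o≤i) (≤-trans (m≤n+m (5 + i) ℓ) (≤-trans (≤-reflexive (eq₁ ℓ i)) late₅)))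
        (subst (λ S → S (h (ℓ + (1 + i))) (h (2 + (ℓ + (1 + i))))) (periodic (1 + i)) (h-step₂ (ℓ + (1 + i)) (<-≤-trans (s≤s o≤i) (m≤n+m (1 + i) ℓ)) (≤-trans (≤-reflexive (eq₁′ ℓ i)) late₅)))
        (h-step₂ (2 + i) (m≤n⇒m≤1+n (s≤s o≤i)) (≤-trans (m≤n+m (6 + i) ℓ) (≤-trans (≤-reflexive (eq₂ ℓ i)) late₆)))
        (subst (λ S → S (h (ℓ + (2 + i))) (h (2 + (ℓ + (2 + i))))) (periodic (2 + i)) (h-step₂ (ℓ + (2 + i)) (<-≤-trans (s≤s (m≤n⇒m≤1+n o≤i)) (m≤n+m (2 + i) ℓ)) (≤-trans (≤-reflexive (eq₂′ ℓ i)) late₆))))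
      where
      ℓ = 4 + j * 8
      late₆ : i + ℓ + 6 ≤ z + len
      late₆ = ≤-trans (+-monoʳ-≤ (i + ℓ) (m≤m+n 6 (6 + j′ * 8))) fits
      late₅ : i + ℓ + 5 ≤ z + len
      late₅ = ≤-trans (+-monoʳ-≤ (i + ℓ) (n≤1+n 5)) late₆
      eq₁ : ∀ ℓ i → ℓ + (5 + i) ≡ i + ℓ + 5
      eq₁ = solve-∀
      eq₁′ : ∀ ℓ i → 4 + (ℓ + (1 + i)) ≡ i + ℓ + 5
      eq₁′ = solve-∀
      eq₂ : ∀ ℓ i → ℓ + (6 + i) ≡ i + ℓ + 6
      eq₂ = solve-∀
      eq₂′ : ∀ ℓ i → 4 + (ℓ + (2 + i)) ≡ i + ℓ + 6
      eq₂′ = solve-∀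
      periodic : ∀ t → Step₂ (ℓ + t) ≡ Step₂ (4 + t)
      periodic t = trans (cong Step₂ (eq (j * 8) t)) (Step₂-periodic j (4 + t))
        where
        eq : ∀ v t → 4 + v + t ≡ v + (4 + t)
        eq = solve-∀
      i< : ∀ y → y < 5 → y + i < i + ℓ
      i< y y<5 = subst (y + i <_) (+-comm ℓ i) (+-monoˡ-< i (<-≤-trans y<5 (m≤m+n 5 (7 + j′ * 8))))
      join : Opposite (h (1 + i)) (h (3 + i)) (h (ℓ + (1 + i))) (h (2 + (ℓ + (1 + i)))) ⊎
             Opposite (h (2 + i)) (h (4 + i)) (h (ℓ + (2 + i))) (h (2 + (ℓ + (2 + i)))) → Break h i ℓ
      join (inj₁ opp) = breakOpposite {h} (1 + i) (3 + i) (m≤n+m i 1) (i< 1 (m≤m+n 2 3)) (m≤n+m i 3) (i< 3 (m≤m+n 4 1))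
        (subst (λ t → Opposite (h (1 + i)) (h (3 + i)) (h (ℓ + (1 + i))) (h t)) (eq ℓ i) opp)
        where
        eq : ∀ ℓ i → 2 + (ℓ + (1 + i)) ≡ ℓ + (3 + i)
        eq = solve-∀
      join (inj₂ opp) = breakOpposite {h} (2 + i) (4 + i) (m≤n+m i 2) (i< 2 (m≤m+n 3 2)) (m≤n+m i 4) (i< 4 ≤-refl)
        (subst (λ t → Opposite (h (2 + i)) (h (4 + i)) (h (ℓ + (2 + i))) (h t)) (eq ℓ i) opp)
        where
        eq : ∀ ℓ i → 2 + (ℓ + (2 + i)) ≡ ℓ + (4 + i)
        eq = solve-∀

    h-break : ∀ i ℓ → o ≤ i → 2 ≤ ℓ → i + ℓ + ℓ ≤ z + len → Break h i ℓ
    h-break i ℓ o≤i 2≤ℓ fits with ℓ divMod 4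
    h-break i .(1 + q * 4) o≤i 2≤ℓ fits | result q (suc zero) refl = h-break-offset i q one o≤i 2≤ℓ fits
    h-break i .(2 + q * 4) o≤i 2≤ℓ fits | result q (suc (suc zero)) refl = h-break-offset i q two o≤i 2≤ℓ fits
    h-break i .(3 + q * 4) o≤i 2≤ℓ fits | result q (suc (suc (suc zero))) refl = h-break-offset i q three o≤i 2≤ℓ fits
    h-break i .(q * 4) o≤i 2≤ℓ fits | result q zero refl with halve q
    ... | odd zero = h-break₄ i o≤i fits
    ... | odd j@(suc j′) = subst (Break h i) (eq j) (h-break-half i j o≤i (s≤s z≤n) (subst (λ ℓ → i + ℓ + ℓ ≤ z + len) (sym (eq j)) fits))
      where
      eq : ∀ j → 4 + j * 8 ≡ suc (j + j) * 4
      eq = solve-∀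
    ... | even zero with () ← 2≤ℓ
    ... | even j@(suc _) = subst (Break h i) (eq j) (h-break₈ i j o≤i (s≤s z≤n) (subst (λ ℓ → i + ℓ + ℓ ≤ z + len) (sym (eq j)) fits))
      where
      eq : ∀ j → j * 8 ≡ (j + j) * 4
      eq = solve-∀

  family : ∀ n → o + n ≡ w * 8 + (15 + length xs) → BicrucialOfLength n
  family n length-eq = fromLevels n f broken left right
    where
    f : ℕ → ℕ
    f p = h (o + p)
    o+n : o + n ≡ z + len
    o+n = trans length-eq total
    broken : ∀ i ℓ → 2 ≤ ℓ → i + ℓ + ℓ ≤ n → Break f i ℓ
    broken i ℓ 2≤ℓ fits = reassociate (h-break (o + i) ℓ (m≤m+n o i) 2≤ℓ (subst₂ _≤_ (eq o i ℓ) o+n (+-monoʳ-≤ o fits)))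
      where
      eq : ∀ o i ℓ → o + (i + ℓ + ℓ) ≡ o + i + ℓ + ℓ
      eq = solve-∀
      reassociate : Break h (o + i) ℓ → Break f i ℓ
      reassociate (a , b , a<ℓ , b<ℓ , lt , gt) = a , b , a<ℓ , b<ℓ ,
        subst₂ _<_ (cong h (+-assoc o i a)) (cong h (+-assoc o i b)) lt ,
        subst₂ _<_ (cong h (eq′ o i ℓ b)) (cong h (eq′ o i ℓ a)) gt
        where
        eq′ : ∀ o i ℓ a → o + i + ℓ + a ≡ o + (i + ℓ + a)
        eq′ = solve-∀
    left : EndCrucial n (key n f)
    left = endCrucial n m₁ m₁≤n (key n f) (λ i → b (o + i)) follows leftCheck
      where
      m₁≤n : m₁ ≤ n
      m₁≤n = +-cancelˡ-≤ o _ _ (≤-trans m₁-fits (≤-trans (m≤m+n z len) (≤-reflexive (sym o+n))))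
      follows : Follows m₁ (λ i → b (o + i)) (key n f)
      follows i j i<m j<m lt = key-mono n f (<-≤-trans i<m m₁≤n)
        (inj₁ (subst₂ _<_ (sym (h-base (inside i<m))) (sym (h-base (inside j<m))) lt))
        where
        inside : ∀ {i} → i < m₁ → o + i < z
        inside i<m = <-≤-trans (+-monoʳ-< o i<m) m₁-fits
    right : EndCrucial n (λ i → key n f (n ∸ suc i))
    right = endCrucial n m₂ m₂≤n (λ i → key n f (n ∸ suc i)) (λ i → g (14 + len ∸ i)) follows crucial-ok
      where
      m₂≤15 : m₂ ≤ 15
      m₂≤15 = ≤ᵇ⇒≤ m₂ 15 m-ok
      15+len≤n : 15 + len ≤ n
      15+len≤n = +-cancelˡ-≤ o _ _ (≤-trans (+-monoˡ-≤ (15 + len) o-fits) (≤-reflexive (sym length-eq)))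
      m₂≤n : m₂ ≤ n
      m₂≤n = ≤-trans m₂≤15 (≤-trans (m≤m+n 15 len) 15+len≤n)
      entry : ∀ i → i < m₂ → f (n ∸ suc i) ≡ g (14 + len ∸ i)
      entry i i<m = trans (cong h (begin
        o + (n ∸ suc i)                ≡⟨ +-∸-assoc o (<-≤-trans i<m m₂≤n) ⟨
        o + n ∸ suc i                  ≡⟨ cong (_∸ suc i) length-eq ⟩
        w * 8 + (15 + len) ∸ suc i     ≡⟨ +-∸-assoc (w * 8) (≤-trans i<m (≤-trans m₂≤15 (m≤m+n 15 len))) ⟩
        w * 8 + (14 + len ∸ i)         ∎)) (same (14 + len ∸ i) (s≤s (m∸n≤m (14 + len) i)))
        where open ≡-Reasoning
      follows : Follows m₂ (λ i → g (14 + len ∸ i)) (λ i → key n f (n ∸ suc i))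
      follows i j i<m j<m lt = key-mono n f (∸-monoʳ-< {n} (s≤s z≤n) (<-≤-trans i<m m₂≤n))
        (inj₁ (subst₂ _<_ (sym (entry i i<m)) (sym (entry j j<m)) lt))

spliceAt-≥ : ∀ {z b xs i} → ¬ (i < z) → spliceAt z b xs i ≡ nth xs (i ∸ z)
spliceAt-≥ {z} {b} {xs} {i} i≮z with i <ᵇ z in eq
... | false = refl
... | true  = contradiction (<ᵇ⇒< i z (subst T (sym eq) tt)) i≮z

spliceAt-shift : ∀ {s z b b′ xs} → (∀ x → x < z → b (s + x) ≡ b′ x) → ∀ x →
                 spliceAt (s + z) b xs (s + x) ≡ spliceAt z b′ xs x
spliceAt-shift {s} {z} {b} {b′} {xs} same x with x <? z
... | yes x<z = trans (spliceAt-< {b = b} {xs} (+-monoʳ-< s x<z)) (trans (same x x<z) (sym (spliceAt-< {b = b′} {xs} x<z)))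
... | no x≮z = trans (spliceAt-≥ {b = b} {xs} (x≮z ∘ +-cancelˡ-< s _ _))
    (trans (cong (nth xs) ([m+n]∸[m+o]≡n∸o s x z)) (sym (spliceAt-≥ {b = b′} {xs} x≮z)))

forBits : (P : Bool → Bool → Bool → Bool → Set) →
  P false false false false → P false false false true → P false false true false → P false false true true →
  P false true  false false → P false true  false true → P false true  true false → P false true  true true →
  P true  false false false → P true  false false true → P true  false true false → P true  false true true →
  P true  true  false false → P true  true  false true → P true  true  true false → P true  true  true true →
  ∀ p q r s → P p q r s
forBits P a b c d e f g h i j k l m n o p = λ
  { false false false false → a ; false false false true → b ; false false true false → c ; false false true true → d
  ; false true  false false → e ; false true  false true → f ; false true  true false → g ; false true  true true → h
  ; true  false false false → i ; true  false false true → j ; true  false true false → k ; true  false true true → l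
  ; true  true  false false → m ; true  true  false true → n ; true  true  true false → o ; true  true  true true → p }

headWindow : (Bool → Bool → List ℕ) → Bool → Bool → Bool → Bool → ℕ → ℕ
headWindow xs p b b′ b″ = spliceAt 15 (window p (b ∷ b′ ∷ b″ ∷ [])) (xs p b″)

-- Heads of length 2 and 4 make the end crucial with ℓ = 4, the longer ones, whose last seven
-- entries repeat the pattern of the seven entries eight places earlier, with ℓ = 8.  All
-- begin with a raised peak, see h-break-peaks.
record Head (len m : ℕ) : Set where
  field
    entries : Bool → Bool → List ℕ
    size    : ∀ p b → length (entries p b) ≡ len
    ok      : ∀ p b b′ b″ → HeadOK (headWindow entries p b b′ b″) len m

head₂ : Head 2 7
head₂ = record
  { entries = entries
  ; size = λ _ _ → refl
  ; ok = forBits (λ p b b′ b″ → HeadOK (headWindow entries p b b′ b″) 2 7) _ _ _ _ _ _ _ _ _ _ _ _ _ _ _ _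
  }
  where
  entries : Bool → Bool → List ℕ
  entries p b = 500 ∷ 0 ∷ []

head₄ : Head 4 7
head₄ = record
  { entries = entries
  ; size = λ _ _ → refl
  ; ok = forBits (λ p b b′ b″ → HeadOK (headWindow entries p b b′ b″) 4 7) _ _ _ _ _ _ _ _ _ _ _ _ _ _ _ _
  }
  where
  entries : Bool → Bool → List ℕ
  entries p b = 500 ∷ 100 ∷ 30 ∷ 600 ∷ []

head₁₄ : Head 14 15
head₁₄ = record
  { entries = entries
  ; size = λ _ _ → refl
  ; ok = forBits (λ p b b′ b″ → HeadOK (headWindow entries p b b′ b″) 14 15) _ _ _ _ _ _ _ _ _ _ _ _ _ _ _ _
  }
  where
  entries : Bool → Bool → List ℕ
  entries p b = 500 ∷ 100 ∷ 30 ∷ level p b 2 ∷ 120 ∷ 1 ∷ 0 ∷ 71 ∷ 501 ∷ 101 ∷ 31 ∷ suc (level p b 2) ∷ 121 ∷ 2 ∷ []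

head₁₆ : Head 16 15
head₁₆ = record
  { entries = entries
  ; size = λ _ _ → refl
  ; ok = forBits (λ p b b′ b″ → HeadOK (headWindow entries p b b′ b″) 16 15) _ _ _ _ _ _ _ _ _ _ _ _ _ _ _ _
  }
  where
  entries : Bool → Bool → List ℕ
  entries p b = 500 ∷ 481 ∷ 30 ∷ level p b 2 ∷ 120 ∷ 50 ∷ level p b 5 ∷ 482 ∷
    501 ∷ 483 ∷ 31 ∷ suc (level p b 2) ∷ 121 ∷ 51 ∷ suc (level p b 5) ∷ 600 ∷ []

module _ {len m : ℕ} (head : Head len m) where
  open Head head

  headed : ∀ {o b} → Regular o b → ∀ m₁ → T (endCrucial? m₁ (λ i → b (o + i))) → ∀ w →
           (∀ x → x < 15 → b (w * 8 + x) ≡ body (w * 8 + x)) → o + m₁ ≤ w * 8 + 15 → o ≤ w * 8 →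
           ∀ n → o + n ≡ w * 8 + (15 + len) → BicrucialOfLength n
  headed {o} {b} regular m₁ leftCheck w same fits o-fits n length-eq =
    family o b regular w xs (headWindow entries (odd? w) (paperfold w) (paperfold (1 + w)) (paperfold (2 + w))) m₁ m
      (λ x _ → spliceAt-shift {w * 8} {15} {b} {_} {xs} (λ x x<15 → trans (same x x<15) (body-window w x (<-≤-trans x<15 (m≤m+n 15 9)))) x)
      (subst (λ l → HeadOK (headWindow entries (odd? w) (paperfold w) (paperfold (1 + w)) (paperfold (2 + w))) l m)
        (sym (size _ _)) (ok (odd? w) (paperfold w) (paperfold (1 + w)) (paperfold (2 + w))))
      leftCheck fits o-fits n (trans length-eq (cong (λ l → w * 8 + (15 + l)) (sym (size _ _))))
    where
    xs : List ℕ
    xs = entries (odd? w) (paperfold (2 + w))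

  easyHeaded : ∀ v → BicrucialOfLength (19 + len + v * 8)
  easyHeaded v = headed easy-regular 7 tt (suc v) (λ _ _ → refl) (≤-trans (m≤m+n 11 4) (m≤n+m 15 (suc v * 8))) (m≤m+n 4 _) _ (eq len (v * 8))
    where
    eq : ∀ len y → 4 + (19 + len + y) ≡ 8 + y + (15 + len)
    eq = solve-∀

  hardHeaded : ∀ v → BicrucialOfLength (46 + len + v * 8)
  hardHeaded v = headed hard-regular 31 tt (4 + v)
    (λ x _ → hard-body {(4 + v) * 8 + x} (m≤m+n 32 _)) (m≤m+n 32 _) (m≤m+n 1 _) _ (eq len (v * 8))
    where
    eq : ∀ len y → 1 + (46 + len + y) ≡ 32 + y + (15 + len)
    eq = solve-∀

-- With `w` equal to 3 the window begins at index 24, inside `tail`, where `hard` is not `body`. For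
-- this and the next three lengths the conditions on the head are therefore evaluated on the
-- sequence itself.
bicrucial40 : BicrucialOfLength 40
bicrucial40 = family 1 hard hard-regular 3 (Head.entries head₂ (odd? 3) (paperfold 5)) _ 31 7 (λ _ _ → refl) _ tt (m≤m+n 32 7) (m≤m+n 1 23) 40 refl

bicrucial42 : BicrucialOfLength 42
bicrucial42 = family 1 hard hard-regular 3 (Head.entries head₄ (odd? 3) (paperfold 5)) _ 31 7 (λ _ _ → refl) _ tt (m≤m+n 32 7) (m≤m+n 1 23) 42 refl

bicrucial52 : BicrucialOfLength 52
bicrucial52 = family 1 hard hard-regular 3 (Head.entries head₁₄ (odd? 3) (paperfold 5)) _ 31 15 (λ _ _ → refl) _ tt (m≤m+n 32 7) (m≤m+n 1 23) 52 refl

bicrucial54 : BicrucialOfLength 54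
bicrucial54 = family 1 hard hard-regular 3 (Head.entries head₁₆ (odd? 3) (paperfold 5)) _ 31 15 (λ _ _ → refl) _ tt (m≤m+n 32 7) (m≤m+n 1 23) 54 refl

-- All lengths that occur

even⇒¬odd : ∀ {n} → 2 ∣ n → odd? n ≢ true
even⇒¬odd (divides k refl) = doubled k
  where
  doubled : ∀ k → odd? (k * 2) ≢ true
  doubled zero    ()
  doubled (suc k) with odd? (k * 2) in eq
  ... | true  = λ _ → doubled k eq
  ... | false = λ ()

odd⇒¬even : ∀ {n} → 2 ∤ n → odd? n ≢ false
odd⇒¬even {n} 2∤n eq with halve n
... | even m = 2∤n (divides m (double m))
  where
  double : ∀ m → m + m ≡ m * 2
  double = solve-∀
... | odd m with () ← trans (sym eq) (odd?-odd m)

odd?-*8 : ∀ q → odd? (q * 8) ≡ false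
odd?-*8 zero = refl
odd?-*8 (suc q) rewrite odd?-*8 q = refl

-- The head lengths 2, 4, 14, 16 represent the four even residues modulo 8. With the easy beginning
-- they reach every odd length from 21 on, except 25 and 27.
oddLength : ∀ q r → odd? (13 + (toℕ r + q * 8)) ≢ false → BicrucialOfLength (13 + (toℕ {8} r + q * 8))
oddLength zero          0F _ = bicrucial13
oddLength (suc v)       0F _ = easyHeaded head₂ v
oddLength zero          2F _ = bicrucial15
oddLength (suc v)       2F _ = easyHeaded head₄ v
oddLength zero          4F _ = bicrucial17
oddLength (suc zero)    4F _ = bicrucial25
oddLength (suc (suc v)) 4F _ = easyHeaded head₁₄ v
oddLength zero          6F _ = bicrucial19
oddLength (suc zero)    6F _ = bicrucial27
oddLength (suc (suc v)) 6F _ = easyHeaded head₁₆ v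
oddLength q 1F n-odd rewrite odd?-*8 q = contradiction refl n-odd
oddLength q 3F n-odd rewrite odd?-*8 q = contradiction refl n-odd
oddLength q 5F n-odd rewrite odd?-*8 q = contradiction refl n-odd
oddLength q 7F n-odd rewrite odd?-*8 q = contradiction refl n-odd

evenLength : ∀ q r → odd? (32 + (toℕ r + q * 8)) ≢ true → 32 + (toℕ r + q * 8) ≢ 38 →
             BicrucialOfLength (32 + (toℕ {8} r + q * 8))
evenLength zero                0F _ _   = bicrucial32
evenLength (suc zero)          0F _ _   = bicrucial40
evenLength (suc (suc v))       0F _ _   = hardHeaded head₂ v
evenLength zero                2F _ _   = bicrucial34
evenLength (suc zero)          2F _ _   = bicrucial42
evenLength (suc (suc v))       2F _ _   = hardHeaded head₄ v
evenLength zero                4F _ _   = bicrucial36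
evenLength (suc zero)          4F _ _   = bicrucial44
evenLength (suc (suc zero))    4F _ _   = bicrucial52
evenLength (suc (suc (suc v))) 4F _ _   = hardHeaded head₁₄ v
evenLength zero                6F _ ≢38 = contradiction refl ≢38
evenLength (suc zero)          6F _ _   = bicrucial46
evenLength (suc (suc zero))    6F _ _   = bicrucial54
evenLength (suc (suc (suc v))) 6F _ _   = hardHeaded head₁₆ v
evenLength q 1F n-even _ rewrite odd?-*8 q = contradiction refl n-even
evenLength q 3F n-even _ rewrite odd?-*8 q = contradiction refl n-even
evenLength q 5F n-even _ rewrite odd?-*8 q = contradiction refl n-even
evenLength q 7F n-even _ rewrite odd?-*8 q = contradiction refl n-even

bicrucialExists : ∀ {n} → n ≡ 9 ⊎ (2 ∤ n × 13 ≤ n) ⊎ (2 ∣ n × 32 ≤ n × n ≢ 38) → BicrucialOfLength n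
bicrucialExists (inj₁ refl) = bicrucial9
bicrucialExists {n} (inj₂ (inj₁ (2∤n , 13≤n))) =
  split (m+[n∸m]≡n 13≤n) ((n ∸ 13) divMod 8)
  where
  split : 13 + (n ∸ 13) ≡ n → DivMod (n ∸ 13) 8 → BicrucialOfLength n
  split eq (result q r eq′) = subst BicrucialOfLength n-eq (oddLength q r (subst (λ n → odd? n ≢ false) (sym n-eq) (odd⇒¬even 2∤n)))
    where
    n-eq : 13 + (toℕ r + q * 8) ≡ n
    n-eq = trans (cong (13 +_) (sym eq′)) eq
bicrucialExists {n} (inj₂ (inj₂ (2∣n , 32≤n , n≢38))) =
  split (m+[n∸m]≡n 32≤n) ((n ∸ 32) divMod 8)
  where
  split : 32 + (n ∸ 32) ≡ n → DivMod (n ∸ 32) 8 → BicrucialOfLength n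
  split eq (result q r eq′) = subst BicrucialOfLength n-eq (evenLength q r (subst (λ n → odd? n ≢ true) (sym n-eq) (even⇒¬odd 2∣n))
                                (n≢38 ∘ trans (sym n-eq)))
    where
    n-eq : 32 + (toℕ r + q * 8) ≡ n
    n-eq = trans (cong (32 +_) (sym eq′)) eq

-- Lengths without bicrucial permutations

bump : ℕ → ℕ → ℕ
bump zero    x       = suc x
bump (suc v) zero    = zero
bump (suc v) (suc x) = suc (bump v x)

toℕ-punchIn : ∀ {n} (v : Fin (suc n)) x → toℕ (punchIn v x) ≡ bump (toℕ v) (toℕ x)
toℕ-punchIn zero    x       = refl
toℕ-punchIn (suc v) zero    = refl
toℕ-punchIn (suc v) (suc x) = cong suc (toℕ-punchIn v x)

bump-mono : ∀ v {x y} → x < y → bump v x < bump v y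
bump-mono zero    x<y                     = s≤s x<y
bump-mono (suc v) {zero}  {suc y} _         = s≤s z≤n
bump-mono (suc v) {suc x} {suc y} (s≤s x<y) = s≤s (bump-mono v x<y)

bump-cancel : ∀ v {x y} → bump v x < bump v y → x < y
bump-cancel v {x} {y} lt with <-cmp x y
... | tri< x<y _ _  = x<y
... | tri≈ _ refl _ = contradiction lt (<-irrefl refl)
... | tri> _ _ y<x  = contradiction lt (<-asym (bump-mono v y<x))

bump-below : ∀ v {x} → x < v → bump v x < v
bump-below (suc v) {zero}  _         = s≤s z≤n
bump-below (suc v) {suc x} (s≤s x<v) = s≤s (bump-below v x<v)

bump-above : ∀ v {x} → v ≤ x → v < bump v x
bump-above zero    _         = s≤s z≤n
bump-above (suc v) (s≤s v≤x) = s≤s (bump-above v v≤x)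

bump-⇔ : ∀ v {x y x′ y′} → x′ ≡ bump v x → y′ ≡ bump v y → x < y ⇔ x′ < y′
bump-⇔ v refl refl = mk⇔ (bump-mono v) (bump-cancel v)

Inside : ℕ → ℕ → Set
Inside ℓ a = 1 ≤ a × a < ℓ

-- h 1, h 2, … are the entries read from the end that is extended by a value v.
Matched : ℕ → (ℕ → ℕ) → ℕ → ℕ → Set
Matched n h v ℓ = 2 ≤ ℓ × ℓ + ℓ ≤ suc n ×
  (∀ a b → Inside ℓ a → Inside ℓ b → h a < h b → h (ℓ + a) < h (ℓ + b)) ×
  (∀ a → Inside ℓ a → h a < v → h (ℓ + a) < h ℓ) ×
  (∀ a → Inside ℓ a → v ≤ h a → h ℓ < h (ℓ + a))

matched : ∀ {n} h v y ℓ → y 0 ≡ v → (∀ a → 1 ≤ a → a ≤ n → y a ≡ bump v (h a)) →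
          2 ≤ ℓ → ℓ + ℓ ≤ suc n → Square y 0 ℓ → Matched n h v ℓ
matched {n} h v y ℓ y₀ yₐ 2≤ℓ fits square = 2≤ℓ , fits ,
  (λ a b (1≤a , a<ℓ) (1≤b , b<ℓ) lt → bump-cancel v (subst₂ _<_ (yₐ _ (late 1≤a) (late≤ a<ℓ)) (yₐ _ (late 1≤b) (late≤ b<ℓ))
    (to (square a b a<ℓ b<ℓ) (subst₂ _<_ (sym (yₐ a 1≤a (early≤ a<ℓ))) (sym (yₐ b 1≤b (early≤ b<ℓ))) (bump-mono v lt))))) ,
  (λ a (1≤a , a<ℓ) lt → bump-cancel v (subst₂ _<_ (yₐ _ (late 1≤a) (late≤ a<ℓ)) (yℓ)
    (to (square a 0 a<ℓ 0<ℓ) (subst₂ _<_ (sym (yₐ a 1≤a (early≤ a<ℓ))) (sym y₀) (bump-below v lt))))) ,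
  (λ a (1≤a , a<ℓ) le → bump-cancel v (subst₂ _<_ (yℓ) (yₐ _ (late 1≤a) (late≤ a<ℓ))
    (to (square 0 a 0<ℓ a<ℓ) (subst₂ _<_ (sym y₀) (sym (yₐ a 1≤a (early≤ a<ℓ))) (bump-above v le)))))
  where
  0<ℓ : 0 < ℓ
  0<ℓ = ≤-trans (s≤s z≤n) 2≤ℓ
  late : ∀ {a} → 1 ≤ a → 1 ≤ ℓ + a
  late {a} 1≤a = ≤-trans 1≤a (m≤n+m a ℓ)
  late≤ : ∀ {a} → a < ℓ → ℓ + a ≤ n
  late≤ a<ℓ = s≤s⁻¹ (≤-trans (+-monoʳ-< ℓ a<ℓ) fits)
  early≤ : ∀ {a} → a < ℓ → a ≤ n
  early≤ {a} a<ℓ = ≤-trans (m≤n+m a ℓ) (late≤ a<ℓ)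
  yℓ : y (ℓ + 0) ≡ bump v (h ℓ)
  yℓ = trans (cong y (+-identityʳ ℓ)) (yₐ ℓ 0<ℓ (subst (_≤ n) (+-identityʳ ℓ) (late≤ 0<ℓ)))

unbump : ∀ {n k ℓ} (w y : ℕ → ℕ) v → (∀ i → i < n → y i ≡ bump v (w i)) → k + ℓ + ℓ ≤ n → Square y k ℓ → Square w k ℓ
unbump {n} {k} {ℓ} w y v same fits square a b a<ℓ b<ℓ =
  mk⇔ (λ lt → from (late-⇔) (to (square a b a<ℓ b<ℓ) (to early-⇔ lt)))
      (λ lt → from early-⇔ (from (square a b a<ℓ b<ℓ) (to late-⇔ lt)))
  where
  inside : ∀ {c} → c < ℓ → k + ℓ + c < n
  inside c<ℓ = <-≤-trans (+-monoʳ-< (k + ℓ) c<ℓ) fits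
  early-⇔ : w (k + a) < w (k + b) ⇔ y (k + a) < y (k + b)
  early-⇔ = bump-⇔ v (same _ (≤-<-trans (+-monoˡ-≤ a (m≤m+n k ℓ)) (inside a<ℓ))) (same _ (≤-<-trans (+-monoˡ-≤ b (m≤m+n k ℓ)) (inside b<ℓ)))
  late-⇔ : w (k + ℓ + a) < w (k + ℓ + b) ⇔ y (k + ℓ + a) < y (k + ℓ + b)
  late-⇔ = bump-⇔ v (same _ (inside a<ℓ)) (same _ (inside b<ℓ))

SquareFreeSeq : ℕ → (ℕ → ℕ) → Set
SquareFreeSeq n h = ∀ i ℓ → 1 ≤ i → 2 ≤ ℓ → i + ℓ + ℓ ≤ suc n → ¬ Square h i ℓ

Distinct : ℕ → (ℕ → ℕ) → Set
Distinct n h = ∀ i j → 1 ≤ i → i ≤ n → 1 ≤ j → j ≤ n → h i ≡ h j → i ≡ j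

-- All that the impossibility proofs use of an end. Indices start at 1, index 0 being the place of
-- the new entry; both ends give the same kind of data.
record EndData (n : ℕ) (h : ℕ → ℕ) : Set where
  field
    distinct   : Distinct n h
    bounded    : ∀ i → 1 ≤ i → i ≤ n → h i < n
    squareFree : SquareFreeSeq n h
    cut        : ∀ v → v ≤ n → ∃[ ℓ ] Matched n h v ℓ

punchIn-last : ∀ {n} (k : Fin n) → punchIn (fromℕ n) k ≡ inject₁ k
punchIn-last zero    = refl
punchIn-last (suc k) = cong suc (punchIn-last k)

module _ {n : ℕ} (σ : Permutation′ n) where

  private
    w = at (word σ)

    w-bounded : ∀ i → i < n → w i < n
    w-bounded i i<n = subst (_< n) (sym (at-< (word σ) i<n)) (toℕ<n (σ ⟨$⟩ʳ fromℕ< i<n))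

    w-distinct : ∀ i j → i < n → j < n → w i ≡ w j → i ≡ j
    w-distinct i j i<n j<n eq = trans (sym (toℕ-fromℕ< i<n)) (trans
      (cong toℕ (word-injective σ (trans (sym (at-< (word σ) i<n)) (trans eq (at-< (word σ) j<n))))) (toℕ-fromℕ< j<n))

    pred< : ∀ {i} → 1 ≤ i → i ≤ n → i ∸ 1 < n
    pred< {suc i} _ i<n = i<n

  -- A square that misses the new entry would, after undoing `bump`, be a square of `σ`. So the
  -- square found in an extension starts at the new entry.
  leftData : LeftCrucial σ → EndData n (λ i → w (i ∸ 1))
  leftData (squareFree , crucial) = record
    { distinct = λ { (suc i) (suc j) _ i<n _ j<n eq → cong suc (w-distinct i j i<n j<n eq) }
    ; bounded = λ i 1≤i i≤n → w-bounded (i ∸ 1) (pred< 1≤i i≤n)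
    ; squareFree = λ { (suc i) ℓ _ 2≤ℓ fits square → squareFree (containsSquare⇐ σ (i , ℓ , 2≤ℓ , s≤s⁻¹ fits , square)) }
    ; cut = λ v v≤n → cut (fromℕ< (s≤s v≤n)) v (toℕ-fromℕ< (s≤s v≤n))
    }
    where
    cut : (f : Fin (suc n)) → ∀ v → toℕ f ≡ v → ∃[ ℓ ] Matched n (λ i → w (i ∸ 1)) v ℓ
    cut f v refl = found (containsSquare⇒ π (crucial π ext))
      where
      π : Permutation′ (suc n)
      π = insert zero f σ
      y = at (word π)
      new : word π zero ≡ v
      new = cong toℕ (insert-self zero f σ)
      old : ∀ k → word π (suc k) ≡ bump v (word σ k)
      old k = trans (cong toℕ (insert-punchIn zero f σ k)) (toℕ-punchIn f (σ ⟨$⟩ʳ k))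
      ext : IsLeftExtension σ π
      ext i j = mk⇔ (from eq) (to eq)
        where
        eq : word σ i < word σ j ⇔ word π (suc i) < word π (suc j)
        eq = bump-⇔ v (old i) (old j)
      y-old : ∀ i → i < n → y (suc i) ≡ bump v (w i)
      y-old i i<n = trans (at-< (word π ∘ suc) i<n) (trans (old (fromℕ< i<n)) (cong (bump v) (sym (at-< (word σ) i<n))))
      found : HasSquare y (suc n) → ∃[ ℓ ] Matched n (λ i → w (i ∸ 1)) v ℓ
      found (zero , ℓ , 2≤ℓ , fits , square) = ℓ , matched (λ i → w (i ∸ 1)) v y ℓ new
        (λ { (suc a) _ a<n → y-old a a<n }) 2≤ℓ fits square
      found (suc k , ℓ , 2≤ℓ , fits , square) = contradiction
        (containsSquare⇐ σ (k , ℓ , 2≤ℓ , s≤s⁻¹ fits , unbump w (y ∘ suc) v y-old (s≤s⁻¹ fits) square)) squareFree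

  rightData : RightCrucial σ → EndData n (λ i → w (n ∸ i))
  rightData (squareFree , crucial) = record
    { distinct = λ i j 1≤i i≤n 1≤j j≤n eq → ∸-cancelˡ-≡ i≤n j≤n (w-distinct (n ∸ i) (n ∸ j) (mirror< 1≤i i≤n) (mirror< 1≤j j≤n) eq)
    ; bounded = λ i 1≤i i≤n → w-bounded (n ∸ i) (mirror< 1≤i i≤n)
    ; squareFree = mirrored
    ; cut = λ v v≤n → cut (fromℕ< (s≤s v≤n)) v (toℕ-fromℕ< (s≤s v≤n))
    }
    where
    mirror< : ∀ {i} → 1 ≤ i → i ≤ n → n ∸ i < n
    mirror< {i} 1≤i i≤n = ∸-monoʳ-< {n} 1≤i i≤n
    mirrored : SquareFreeSeq n (λ i → w (n ∸ i))
    mirrored i ℓ 1≤i 2≤ℓ fits square = squareFree (containsSquare⇐ σ (K , ℓ , 2≤ℓ , fits′ ,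
      mirrorSquare {n} {K} {i} {ℓ} (λ i → w (n ∸ i)) w (λ { p q refl → cong w (m+n∸m≡n p q) }) total square))
      where
      K = suc n ∸ (i + ℓ + ℓ)
      total : i + K + ℓ + ℓ ≡ suc n
      total = trans (rearrange i K ℓ) (m+[n∸m]≡n fits)
        where
        rearrange : ∀ i K ℓ → i + K + ℓ + ℓ ≡ i + ℓ + ℓ + K
        rearrange = solve-∀
      fits′ : K + ℓ + ℓ ≤ n
      fits′ = s≤s⁻¹ (≤-trans (+-monoˡ-≤ (K + ℓ + ℓ) 1≤i) (≤-reflexive (trans (rearrange i K ℓ) total)))
        where
        rearrange : ∀ i K ℓ → i + (K + ℓ + ℓ) ≡ i + K + ℓ + ℓ
        rearrange = solve-∀
    cut : (f : Fin (suc n)) → ∀ v → toℕ f ≡ v → ∃[ ℓ ] Matched n (λ i → w (n ∸ i)) v ℓ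
    cut f v refl = found (containsSquare⇒ π (crucial π ext))
      where
      π : Permutation′ (suc n)
      π = insert (fromℕ n) f σ
      y = at (word π)
      new : y n ≡ v
      new = trans (cong y (sym (toℕ-fromℕ n))) (trans (at-toℕ (word π) (fromℕ n)) (cong toℕ (insert-self (fromℕ n) f σ)))
      old : ∀ k → word π (inject₁ k) ≡ bump v (word σ k)
      old k = trans (cong (word π) (sym (punchIn-last k))) (trans (cong toℕ (insert-punchIn (fromℕ n) f σ k)) (toℕ-punchIn f (σ ⟨$⟩ʳ k)))
      ext : IsRightExtension σ π
      ext i j = mk⇔ (from eq) (to eq)
        where
        eq : word σ i < word σ j ⇔ word π (inject₁ i) < word π (inject₁ j)
        eq = bump-⇔ v (old i) (old j)
      y-old : ∀ i → i < n → y i ≡ bump v (w i)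
      y-old i i<n = trans (cong y (sym (trans (toℕ-inject₁ _) (toℕ-fromℕ< i<n)))) (trans (at-toℕ (word π) (inject₁ (fromℕ< i<n)))
        (trans (old (fromℕ< i<n)) (cong (bump v) (sym (at-< (word σ) i<n)))))
      found : HasSquare y (suc n) → ∃[ ℓ ] Matched n (λ i → w (n ∸ i)) v ℓ
      found (k , ℓ , 2≤ℓ , fits , square) with m≤n⇒m<n∨m≡n fits
      ... | inj₁ (s≤s fits′) = contradiction (containsSquare⇐ σ (k , ℓ , 2≤ℓ , fits′ , unbump w y v y-old fits′ square)) squareFree
      ... | inj₂ total = ℓ , matched (λ i → w (n ∸ i)) v (λ i → y (n ∸ i)) ℓ new
              (λ a 1≤a a≤n → y-old (n ∸ a) (mirror< 1≤a a≤n)) 2≤ℓ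
              (≤-trans (+-monoˡ-≤ ℓ (m≤n+m ℓ k)) fits)
              (mirrorSquare {n} {0} {k} {ℓ} y (λ i → y (n ∸ i)) (λ { p q refl → cong y (sym (m+n∸n≡m p q)) })
                (trans (cong (λ t → t + ℓ + ℓ) (+-identityʳ k)) total) square)

-- Comparisons up to reversal of the order

Rel : Bool → (ℕ → ℕ) → ℕ → ℕ → Set
Rel true  h i j = h i < h j
Rel false h i j = h j < h i

Rel-asym : ∀ o {h i j} → Rel o h i j → ¬ Rel o h j i
Rel-asym true  = <-asym
Rel-asym false = <-asym

Rel-trans : ∀ o {h i j k} → Rel o h i j → Rel o h j k → Rel o h i k
Rel-trans true  p q = <-trans p q
Rel-trans false p q = <-trans q p

SameRel : (R : ℕ → ℕ → Set) → ℕ → ℕ → ℕ → ℕ → Set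
SameRel R a b c d = (R a b × R c d) ⊎ (R b a × R d c)

Rel-total : ∀ o {h i j} → h i ≢ h j → Rel o h i j ⊎ Rel o h j i
Rel-total o {h} {i} {j} ≢ with <-cmp (h i) (h j)
Rel-total o     ≢ | tri≈ _ eq _ = contradiction eq ≢
Rel-total true  ≢ | tri< lt _ _ = inj₁ lt
Rel-total false ≢ | tri< lt _ _ = inj₂ lt
Rel-total true  ≢ | tri> _ _ gt = inj₂ gt
Rel-total false ≢ | tri> _ _ gt = inj₁ gt

SameRel⇒⇔ : ∀ o {h a b c d} → SameRel (Rel o h) a b c d → h a < h b ⇔ h c < h d
SameRel⇒⇔ true  (inj₁ (p , q)) = mk⇔ (λ _ → q) (λ _ → p)
SameRel⇒⇔ true  (inj₂ (p , q)) = mk⇔ (λ lt → contradiction p (<-asym lt)) (λ lt → contradiction q (<-asym lt))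
SameRel⇒⇔ false (inj₁ (p , q)) = mk⇔ (λ lt → contradiction p (<-asym lt)) (λ lt → contradiction q (<-asym lt))
SameRel⇒⇔ false (inj₂ (p , q)) = mk⇔ (λ _ → q) (λ _ → p)

Found : ℕ → (ℕ → ℕ → Set) → ℕ → Set
Found n R ℓ = 2 ≤ ℓ × ℓ + ℓ ≤ suc n × (∀ a b → Inside ℓ a → Inside ℓ b → R a b → R (ℓ + a) (ℓ + b))

-- Extensions by an entry just above the j-th one, respectively above all entries.
FoundAbove : ℕ → (ℕ → ℕ → Set) → ℕ → ℕ → Set
FoundAbove n R j ℓ = Found n R ℓ × (∀ a → Inside ℓ a → R a j ⊎ a ≡ j → R (ℓ + a) ℓ) ×
  (∀ a → Inside ℓ a → R j a → R ℓ (ℓ + a))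

FoundTop : ℕ → (ℕ → ℕ → Set) → ℕ → Set
FoundTop n R ℓ = Found n R ℓ × (∀ a → Inside ℓ a → R (ℓ + a) ℓ)

-- In the direct order the place just above entry `j` is the cut at `suc (h j)`; in the reversed
-- order it is the cut at `h j`, which moves entry `j` and all larger ones away.
foundAbove : ∀ {n h} o → EndData n h → ∀ j → 1 ≤ j → j ≤ n → ∃[ ℓ ] FoundAbove n (Rel o h) j ℓ
foundAbove {n} {h} true end j 1≤j j≤n with EndData.cut end (suc (h j)) (EndData.bounded end j 1≤j j≤n)
... | ℓ , 2≤ℓ , fits , match , below , over = ℓ , (2≤ℓ , fits , match) ,
      (λ { a ia (inj₁ lt) → below a ia (m≤n⇒m≤1+n lt) ; a ia (inj₂ refl) → below a ia ≤-refl }) , over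
foundAbove {n} {h} false end j 1≤j j≤n with EndData.cut end (h j) (<⇒≤ (EndData.bounded end j 1≤j j≤n))
... | ℓ , 2≤ℓ , fits , match , below , over = ℓ , (2≤ℓ , fits , λ a b ia ib → match b a ib ia) ,
      (λ { a ia (inj₁ lt) → over a ia (<⇒≤ lt) ; a ia (inj₂ refl) → over a ia ≤-refl }) , below

foundTop : ∀ {n h} o → EndData n h → ∃[ ℓ ] FoundTop n (Rel o h) ℓ
foundTop {n} true end with EndData.cut end n ≤-refl
... | ℓ , 2≤ℓ , fits , match , below , _ = ℓ , (2≤ℓ , fits , match) ,
      λ a (1≤a , a<ℓ) → below a (1≤a , a<ℓ) (EndData.bounded end a 1≤a (s≤s⁻¹ (≤-trans a<ℓ (≤-trans (m≤m+n ℓ ℓ) fits))))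
foundTop false end with EndData.cut end 0 z≤n
... | ℓ , 2≤ℓ , fits , match , _ , over = ℓ , (2≤ℓ , fits , λ a b ia ib → match b a ib ia) , λ a ia → over a ia z≤n

module Oriented {n h} (end : EndData n h) (o : Bool) where
  open EndData end

  R : ℕ → ℕ → Set
  R = Rel o h

  total : ∀ i j → 1 ≤ i → i ≤ n → 1 ≤ j → j ≤ n → i ≢ j → R i j ⊎ R j i
  total i j 1≤i i≤n 1≤j j≤n i≢j = Rel-total o (i≢j ∘ distinct i j 1≤i i≤n 1≤j j≤n)

  asym : ∀ {i j} → R i j → R j i → ⊥
  asym = Rel-asym o {h}

  trans′ : ∀ {i j k} → R i j → R j k → R i k
  trans′ = Rel-trans o {h}

  noSquare : ∀ i ℓ → 1 ≤ i → 2 ≤ ℓ → i + ℓ + ℓ ≤ suc n →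
             (∀ a b → a < b → b < ℓ → SameRel R (i + a) (i + b) (i + ℓ + a) (i + ℓ + b)) → ⊥
  noSquare i ℓ 1≤i 2≤ℓ fits same = squareFree i ℓ 1≤i 2≤ℓ fits square
    where
    flipped : ∀ {a b c d} → SameRel R a b c d → SameRel R b a d c
    flipped (inj₁ pq) = inj₂ pq
    flipped (inj₂ pq) = inj₁ pq
    square : Square h i ℓ
    square a b a<ℓ b<ℓ with <-cmp a b
    ... | tri< a<b _ _  = SameRel⇒⇔ o {h} (same a b a<b b<ℓ)
    ... | tri≈ _ refl _ = mk⇔ (λ lt → contradiction lt (<-irrefl refl)) (λ lt → contradiction lt (<-irrefl refl))
    ... | tri> _ _ b<a  = SameRel⇒⇔ o {h} (flipped (same b a b<a a<ℓ))

  noSquare₂ : ∀ i → 1 ≤ i → 3 + i ≤ n → SameRel R i (1 + i) (2 + i) (3 + i) → ⊥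
  noSquare₂ i 1≤i fits s = noSquare i 2 1≤i ≤-refl (subst (_≤ suc n) (sum i) (s≤s fits))
    λ { zero (suc zero) _ _ → subst₂ (λ a b → SameRel R a b (i + 2 + 0) (i + 2 + 1)) (sym (+-identityʳ i)) (+-comm 1 i)
          (subst₂ (SameRel R i (1 + i)) (trans (+-comm 2 i) (sym (+-identityʳ _))) (trans (+-comm 3 i) (sym (+-assoc i 2 1))) s)
      ; (suc _) (suc zero) (s≤s ()) _
      ; _ (suc (suc _)) _ (s≤s (s≤s ())) }
    where
    sum : ∀ i → 4 + i ≡ i + 2 + 2
    sum = solve-∀

  noSquare₄ : ∀ i → 1 ≤ i → 7 + i ≤ n →
    SameRel R i (1 + i) (4 + i) (5 + i) → SameRel R i (2 + i) (4 + i) (6 + i) → SameRel R i (3 + i) (4 + i) (7 + i) →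
    SameRel R (1 + i) (2 + i) (5 + i) (6 + i) → SameRel R (1 + i) (3 + i) (5 + i) (7 + i) →
    SameRel R (2 + i) (3 + i) (6 + i) (7 + i) → ⊥
  noSquare₄ i 1≤i fits s₀₁ s₀₂ s₀₃ s₁₂ s₁₃ s₂₃ = noSquare i 4 1≤i (s≤s (s≤s z≤n)) (subst (_≤ suc n) (sum i) (s≤s fits))
    λ { 0 1 _ _ → move 0 1 s₀₁ ; 0 2 _ _ → move 0 2 s₀₂ ; 0 3 _ _ → move 0 3 s₀₃
      ; 1 2 _ _ → move 1 2 s₁₂ ; 1 3 _ _ → move 1 3 s₁₃ ; 2 3 _ _ → move 2 3 s₂₃
      ; (suc _) 1 (s≤s ()) _ ; (suc (suc _)) 2 (s≤s (s≤s ())) _ ; (suc (suc (suc _))) 3 (s≤s (s≤s (s≤s ()))) _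
      ; _ (suc (suc (suc (suc _)))) _ (s≤s (s≤s (s≤s (s≤s ())))) }
    where
    sum : ∀ i → 8 + i ≡ i + 4 + 4
    sum = solve-∀
    shift : ∀ i a → 4 + (a + i) ≡ i + 4 + a
    shift = solve-∀
    move : ∀ a b → SameRel R (a + i) (b + i) (4 + (a + i)) (4 + (b + i)) → SameRel R (i + a) (i + b) (i + 4 + a) (i + 4 + b)
    move a b s = subst₂ (λ x y → SameRel R x y (i + 4 + a) (i + 4 + b)) (+-comm a i) (+-comm b i)
      (subst₂ (SameRel R (a + i) (b + i)) (shift i a) (shift i b) s)

  -- The steps of a square-free sequence repeat the pattern down, up, up, down.
  Step : ℕ → ℕ → ℕ → Set
  Step 0 i j = R j i
  Step 1 i j = R i j
  Step 2 i j = R i j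
  Step 3 i j = R j i
  Step (suc (suc (suc (suc t)))) i j = Step t i j

  opposite-step : ∀ t {i j k l} → (SameRel R i j k l → ⊥) → R k l ⊎ R l k → Step t i j → Step (2 + t) k l
  opposite-step 0 ¬same (inj₁ p) q = p
  opposite-step 0 ¬same (inj₂ p) q = contradiction (inj₂ (q , p)) ¬same
  opposite-step 1 ¬same (inj₁ p) q = contradiction (inj₁ (q , p)) ¬same
  opposite-step 1 ¬same (inj₂ p) q = p
  opposite-step 2 ¬same (inj₁ p) q = contradiction (inj₁ (q , p)) ¬same
  opposite-step 2 ¬same (inj₂ p) q = p
  opposite-step 3 ¬same (inj₁ p) q = p
  opposite-step 3 ¬same (inj₂ p) q = contradiction (inj₂ (q , p)) ¬same
  opposite-step (suc (suc (suc (suc t)))) ¬same = opposite-step t ¬same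

  -- Without squares of ℓ = 2, the steps `i` and `2 + i` are opposite, so the first two determine
  -- all. The phase `s` is 0 at a hard end and 3 at an easy one.
  steps : ∀ s → Step (s + 1) 1 2 → Step (s + 2) 2 3 → ∀ i → 1 ≤ i → 1 + i ≤ n → Step (s + i) i (1 + i)
  steps s first second 1 _ _ = first
  steps s first second 2 _ _ = second
  steps s first second (suc (suc i@(suc _))) _ fits =
    subst (λ t → Step t (2 + i) (3 + i)) (sym (trans (+-suc s (suc i)) (cong suc (+-suc s i))))
      (opposite-step (s + i) (noSquare₂ i (s≤s z≤n) fits)
        (total (2 + i) (3 + i) (s≤s z≤n) (≤-trans (n≤1+n _) fits) (s≤s z≤n) fits (1+n≢n ∘ sym))
        (steps s first second i (s≤s z≤n) (≤-trans (m≤n+m (1 + i) 2) fits)))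

lit : ∀ {n b} a → b ≤ n → {T (a ≤ᵇ b)} → a ≤ n
lit a b≤n {t} = ≤-trans (≤ᵇ⇒≤ a _ t) b≤n

in[_] : ∀ a {ℓ} → {T (1 ≤ᵇ a)} → {T (a <ᵇ ℓ)} → Inside ℓ a
in[ a ] {ℓ} {t} {u} = ≤ᵇ⇒≤ 1 a t , <ᵇ⇒< a ℓ u

data Good : ℕ → Set where
  four    : Good 4
  eight   : Good 8
  sixteen : Good 16

-- Hard ends

module Hard {n h} (end : EndData n h) (o : Bool) (first : Rel o h 1 2) (second : Rel o h 2 3) where
  open Oriented end o public

  step : ∀ i → 1 ≤ i → 1 + i ≤ n → Step i i (1 + i)
  step = steps 0 first second

  Step-periodic : ∀ m t → Step (t + m * 4) ≡ Step t
  Step-periodic m t = trans (cong Step (+-comm t (m * 4))) (reduce m)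
    where
    reduce : ∀ m → Step (m * 4 + t) ≡ Step t
    reduce zero    = refl
    reduce (suc m) = reduce m

  stepAt : ∀ m t → 1 ≤ t + m * 4 → 1 + (t + m * 4) ≤ n → Step t (t + m * 4) (1 + (t + m * 4))
  stepAt m t low high = subst (λ S → S (t + m * 4) (1 + (t + m * 4))) (Step-periodic m t) (step (t + m * 4) low high)

  -- Given the steps, e₄ₘ < e₄ₘ₊₂ fixes the order of the four entries from e₄ₘ on. The same
  -- comparison four places later would complete a square with ℓ = 4.
  falls : ∀ m → 1 ≤ m → 7 + m * 4 ≤ n → R (m * 4) (2 + m * 4) → R (6 + m * 4) (4 + m * 4)
  falls m@(suc _) _ fits up with total (4 + m * 4) (6 + m * 4) (s≤s z≤n) (≤-trans (m≤n+m _ 3) fits) (s≤s z≤n) (≤-trans (n≤1+n _) fits)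
                       (<⇒≢ (m≤n+m _ 1))
  ... | inj₂ down = down
  ... | inj₁ up′ = ⊥-elim (noSquare₄ (m * 4) (s≤s z≤n) fits
          (inj₂ (s₀ , s₄)) (inj₁ (up , up′)) (inj₁ (trans′ up s₂ , trans′ up′ s₆))
          (inj₁ (trans′ s₀ up , trans′ s₄ up′)) (inj₁ (trans′ s₀ (trans′ up s₂) , trans′ s₄ (trans′ up′ s₆)))
          (inj₁ (s₂ , s₆)))
    where
    s₀ = stepAt m 0 (s≤s z≤n) (≤-trans (m≤n+m _ 6) fits)
    s₂ = stepAt m 2 (s≤s z≤n) (≤-trans (m≤n+m _ 4) fits)
    s₄ = stepAt m 4 (s≤s z≤n) (≤-trans (m≤n+m _ 2) fits)
    s₆ = stepAt m 6 (s≤s z≤n) fits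

  -- The counterpart of `falls`: a downward comparison fixes the order of four entries if they start
  -- one place before it. Together the two show that a shift of 4 reverses these comparisons and a
  -- shift of 8 keeps them.
  rises : ∀ m → 10 + m * 4 ≤ n → R (6 + m * 4) (4 + m * 4) → R (8 + m * 4) (10 + m * 4)
  rises m fits down with total (8 + m * 4) (10 + m * 4) (s≤s z≤n) (≤-trans (m≤n+m _ 2) fits) (s≤s z≤n) fits (<⇒≢ (m≤n+m _ 1))
  ... | inj₁ up = up
  ... | inj₂ down′ = ⊥-elim (noSquare₄ (3 + m * 4) (s≤s z≤n) fits
          (inj₂ (s₃ , s₇)) (inj₂ (trans′ s₅ (trans′ down s₃) , trans′ s₉ (trans′ down′ s₇))) (inj₂ (trans′ down s₃ , trans′ down′ s₇))
          (inj₂ (trans′ s₅ down , trans′ s₉ down′)) (inj₂ (down , down′)) (inj₁ (s₅ , s₉)))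
    where
    s₃ = stepAt m 3 (s≤s z≤n) (≤-trans (m≤n+m _ 6) fits)
    s₅ = stepAt m 5 (s≤s z≤n) (≤-trans (m≤n+m _ 4) fits)
    s₇ = stepAt m 7 (s≤s z≤n) (≤-trans (m≤n+m _ 2) fits)
    s₉ = stepAt m 9 (s≤s z≤n) fits

  -- As e₁ is below the new entry, e at ℓ + 1 must be below e at ℓ, but step ℓ is up for ℓ ≡ 1, 2
  -- modulo 4. For ℓ ≡ 3 the rise from e₁ to e₂ would recur at a down step. For ℓ = 12 the
  -- comparison of e₄ with e₆ returns reversed after three shifts of 4. From 20 on, 2ℓ exceeds n +
  -- 1.
  good : ∀ ℓ → n ≤ 38 → Found n R ℓ → (∀ a → Inside ℓ a → R a 1 ⊎ a ≡ 1 → R (ℓ + a) ℓ) → Good ℓ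
  good 0 _ (() , _) _
  good 1 _ (s≤s () , _) _
  good 2 _ (_ , fits , _) b = contradiction (step 2 (s≤s z≤n) (s≤s⁻¹ fits)) (λ p → asym p (b 1 in[ 1 ] (inj₂ refl)))
  good 3 _ (_ , fits , match) b = contradiction (match 1 2 in[ 1 ] in[ 2 ] first) (λ p → asym p (step 4 (s≤s z≤n) (lit 5 (s≤s⁻¹ fits))))
  good 4 _ _ _ = four
  good 5 _ (_ , fits , _) b = contradiction (step 5 (s≤s z≤n) (lit 6 (s≤s⁻¹ fits))) (λ p → asym p (b 1 in[ 1 ] (inj₂ refl)))
  good 6 _ (_ , fits , _) b = contradiction (step 6 (s≤s z≤n) (lit 7 (s≤s⁻¹ fits))) (λ p → asym p (b 1 in[ 1 ] (inj₂ refl)))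
  good 7 _ (_ , fits , match) b = contradiction (match 1 2 in[ 1 ] in[ 2 ] first) (λ p → asym p (step 8 (s≤s z≤n) (lit 9 (s≤s⁻¹ fits))))
  good 8 _ _ _ = eight
  good 9 _ (_ , fits , _) b = contradiction (step 9 (s≤s z≤n) (lit 10 (s≤s⁻¹ fits))) (λ p → asym p (b 1 in[ 1 ] (inj₂ refl)))
  good 10 _ (_ , fits , _) b = contradiction (step 10 (s≤s z≤n) (lit 11 (s≤s⁻¹ fits))) (λ p → asym p (b 1 in[ 1 ] (inj₂ refl)))
  good 11 _ (_ , fits , match) b = contradiction (match 1 2 in[ 1 ] in[ 2 ] first) (λ p → asym p (step 12 (s≤s z≤n) (lit 13 (s≤s⁻¹ fits))))
  good 12 _ (_ , fits , match) b with total 4 6 (s≤s z≤n) (lit 4 (s≤s⁻¹ fits)) (s≤s z≤n) (lit 6 (s≤s⁻¹ fits)) (λ ())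
  ... | inj₁ up = contradiction (falls 3 (s≤s z≤n) (lit 19 (s≤s⁻¹ fits)) (rises 1 (lit 14 (s≤s⁻¹ fits)) (falls 1 (s≤s z≤n) (lit 11 (s≤s⁻¹ fits)) up)))
                    (λ p → asym p (match 4 6 in[ 4 ] in[ 6 ] up))
  ... | inj₂ down = contradiction (rises 2 (lit 18 (s≤s⁻¹ fits)) (falls 2 (s≤s z≤n) (lit 15 (s≤s⁻¹ fits)) (rises 0 (lit 10 (s≤s⁻¹ fits)) down)))
                      (λ p → asym p (match 6 4 in[ 6 ] in[ 4 ] down))
  good 13 _ (_ , fits , _) b = contradiction (step 13 (s≤s z≤n) (lit 14 (s≤s⁻¹ fits))) (λ p → asym p (b 1 in[ 1 ] (inj₂ refl)))
  good 14 _ (_ , fits , _) b = contradiction (step 14 (s≤s z≤n) (lit 15 (s≤s⁻¹ fits))) (λ p → asym p (b 1 in[ 1 ] (inj₂ refl)))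
  good 15 _ (_ , fits , match) b = contradiction (match 1 2 in[ 1 ] in[ 2 ] first) (λ p → asym p (step 16 (s≤s z≤n) (lit 17 (s≤s⁻¹ fits))))
  good 16 _ _ _ = sixteen
  good 17 _ (_ , fits , _) b = contradiction (step 17 (s≤s z≤n) (lit 18 (s≤s⁻¹ fits))) (λ p → asym p (b 1 in[ 1 ] (inj₂ refl)))
  good 18 _ (_ , fits , _) b = contradiction (step 18 (s≤s z≤n) (lit 19 (s≤s⁻¹ fits))) (λ p → asym p (b 1 in[ 1 ] (inj₂ refl)))
  good 19 _ (_ , fits , match) b = contradiction (match 1 2 in[ 1 ] in[ 2 ] first) (λ p → asym p (step 20 (s≤s z≤n) (lit 21 (s≤s⁻¹ fits))))
  good (suc (suc (suc (suc (suc (suc (suc (suc (suc (suc (suc (suc (suc (suc (suc (suc (suc (suc (suc (suc ℓ)))))))))))))))))))) n≤38 (_ , fits , _) b =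
    contradiction (≤-trans (+-mono-≤ (m≤m+n 20 ℓ) (m≤m+n 20 ℓ)) (≤-trans fits (s≤s n≤38))) (<⇒≱ ≤-refl)

  record Facts : Set where
    field
      long   : 31 ≤ n
      low₈   : R 10 8
      low₇   : R 7 3
      match₈ : ∀ a b → Inside 8 a → Inside 8 b → R a b → R (8 + a) (8 + b)
      match₁₆ : ∀ a b → Inside 16 a → Inside 16 b → R a b → R (16 + a) (16 + b)

  module _ (n≤38 : n ≤ 38) (3≤n : 3 ≤ n) where

    private
      at₂ : ∀ {ℓ} → Good ℓ → Inside ℓ 2
      at₂ four = in[ 2 ]
      at₂ eight = in[ 2 ]
      at₂ sixteen = in[ 2 ]

      at₃ : ∀ {ℓ} → Good ℓ → Inside ℓ 3
      at₃ four = in[ 3 ]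
      at₃ eight = in[ 3 ]
      at₃ sixteen = in[ 3 ]

      first<third : R 1 3
      first<third = trans′ first second

      up₁ : ∀ {ℓ} → Good ℓ → FoundAbove n R 1 ℓ → R ℓ (ℓ + 2)
      up₁ g (_ , _ , over) = over 2 (at₂ g) first

      down₂ : ∀ {ℓ} → Good ℓ → FoundAbove n R 2 ℓ → R (ℓ + 2) ℓ
      down₂ g (_ , below , _) = below 2 (at₂ g) (inj₂ refl)

      up₂ : ∀ {ℓ} → Good ℓ → FoundAbove n R 2 ℓ → R ℓ (ℓ + 3)
      up₂ g (_ , _ , over) = over 3 (at₃ g) second

      down₃ : ∀ {ℓ} → Good ℓ → FoundAbove n R 3 ℓ → R (ℓ + 2) ℓ
      down₃ g (_ , below , _) = below 2 (at₂ g) (inj₁ second)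

      down₃′ : ∀ {ℓ} → Good ℓ → FoundAbove n R 3 ℓ → R (ℓ + 3) ℓ
      down₃′ g (_ , below , _) = below 3 (at₃ g) (inj₂ refl)

      -- Two gaps are separated by e₂ or e₃. If one ℓ served both, the entry ℓ places after the
      -- separating one would be both above and below the entry at ℓ.
      clash₁₂ : ∀ {ℓ} → Good ℓ → FoundAbove n R 1 ℓ → FoundAbove n R 2 ℓ → ⊥
      clash₁₂ g f₁ f₂ = asym (up₁ g f₁) (down₂ g f₂)

      clash₁₃ : ∀ {ℓ} → Good ℓ → FoundAbove n R 1 ℓ → FoundAbove n R 3 ℓ → ⊥
      clash₁₃ g f₁ f₃ = asym (up₁ g f₁) (down₃ g f₃)

      clash₂₃ : ∀ {ℓ} → Good ℓ → FoundAbove n R 2 ℓ → FoundAbove n R 3 ℓ → ⊥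
      clash₂₃ g f₂ f₃ = asym (up₂ g f₂) (down₃′ g f₃)

      clash₁ₜ : ∀ {ℓ} → Good ℓ → FoundAbove n R 1 ℓ → FoundTop n R ℓ → ⊥
      clash₁ₜ g f₁ (_ , below) = asym (up₁ g f₁) (below 2 (at₂ g))

      clash₂ₜ : ∀ {ℓ} → Good ℓ → FoundAbove n R 2 ℓ → FoundTop n R ℓ → ⊥
      clash₂ₜ g f₂ (_ , below) = asym (up₂ g f₂) (below 3 (at₃ g))

      long : Found n R 16 → 31 ≤ n
      long (_ , fits , _) = s≤s⁻¹ fits

      -- The same ℓ serves the cut just above e₃ and the cut above everything. If e₇ exceeded e₃,
      -- the two cuts would demand opposite comparisons at ℓ and ℓ + 7.
      low₇ : ∀ ℓ → Found n R ℓ → Inside ℓ 7 → FoundAbove n R 3 ℓ → FoundTop n R ℓ → R 7 3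
      low₇ ℓ (_ , fits , _) i₇ (_ , _ , over) (_ , below) with total 7 3 (s≤s z≤n) 7≤n (s≤s z≤n) 3≤n (λ ())
        where
        7≤n : 7 ≤ n
        7≤n = ≤-trans (n≤1+n 7) (s≤s⁻¹ (≤-trans (s≤s (proj₂ i₇)) (≤-trans (+-monoˡ-≤ ℓ (≤-trans (s≤s z≤n) (proj₂ i₇))) fits)))
      ... | inj₁ p = p
      ... | inj₂ p = ⊥-elim (asym (over 7 i₇ p) (below 7 i₇))

      -- An ℓ serving the first gap compares e_ℓ with e_{ℓ+2} differently from one serving
      -- the others, and the comparison is the same for 8 and 16.
      notFirst₈ : 31 ≤ n → FoundAbove n R 1 8 → R 18 16 → Facts
      notFirst₈ 31≤n f₁ down = ⊥-elim (asym down (rises 2 (lit 18 31≤n) (falls 2 (s≤s z≤n) (lit 15 31≤n) (up₁ eight f₁))))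

      notFirst₁₆ : 31 ≤ n → FoundAbove n R 1 16 → R 10 8 → Facts
      notFirst₁₆ 31≤n f₁ down = ⊥-elim (asym (up₁ sixteen f₁) (falls 3 (s≤s z≤n) (lit 19 31≤n) (rises 1 (lit 14 31≤n) down)))

      -- The first three ℓ differ, and the first must be 4. The cut above everything clashes with
      -- the first two, so it shares the third; two assignments survive, and both yield the matches
      -- for 8 and for 16.
      combine : ∀ {ℓ₁ ℓ₂ ℓ₃ ℓₜ} → Good ℓ₁ → Good ℓ₂ → Good ℓ₃ → Good ℓₜ →
        FoundAbove n R 1 ℓ₁ → FoundAbove n R 2 ℓ₂ → FoundAbove n R 3 ℓ₃ → FoundTop n R ℓₜ → Facts
      combine four four _ _ f₁ f₂ f₃ fₜ = ⊥-elim (clash₁₂ four f₁ f₂)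
      combine four _ four _ f₁ f₂ f₃ fₜ = ⊥-elim (clash₁₃ four f₁ f₃)
      combine four _ _ four f₁ f₂ f₃ fₜ = ⊥-elim (clash₁ₜ four f₁ fₜ)
      combine four eight eight _ f₁ f₂ f₃ fₜ = ⊥-elim (clash₂₃ eight f₂ f₃)
      combine four eight _ eight f₁ f₂ f₃ fₜ = ⊥-elim (clash₂ₜ eight f₂ fₜ)
      combine four sixteen sixteen _ f₁ f₂ f₃ fₜ = ⊥-elim (clash₂₃ sixteen f₂ f₃)
      combine four sixteen _ sixteen f₁ f₂ f₃ fₜ = ⊥-elim (clash₂ₜ sixteen f₂ fₜ)
      combine four eight sixteen sixteen f₁ f₂ f₃ fₜ = record
        { long = long (proj₁ f₃) ; low₈ = down₂ eight f₂ ; low₇ = low₇ 16 (proj₁ f₃) in[ 7 ] f₃ fₜ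
        ; match₈ = proj₂ (proj₂ (proj₁ f₂)) ; match₁₆ = proj₂ (proj₂ (proj₁ f₃)) }
      combine four sixteen eight eight f₁ f₂ f₃ fₜ = record
        { long = long (proj₁ f₂) ; low₈ = down₃ eight f₃ ; low₇ = low₇ 8 (proj₁ f₃) in[ 7 ] f₃ fₜ
        ; match₈ = proj₂ (proj₂ (proj₁ f₃)) ; match₁₆ = proj₂ (proj₂ (proj₁ f₂)) }
      combine eight eight _ _ f₁ f₂ f₃ fₜ = ⊥-elim (clash₁₂ eight f₁ f₂)
      combine eight _ eight _ f₁ f₂ f₃ fₜ = ⊥-elim (clash₁₃ eight f₁ f₃)
      combine eight four four _ f₁ f₂ f₃ fₜ = ⊥-elim (clash₂₃ four f₂ f₃)
      combine eight sixteen _ _ f₁ f₂ f₃ fₜ = notFirst₈ (long (proj₁ f₂)) f₁ (down₂ sixteen f₂)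
      combine eight _ sixteen _ f₁ f₂ f₃ fₜ = notFirst₈ (long (proj₁ f₃)) f₁ (down₃ sixteen f₃)
      combine sixteen sixteen _ _ f₁ f₂ f₃ fₜ = ⊥-elim (clash₁₂ sixteen f₁ f₂)
      combine sixteen _ sixteen _ f₁ f₂ f₃ fₜ = ⊥-elim (clash₁₃ sixteen f₁ f₃)
      combine sixteen four four _ f₁ f₂ f₃ fₜ = ⊥-elim (clash₂₃ four f₂ f₃)
      combine sixteen eight _ _ f₁ f₂ f₃ fₜ = notFirst₁₆ (long (proj₁ f₁)) f₁ (down₂ eight f₂)
      combine sixteen _ eight _ f₁ f₂ f₃ fₜ = notFirst₁₆ (long (proj₁ f₁)) f₁ (down₃ eight f₃)

    facts : Facts
    facts with foundAbove o end 1 ≤-refl (≤-trans (s≤s z≤n) 3≤n) | foundAbove o end 2 (s≤s z≤n) (≤-trans (n≤1+n 2) 3≤n)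
             | foundAbove o end 3 (s≤s z≤n) 3≤n | foundTop o end
    ... | ℓ₁ , f₁ | ℓ₂ , f₂ | ℓ₃ , f₃ | ℓₜ , fₜ = combine
      (good ℓ₁ n≤38 (proj₁ f₁) (proj₁ (proj₂ f₁)))
      (good ℓ₂ n≤38 (proj₁ f₂) (λ { a ia (inj₁ p) → proj₁ (proj₂ f₂) a ia (inj₁ (trans′ p first)) ; a ia (inj₂ refl) → proj₁ (proj₂ f₂) 1 ia (inj₁ first) }))
      (good ℓ₃ n≤38 (proj₁ f₃) (λ { a ia (inj₁ p) → proj₁ (proj₂ f₃) a ia (inj₁ (trans′ p first<third)) ; a ia (inj₂ refl) → proj₁ (proj₂ f₃) 1 ia (inj₁ first<third) }))
      (good ℓₜ n≤38 (proj₁ fₜ) (λ a ia _ → proj₂ fₜ a ia)) f₁ f₂ f₃ fₜ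

-- Length 38

Reverse : ℕ → (ℕ → ℕ) → (ℕ → ℕ) → Set
Reverse n h h′ = ∀ i j → i + j ≡ suc n → 1 ≤ i → 1 ≤ j → h′ i ≡ h j

Rel-reverse : ∀ {n h h′} o → Reverse n h h′ → ∀ i j i′ j′ → i + i′ ≡ suc n → j + j′ ≡ suc n →
              1 ≤ i → 1 ≤ i′ → 1 ≤ j → 1 ≤ j′ → Rel o h′ i j → Rel o h i′ j′
Rel-reverse true  rev i j i′ j′ e e′ 1≤i 1≤i′ 1≤j 1≤j′ = subst₂ _<_ (rev i i′ e 1≤i 1≤i′) (rev j j′ e′ 1≤j 1≤j′)
Rel-reverse false rev i j i′ j′ e e′ 1≤i 1≤i′ 1≤j 1≤j′ = subst₂ _<_ (rev j j′ e′ 1≤j 1≤j′) (rev i i′ e 1≤i 1≤i′)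

module NotThirtyEight {h h′} (end : EndData 38 h) (end′ : EndData 38 h′) (rev : Reverse 38 h h′)
                      (o : Bool) (first : Rel o h 1 2) (second : Rel o h 2 3) where
  open Hard end o first second
  open Facts (facts ≤-refl (m≤m+n 3 35))

  private
    back : ∀ i j {i′ j′} → i + i′ ≡ 39 → j + j′ ≡ 39 → {T (1 ≤ᵇ i)} → {T (1 ≤ᵇ i′)} → {T (1 ≤ᵇ j)} → {T (1 ≤ᵇ j′)} →
           Rel o h′ i j → R i′ j′
    back i j {i′} {j′} e e′ {a} {b} {c} {d} =
      Rel-reverse o rev i j i′ j′ e e′ (≤ᵇ⇒≤ 1 i a) (≤ᵇ⇒≤ 1 i′ b) (≤ᵇ⇒≤ 1 j c) (≤ᵇ⇒≤ 1 j′ d)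

    forth : ∀ i j {i′ j′} → i + i′ ≡ 39 → j + j′ ≡ 39 → {T (1 ≤ᵇ i)} → {T (1 ≤ᵇ i′)} → {T (1 ≤ᵇ j)} → {T (1 ≤ᵇ j′)} →
            R i′ j′ → Rel o h′ i j
    forth i j {i′} {j′} e e′ {a} {b} {c} {d} =
      Rel-reverse o (λ k l k+l 1≤k 1≤l → sym (rev l k (trans (+-comm l k) k+l) 1≤l 1≤k)) i′ j′ i j
        (trans (+-comm i′ i) e) (trans (+-comm j′ j) e′) (≤ᵇ⇒≤ 1 i′ b) (≤ᵇ⇒≤ 1 i a) (≤ᵇ⇒≤ 1 j′ d) (≤ᵇ⇒≤ 1 j c)

    st : ∀ i → {T (1 ≤ᵇ i)} → {T (1 + i ≤ᵇ 38)} → Step i i (1 + i)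
    st i {a} {b} = step i (≤ᵇ⇒≤ 1 i a) (≤ᵇ⇒≤ (1 + i) 38 b)

    low₃₂ : R 34 32
    low₃₂ = falls 7 (s≤s z≤n) (m≤m+n 35 3) (rises 5 (m≤m+n 30 8) (falls 5 (s≤s z≤n) (m≤m+n 27 11)
      (rises 3 (m≤m+n 22 16) (falls 3 (s≤s z≤n) (m≤m+n 19 19) (rises 1 (m≤m+n 14 24) low₈)))))

    high₂₀ : R 20 22
    high₂₀ = rises 3 (m≤m+n 22 16) (falls 3 (s≤s z≤n) (m≤m+n 19 19) (rises 1 (m≤m+n 14 24) low₈))

    -- Index i of `h′` is index 39 - i of `h`. Unless 4 divides ℓ, the steps alone exclude the
    -- square.
    noTop : ∀ ℓ → ¬ FoundTop 38 (Rel o h′) ℓ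
    noTop 0 ((() , _) , _)
    noTop 1 ((s≤s () , _) , _)
    noTop 2 (_ , b) = asym (back 3 2 refl refl (b 1 in[ 1 ])) (st 36)
    noTop 3 (_ , b) = asym (back 4 3 refl refl (b 1 in[ 1 ])) (st 35)
    -- In indices of `h`: e₃₆ < e₃₈ holds by alternation and would be carried to e₃₂ < e₃₄, against
    -- `low₃₂`.
    noTop 4 ((_ , _ , match) , _) = asym low₃₂ (back 7 5 refl refl (match 3 1 in[ 3 ] in[ 1 ] (forth 3 1 refl refl (rises 7 ≤-refl low₃₂))))
    noTop 5 ((_ , _ , match) , _) = asym (back 7 6 refl refl (match 2 1 in[ 2 ] in[ 1 ] (forth 2 1 refl refl (st 37)))) (st 32)
    noTop 6 (_ , b) = asym (back 7 6 refl refl (b 1 in[ 1 ])) (st 32)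
    noTop 7 (_ , b) = asym (back 8 7 refl refl (b 1 in[ 1 ])) (st 31)
    -- The square requires e₂₇ < e₃₁, but the matches of the hard end carry e₇ < e₃ to e₁₅ < e₁₁ and
    -- on to e₃₁ < e₂₇. For ℓ = 16 a single match gives e₂₃ < e₁₉ in the same way.
    noTop 8 (_ , b) = asym (back 12 8 refl refl (b 4 in[ 4 ])) (match₁₆ 15 11 in[ 15 ] in[ 11 ] (match₈ 7 3 in[ 7 ] in[ 3 ] low₇))
    noTop 9 ((_ , _ , match) , _) = asym (back 11 10 refl refl (match 2 1 in[ 2 ] in[ 1 ] (forth 2 1 refl refl (st 37)))) (st 28)
    noTop 10 (_ , b) = asym (back 11 10 refl refl (b 1 in[ 1 ])) (st 28)
    noTop 11 (_ , b) = asym (back 12 11 refl refl (b 1 in[ 1 ])) (st 27)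
    -- Three shifts of 4 reverse the comparison of e₂₀ with e₂₂ into that of e₃₂ with e₃₄, while the
    -- square would equate them.
    noTop 12 ((_ , _ , match) , _) = asym high₂₀ (back 17 19 refl refl (match 5 7 in[ 5 ] in[ 7 ] (forth 5 7 refl refl low₃₂)))
    noTop 13 ((_ , _ , match) , _) = asym (back 15 14 refl refl (match 2 1 in[ 2 ] in[ 1 ] (forth 2 1 refl refl (st 37)))) (st 24)
    noTop 14 (_ , b) = asym (back 15 14 refl refl (b 1 in[ 1 ])) (st 24)
    noTop 15 (_ , b) = asym (back 16 15 refl refl (b 1 in[ 1 ])) (st 23)
    noTop 16 (_ , b) = asym (back 20 16 refl refl (b 4 in[ 4 ])) (match₁₆ 7 3 in[ 7 ] in[ 3 ] low₇)
    noTop 17 ((_ , _ , match) , _) = asym (back 19 18 refl refl (match 2 1 in[ 2 ] in[ 1 ] (forth 2 1 refl refl (st 37)))) (st 20)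
    noTop 18 (_ , b) = asym (back 19 18 refl refl (b 1 in[ 1 ])) (st 20)
    noTop 19 (_ , b) = asym (back 20 19 refl refl (b 1 in[ 1 ])) (st 19)
    noTop (suc (suc (suc (suc (suc (suc (suc (suc (suc (suc (suc (suc (suc (suc (suc (suc (suc (suc (suc (suc ℓ)))))))))))))))))))) ((_ , fits , _) , _) =
      <⇒≱ ≤-refl (≤-trans (+-mono-≤ (m≤m+n 20 ℓ) (m≤m+n 20 ℓ)) fits)

  impossible : ⊥
  impossible with foundTop o end′
  ... | ℓ , f = noTop ℓ f

-- Easy ends

module Easy {n h} (end : EndData n h) (o : Bool) (first : Rel o h 2 1) (second : Rel o h 2 3) where
  open Oriented end o public

  step : ∀ i → 1 ≤ i → 1 + i ≤ n → Step (3 + i) i (1 + i)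
  step = steps 3 first second

  module _ (n≤14 : n ≤ 14) (3≤n : 3 ≤ n) where
    four-only : ∀ ℓ → Found n R ℓ → R (ℓ + 1) ℓ → ℓ ≡ 4
    four-only 0 (() , _) _
    four-only 1 (s≤s () , _) _
    four-only 2 (_ , fits , _) b = ⊥-elim (asym b (step 2 (s≤s z≤n) (s≤s⁻¹ fits)))
    four-only 3 (_ , fits , _) b = ⊥-elim (asym b (step 3 (s≤s z≤n) (lit 4 (s≤s⁻¹ fits))))
    four-only 4 _ _ = refl
    four-only 5 (_ , fits , match) b = ⊥-elim (asym (match 2 1 in[ 2 ] in[ 1 ] first) (step 6 (s≤s z≤n) (lit 7 (s≤s⁻¹ fits))))
    four-only 6 (_ , fits , _) b = ⊥-elim (asym b (step 6 (s≤s z≤n) (lit 7 (s≤s⁻¹ fits))))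
    four-only 7 (_ , fits , _) b = ⊥-elim (asym b (step 7 (s≤s z≤n) (lit 8 (s≤s⁻¹ fits))))
    four-only (suc (suc (suc (suc (suc (suc (suc (suc ℓ)))))))) (_ , fits , _) b =
      contradiction (≤-trans (+-mono-≤ (m≤m+n 8 ℓ) (m≤m+n 8 ℓ)) (≤-trans fits (s≤s n≤14))) (<⇒≱ ≤-refl)

    -- The cuts just above e₁ and above everything both need ℓ = 4. Were e₃ above e₁, they would
    -- disagree on e₄ and e₇; so e₃ < e₁, and the match carries this to e₇ < e₅.
    conclusion : 7 ≤ n × R 3 1 × R 7 5
    conclusion with foundAbove o end 1 ≤-refl (≤-trans (s≤s z≤n) 3≤n) | foundTop o end
    ... | ℓ , f | ℓ′ , f′ with four-only ℓ (proj₁ f) (proj₁ (proj₂ f) 1 (inside (proj₁ (proj₁ f))) (inj₂ refl)) | four-only ℓ′ (proj₁ f′) (proj₂ f′ 1 (inside (proj₁ (proj₁ f′))))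
      where
      inside : ∀ {ℓ} → 2 ≤ ℓ → Inside ℓ 1
      inside 2≤ℓ = ≤-refl , 2≤ℓ
    ... | refl | refl with total 3 1 (s≤s z≤n) 3≤n ≤-refl (≤-trans (s≤s z≤n) 3≤n) (λ ())
    ... | inj₁ low = s≤s⁻¹ (proj₁ (proj₂ (proj₁ f))) , low , proj₂ (proj₂ (proj₁ f)) 3 1 in[ 3 ] in[ 1 ] low
    ... | inj₂ high = ⊥-elim (asym (proj₂ (proj₂ f) 3 in[ 3 ] high) (proj₂ f′ 3 in[ 3 ]))

-- Combining the two ends

oriented : ∀ {n h} → EndData n h → 3 ≤ n → ∃[ o ] Rel o h 2 3
oriented end 3≤n with Oriented.total end true 2 3 (s≤s z≤n) (≤-trans (n≤1+n 2) 3≤n) (s≤s z≤n) 3≤n (λ ())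
... | inj₁ p = true , p
... | inj₂ p = false , p

firstStep : ∀ {n h} → EndData n h → 3 ≤ n → ∀ o → Rel o h 1 2 ⊎ Rel o h 2 1
firstStep end 3≤n o = Oriented.total end o 1 2 ≤-refl (≤-trans (s≤s z≤n) 3≤n) (s≤s z≤n) (≤-trans (n≤1+n 2) 3≤n) (λ ())

tooShort : ∀ {n h} → n ≤ 2 → ¬ EndData n h
tooShort n≤2 end with foundTop true end
... | ℓ , (2≤ℓ , fits , _) , _ = <⇒≱ ≤-refl (≤-trans (+-mono-≤ 2≤ℓ 2≤ℓ) (≤-trans fits (s≤s n≤2)))

reverse-sym : ∀ {n h h′} → Reverse n h h′ → Reverse n h′ h
reverse-sym rev i j i+j 1≤i 1≤j = sym (rev j i (trans (+-comm j i) i+j) 1≤j 1≤i)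

-- The ends are oriented independently: seen from one end, comparisons made at the other are all
-- kept or all reversed.
Rel-cases : ∀ o o′ {h a b c d} → Rel o′ h a b → Rel o′ h c d →
            (Rel o h a b × Rel o h c d) ⊎ (Rel o h b a × Rel o h d c)
Rel-cases true  true  p q = inj₁ (p , q)
Rel-cases true  false p q = inj₂ (p , q)
Rel-cases false true  p q = inj₂ (p , q)
Rel-cases false false p q = inj₁ (p , q)

hard-short : ∀ {n h h′} → EndData n h → EndData n h′ → Reverse n h h′ → 3 ≤ n → n ≤ 30 ⊎ n ≡ 38 →
             ∀ o → Rel o h 1 2 → Rel o h 2 3 → ⊥
hard-short end end′ rev 3≤n (inj₁ n≤30) o first second =
  <⇒≱ (Hard.Facts.long (Hard.facts end o first second (≤-trans n≤30 (m≤m+n 30 8)) 3≤n)) n≤30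
hard-short end end′ rev 3≤n (inj₂ refl) o first second = NotThirtyEight.impossible end end′ rev o first second

module BothEasy {n h h′} (end : EndData n h) (end′ : EndData n h′) (rev : Reverse n h h′) (3≤n : 3 ≤ n)
                (o : Bool) (first : Rel o h 2 1) (second : Rel o h 2 3)
                (o′ : Bool) (first′ : Rel o′ h′ 2 1) (second′ : Rel o′ h′ 2 3) where
  open Easy end o first second

  private
    -- For even `t`, the steps of phases `3 + t` and `t` go the same way, whereas an easy far end
    -- needs a turn at its second entry.
    turn : ∀ t {x y z} → odd? t ≡ false → Step (3 + t) x y → Step t y z → (R y z × R y x) ⊎ (R z y × R x y) → ⊥
    turn 0 _ s u (inj₁ (p , q)) = asym p u
    turn 0 _ s u (inj₂ (p , q)) = asym q s
    turn 2 _ s u (inj₁ (p , q)) = asym q s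
    turn 2 _ s u (inj₂ (p , q)) = asym p u
    turn (suc (suc (suc (suc t)))) eq = turn t (trans (sym (trans (not-involutive _) (not-involutive _))) eq)

  odd-length : odd? n ≢ false
  odd-length eq = atEnd (n ∸ 2) (m+[n∸m]≡n (≤-trans (n≤1+n 2) 3≤n))
    where
    atEnd : ∀ m → 2 + m ≡ n → ⊥
    atEnd m refl = turn m (trans (sym (not-involutive _)) eq) (step m 1≤m (n≤1+n _)) (step (1 + m) (s≤s z≤n) ≤-refl)
      (Rel-cases o o′
        (Rel-reverse o′ rev 2 1 (1 + m) (2 + m) refl refl (s≤s z≤n) (s≤s z≤n) ≤-refl (s≤s z≤n) first′)
        (Rel-reverse o′ rev 2 3 (1 + m) m refl refl (s≤s z≤n) (s≤s z≤n) (s≤s z≤n) 1≤m second′))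
      where
      1≤m : 1 ≤ m
      1≤m = s≤s⁻¹ (s≤s⁻¹ 3≤n)

  not-short : n ≤ 12 → n ≢ 9 → ⊥
  not-short n≤12 n≢9 = clash n refl n≤12 n≢9 (conclusion (≤-trans n≤12 (m≤m+n 12 2)) 3≤n)
    (Easy.conclusion end′ o′ first′ second′ (≤-trans n≤12 (m≤m+n 12 2)) 3≤n)
    where
    -- Reflection takes e₁, e₃ to e₇, e₅ for length 7 and exchanges e₅ with e₇ for length 11. With
    -- equal orientations this contradicts e₇ < e₅; opposite orientations contradict the last step.
    -- For length 9 the pairs do not meet.
    clash : ∀ m → m ≡ n → m ≤ 12 → m ≢ 9 → 7 ≤ n × R 3 1 × R 7 5 → 7 ≤ n × Rel o′ h′ 3 1 × Rel o′ h′ 7 5 → ⊥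
    clash 7 refl _ _ (_ , _ , low) (_ , low₃ , _) with Rel-cases o o′
      (Rel-reverse o′ rev 2 1 6 7 refl refl (s≤s z≤n) (s≤s z≤n) ≤-refl (s≤s z≤n) first′)
      (Rel-reverse o′ rev 3 1 5 7 refl refl (s≤s z≤n) (s≤s z≤n) ≤-refl (s≤s z≤n) low₃)
    ... | inj₁ (_ , p) = asym p low
    ... | inj₂ (p , _) = asym p (step 6 (s≤s z≤n) ≤-refl)
    clash 11 refl _ _ (_ , _ , low) (_ , _ , low₇) with Rel-cases o o′
      (Rel-reverse o′ rev 2 1 10 11 refl refl (s≤s z≤n) (s≤s z≤n) ≤-refl (s≤s z≤n) first′)
      (Rel-reverse o′ rev 7 5 5 7 refl refl (s≤s z≤n) (s≤s z≤n) (s≤s z≤n) (s≤s z≤n) low₇)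
    ... | inj₁ (_ , p) = asym p low
    ... | inj₂ (p , _) = asym p (step 10 (s≤s z≤n) ≤-refl)
    clash 8  refl _ _ _ _ = odd-length refl
    clash 10 refl _ _ _ _ = odd-length refl
    clash 12 refl _ _ _ _ = odd-length refl
    clash 9  refl _ ≢9 _ _ = ≢9 refl
    clash 0 refl _ _ (() , _) _
    clash 1 refl _ _ (s≤s () , _) _
    clash 2 refl _ _ (s≤s (s≤s ()) , _) _
    clash 3 refl _ _ (s≤s (s≤s (s≤s ())) , _) _
    clash 4 refl _ _ (s≤s (s≤s (s≤s (s≤s ()))) , _) _
    clash 5 refl _ _ (s≤s (s≤s (s≤s (s≤s (s≤s ())))) , _) _
    clash 6 refl _ _ (s≤s (s≤s (s≤s (s≤s (s≤s (s≤s ()))))) , _) _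
    clash (suc (suc (suc (suc (suc (suc (suc (suc (suc (suc (suc (suc (suc m))))))))))))) _
      (s≤s (s≤s (s≤s (s≤s (s≤s (s≤s (s≤s (s≤s (s≤s (s≤s (s≤s (s≤s ())))))))))))) _ _ _

impossibleLength : ∀ {n h h′} → EndData n h → EndData n h′ → Reverse n h h′ →
                   n ≢ 9 → n ≤ 30 ⊎ n ≡ 38 → (odd? n ≢ false → n ≤ 12) → ⊥
impossibleLength {n} end end′ rev n≢9 size odd-size with n ≤? 2
... | yes n≤2 = tooShort n≤2 end
... | no n≰2 with oriented end (≰⇒> n≰2) | oriented end′ (≰⇒> n≰2)
...   | o , second | o′ , second′ with firstStep end (≰⇒> n≰2) o | firstStep end′ (≰⇒> n≰2) o′
...     | inj₁ first | _ = hard-short end end′ rev (≰⇒> n≰2) size o first second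
...     | inj₂ _     | inj₁ first′ = hard-short end′ end (reverse-sym rev) (≰⇒> n≰2) size o′ first′ second′
...     | inj₂ first | inj₂ first′ = not-short (odd-size odd-length) n≢9
  where
  open BothEasy end end′ rev (≰⇒> n≰2) o first second o′ first′ second′

lengthOfBicrucial : ∀ {n} → BicrucialOfLength n → n ≡ 9 ⊎ (2 ∤ n × 13 ≤ n) ⊎ (2 ∣ n × 32 ≤ n × n ≢ 38)
lengthOfBicrucial {n} (σ , left , right) = classify (2 ∣? n) (n ≟ 9) (n ≤? 12) (n ≤? 31) (n ≟ 38)
  where
  rev : Reverse n (λ i → at (word σ) (i ∸ 1)) (λ i → at (word σ) (n ∸ i))
  rev i (suc j) i+j 1≤i _ = cong (at (word σ)) (trans (cong (_∸ i) (sym (suc-injective (trans (sym (+-suc i j)) i+j)))) (m+n∸m≡n i j))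
  absurd : n ≢ 9 → n ≤ 30 ⊎ n ≡ 38 → (odd? n ≢ false → n ≤ 12) → ⊥
  absurd = impossibleLength (leftData σ left) (rightData σ right) rev
  classify : Dec (2 ∣ n) → Dec (n ≡ 9) → Dec (n ≤ 12) → Dec (n ≤ 31) → Dec (n ≡ 38) →
             n ≡ 9 ⊎ (2 ∤ n × 13 ≤ n) ⊎ (2 ∣ n × 32 ≤ n × n ≢ 38)
  classify _ (yes n≡9) _ _ _ = inj₁ n≡9
  classify (no 2∤n) (no n≢9) (no n≰12) _ _ = inj₂ (inj₁ (2∤n , ≰⇒> n≰12))
  classify (no 2∤n) (no n≢9) (yes n≤12) _ _ = ⊥-elim (absurd n≢9 (inj₁ (≤-trans n≤12 (m≤m+n 12 18))) (λ _ → n≤12))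
  classify (yes 2∣n) (no n≢9) _ (no n≰31) (no n≢38) = inj₂ (inj₂ (2∣n , ≰⇒> n≰31 , n≢38))
  classify (yes 2∣n) (no n≢9) _ _ (yes n≡38) = ⊥-elim (absurd n≢9 (inj₂ n≡38) (λ ≢false → contradiction (¬-not ≢false) (even⇒¬odd 2∣n)))
  -- A hard end only forces n ≥ 31; the value 31 is excluded by parity.
  classify (yes 2∣n) (no n≢9) _ (yes n≤31) (no n≢38) =
    ⊥-elim (absurd n≢9 (inj₁ (s≤s⁻¹ (≤∧≢⇒< n≤31 λ { refl → even⇒¬odd 2∣n refl }))) (λ ≢false → contradiction (¬-not ≢false) (even⇒¬odd 2∣n)))

theorem3 : (n : ℕ) → 1 ≤ n →
    (Σ[ σ ∈ Permutation′ n ] Bicrucial σ)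
    ⇔ (n ≡ 9 ⊎ (2 ∤ n × 13 ≤ n) ⊎ (2 ∣ n × 32 ≤ n × n ≢ 38))
theorem3 n _ = mk⇔ lengthOfBicrucial bicrucialExists
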